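{- If $\sigma:=\ell\cdot\deg_t(v)>(2n-1)\deg_t(f)$, then $L'=W$, where $L'\subseteq\mathbb{F}_p^{\,r}$ is the intersection of the kernels of the matrices $\tilde A_0,\dots,\tilde A_{n-1}$.
   Context: Let $q=p^w$, $K=\mathbb{F}_q(t)$, $\mathcal{O}=\mathbb{F}_q[t]$. Let $f\in\mathbb{F}_q[t][X]$ be separable of $X$-degree $n\ge2$ with leading coefficient $\ell_f$. Let $v\in\mathbb{F}_q[t]$ be irreducible with $v\nmid\ell_f$ and such that the image of $f$ in $k[X]$, $k=\mathbb{F}_q[t]/(v)$, is squarefree. Let $\mathcal{O}_v$ be the $v$-adic completion of $\mathbb{F}_q[t]$. Write $f=\ell_f f_1\cdots f_r$ with $f_i\in\mathcal{O}_v[X]$ monic irreducible, and $f=\ell_f g_1\cdots g_s$ with $g_j\in\mathbb{F}_q(t)[X]$ monic irreducible; $g_j=f_1^{w_{j,1}}\cdots f_r^{w_{j,r}}$ with $w_{j,i}\in\{0,1\}$; $W\subseteq\mathbb{F}_p^{\,r}$ is the $\mathbb{F}_p$-span of the vectors $(w_{j,1},\dots,w_{j,r})^T$. Fix $\ell\ge1$ and $\sigma=\ell\deg_t v$. For $a\in\mathcal{O}_v$, "$a$ mod $v^\ell$" is the unique element of $\mathbb{F}_q[t]$ of degree $<\sigma$ congruent to $a$ modulo $v^\ell$ (extended coefficientwise to polynomials). Let $\Phi(f_j)=ff_j'/f_j\in\mathcal{O}_v[X]$ and write $\Phi(f_j)\bmod v^\ell=\sum_{i=0}^{n-1}a_{i,j}X^i$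 with $a_{i,j}\in\mathbb{F}_q[t]$. Put $m=\deg_t(f)+1$ and $\phi_m(\sum_kc_kt^k)=(c_m,\dots,c_{\sigma-1})^T\in\mathbb{F}_q^{\sigma-m}$. Let $A_i$ be the $(\sigma-m)\times r$ matrix over $\mathbb{F}_q$ with columns $\phi_m(a_{i,1}),\dots,\phi_m(a_{i,r})$. Fix an $\mathbb{F}_p$-basis $\gamma_1,\dots,\gamma_w$ of $\mathbb{F}_q$ and let $\psi:\mathbb{F}_q\to\mathbb{F}_p^{\,w}$, $\sum c_l\gamma_l\mapsto(c_1,\dots,c_w)^T$. $\tilde A_i$ is the $w(\sigma-m)\times r$ matrix over $\mathbb{F}_p$ obtained by replacing each entry $c$ of $A_i$ by the column $\psi(c)$. -}

module Defs where

open import Algebra.Bundles using (CommutativeRing)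
open import Algebra.Definitions using (AlmostLeftCancellative)
import Algebra.Bundles as Bundles
import Algebra.Definitions.RawSemiring as RawSemiringDefinitions
import Algebra.Properties.AbelianGroup as AbelianGroupProperties
import Algebra.Properties.CommutativeSemigroup as CommutativeSemigroupProperties
import Algebra.Properties.Ring as RingProperties
import Algebra.Properties.Semiring.Divisibility as DivisibilityProperties
import Algebra.Solver.Ring.NaturalCoefficients.Default as Solver
open import Data.Empty using (⊥-elim)
open import Data.Fin.Base using (Fin; toℕ; remQuot)
import Data.Fin.Properties as Finₚ
import Data.Integer.Base as ℤ
import Data.Integer.Properties as ℤₚ
open import Data.List.Base using (List; []; _∷_; map)
open import Data.Nat.Base as ℕ using (ℕ; zero; suc; _≤_; _∸_)
open import Data.Nat.Primality using (Prime)
open import Data.Product.Base using (Σ; ∃; _×_; _,_; proj₁; proj₂)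
open import Data.Sum.Base as Sum using (_⊎_; inj₁; inj₂)
open import Data.Vec.Functional using (Vector)
open import Function.Bundles using (Inverse)
open import Function.Properties.Inverse using (Inverse⇒Injection)
open import Level using (_⊔_) renaming (suc to lsuc)
open import Relation.Binary.Definitions using (Decidable)
import Relation.Binary.PropositionalEquality as ≡
import Relation.Binary.Reasoning.Setoid as SetoidReasoning
open import Relation.Nullary using (yes; no)
open import Relation.Nullary.Decidable using (via-injection)

module RingNotation {a b} (R : CommutativeRing a b) where
  open CommutativeRing R public
  open RawSemiringDefinitions (Bundles.Semiring.rawSemiring semiring) public
    using (sum; product; _^_; _∣_; _∤_; Coprime; Irreducible)
    renaming (_×_ to _·_)

  Squarefree : Carrier → Set (a ⊔ b)
  Squarefree x = ∀ {y} → y * y ∣ x → y ∣ 1#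

  Matrix : ℕ → ℕ → Set a
  Matrix h l = Fin h → Fin l → Carrier

  Kernel : ∀ {h l} → Matrix h l → Vector Carrier l → Set b
  Kernel M x = ∀ i → sum (λ j → M i j * x j) ≈ 0#

  Span : ∀ {s r} → (Fin s → Vector Carrier r) → Vector Carrier r → Set (a ⊔ b)
  Span {s} u x = Σ (Vector Carrier s) λ c → ∀ i → x i ≈ sum (λ j → c j * u j i)

-- A list holds the coefficients from the constant term
-- upwards; trailing zeros are allowed and are invisible to _≈ₚ_.

module Polynomial {a b} (R : CommutativeRing a b) where
  open RingNotation R
  private
    module +-CS = CommutativeSemigroupProperties +-commutativeSemigroup

  Poly : Set a
  Poly = List Carrier

  coeff : Poly → ℕ → Carrier
  coeff []      _       = 0#
  coeff (x ∷ p) zero    = x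
  coeff (x ∷ p) (suc i) = coeff p i

  infix 4 _≈ₚ_
  record _≈ₚ_ (p q : Poly) : Set b where
    constructor mk≈ₚ
    field
      at : ∀ i → coeff p i ≈ coeff q i
  open _≈ₚ_ public

  infixl 6 _+ₚ_
  _+ₚ_ : Poly → Poly → Poly
  []      +ₚ q       = q
  (x ∷ p) +ₚ []      = x ∷ p
  (x ∷ p) +ₚ (y ∷ q) = x + y ∷ p +ₚ q

  scale : Carrier → Poly → Poly
  scale x = map (x *_)

  infixl 7 _*ₚ_
  _*ₚ_ : Poly → Poly → Poly
  []      *ₚ q = []
  (x ∷ p) *ₚ q = scale x q +ₚ (0# ∷ p *ₚ q)

  -ₚ_ : Poly → Poly
  -ₚ_ = map (-_)

  const : Carrier → Poly
  const x = x ∷ []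

  weighted : ℕ → Poly → Poly
  weighted k []      = []
  weighted k (x ∷ p) = k · x ∷ weighted (suc k) p

  derivative : Poly → Poly
  derivative []      = []
  derivative (x ∷ p) = weighted 1 p

  -- p has degree less than d (the zero polynomial included)
  DegreeBelow : Poly → ℕ → Set b
  DegreeBelow p d = ∀ i → d ≤ i → coeff p i ≈ 0#

  HasDegree : Poly → ℕ → Set b
  HasDegree p d = coeff p d ≉ 0# × DegreeBelow p (suc d)

  Monic : Poly → Set b
  Monic p = ∃ λ d → coeff p d ≈ 1# × DegreeBelow p (suc d)

  coeff-+ : ∀ p q i → coeff (p +ₚ q) i ≈ coeff p i + coeff q i
  coeff-+ []      q       i       = sym (+-identityˡ _)
  coeff-+ (x ∷ p) []      i       = sym (+-identityʳ _)
  coeff-+ (x ∷ p) (y ∷ q) zero    = refl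
  coeff-+ (x ∷ p) (y ∷ q) (suc i) = coeff-+ p q i

  coeff-scale : ∀ x p i → coeff (scale x p) i ≈ x * coeff p i
  coeff-scale x []      i       = sym (zeroʳ x)
  coeff-scale x (y ∷ p) zero    = refl
  coeff-scale x (y ∷ p) (suc i) = coeff-scale x p i

  coeff-neg : ∀ p i → coeff (-ₚ p) i ≈ - coeff p i
  coeff-neg []      i       = sym ε⁻¹≈ε
    where open AbelianGroupProperties +-abelianGroup
  coeff-neg (x ∷ p) zero    = refl
  coeff-neg (x ∷ p) (suc i) = coeff-neg p i

  reflₚ : ∀ {p} → p ≈ₚ p
  reflₚ .at i = refl

  symₚ : ∀ {p q} → p ≈ₚ q → q ≈ₚ p
  symₚ e .at i = sym (e .at i)

  transₚ : ∀ {p q r} → p ≈ₚ q → q ≈ₚ r → p ≈ₚ r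
  transₚ e f .at i = trans (e .at i) (f .at i)

  ∷-cong : ∀ {x y p q} → x ≈ y → p ≈ₚ q → x ∷ p ≈ₚ y ∷ q
  ∷-cong e f .at zero    = e
  ∷-cong e f .at (suc i) = f .at i

  tail-cong : ∀ {x y p q} → x ∷ p ≈ₚ y ∷ q → p ≈ₚ q
  tail-cong e .at i = e .at (suc i)

  tail-zero : ∀ {x p} → x ∷ p ≈ₚ [] → p ≈ₚ []
  tail-zero e .at i = e .at (suc i)

  +ₚ-cong : ∀ {p p′ q q′} → p ≈ₚ p′ → q ≈ₚ q′ → p +ₚ q ≈ₚ p′ +ₚ q′
  +ₚ-cong {p} {p′} {q} {q′} e f .at i =
    trans (coeff-+ p q i) (trans (+-cong (e .at i) (f .at i)) (sym (coeff-+ p′ q′ i)))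

  +ₚ-assoc : ∀ p q r → (p +ₚ q) +ₚ r ≈ₚ p +ₚ (q +ₚ r)
  +ₚ-assoc p q r .at i = begin
    coeff ((p +ₚ q) +ₚ r) i               ≈⟨ coeff-+ (p +ₚ q) r i ⟩
    coeff (p +ₚ q) i + coeff r i          ≈⟨ +-congʳ (coeff-+ p q i) ⟩
    coeff p i + coeff q i + coeff r i     ≈⟨ +-assoc _ _ _ ⟩
    coeff p i + (coeff q i + coeff r i)   ≈⟨ +-congˡ (coeff-+ q r i) ⟨
    coeff p i + coeff (q +ₚ r) i          ≈⟨ coeff-+ p (q +ₚ r) i ⟨
    coeff (p +ₚ (q +ₚ r)) i               ∎
    where open SetoidReasoning setoid

  +ₚ-comm : ∀ p q → p +ₚ q ≈ₚ q +ₚ p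
  +ₚ-comm p q .at i =
    trans (coeff-+ p q i) (trans (+-comm _ _) (sym (coeff-+ q p i)))

  +ₚ-identityʳ : ∀ p → p +ₚ [] ≈ₚ p
  +ₚ-identityʳ []      = reflₚ
  +ₚ-identityʳ (x ∷ p) = reflₚ

  -ₚ-cong : ∀ {p q} → p ≈ₚ q → -ₚ p ≈ₚ -ₚ q
  -ₚ-cong {p} {q} e .at i =
    trans (coeff-neg p i) (trans (-‿cong (e .at i)) (sym (coeff-neg q i)))

  -ₚ-inverseʳ : ∀ p → p +ₚ (-ₚ p) ≈ₚ []
  -ₚ-inverseʳ p .at i =
    trans (coeff-+ p (-ₚ p) i) (trans (+-congˡ (coeff-neg p i)) (-‿inverseʳ _))

  +ₚ-abelianGroup : Bundles.AbelianGroup a b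
  +ₚ-abelianGroup = record
    { Carrier = Poly ; _≈_ = _≈ₚ_ ; _∙_ = _+ₚ_ ; ε = [] ; _⁻¹ = -ₚ_
    ; isAbelianGroup = record
      { isGroup = record
        { isMonoid = record
          { isSemigroup = record
            { isMagma = record
              { isEquivalence = record { refl = reflₚ ; sym = symₚ ; trans = transₚ }
              ; ∙-cong = +ₚ-cong
              }
            ; assoc = +ₚ-assoc
            }
          ; identity = (λ _ → reflₚ) , +ₚ-identityʳ
          }
        ; inverse = (λ p → transₚ (+ₚ-comm (-ₚ p) p) (-ₚ-inverseʳ p)) , -ₚ-inverseʳ
        ; ⁻¹-cong = -ₚ-cong
        }
      ; comm = +ₚ-comm
      }
    }

  module G = Bundles.AbelianGroup +ₚ-abelianGroup
  module +ₚ-CS = CommutativeSemigroupProperties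
    (Bundles.CommutativeMonoid.commutativeSemigroup G.commutativeMonoid)

  scale-cong : ∀ {x y p q} → x ≈ y → p ≈ₚ q → scale x p ≈ₚ scale y q
  scale-cong {x} {y} {p} {q} e f .at i =
    trans (coeff-scale x p i) (trans (*-cong e (f .at i)) (sym (coeff-scale y q i)))

  scale-+ : ∀ x p q → scale x (p +ₚ q) ≈ₚ scale x p +ₚ scale x q
  scale-+ x p q .at i = begin
    coeff (scale x (p +ₚ q)) i                    ≈⟨ coeff-scale x (p +ₚ q) i ⟩
    x * coeff (p +ₚ q) i                          ≈⟨ *-congˡ (coeff-+ p q i) ⟩
    x * (coeff p i + coeff q i)                   ≈⟨ distribˡ _ _ _ ⟩
    x * coeff p i + x * coeff q i                 ≈⟨ +-cong (coeff-scale x p i) (coeff-scale x q i) ⟨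
    coeff (scale x p) i + coeff (scale x q) i     ≈⟨ coeff-+ (scale x p) (scale x q) i ⟨
    coeff (scale x p +ₚ scale x q) i              ∎
    where open SetoidReasoning setoid

  +-scale : ∀ x y p → scale (x + y) p ≈ₚ scale x p +ₚ scale y p
  +-scale x y p .at i = begin
    coeff (scale (x + y) p) i                     ≈⟨ coeff-scale (x + y) p i ⟩
    (x + y) * coeff p i                           ≈⟨ distribʳ _ _ _ ⟩
    x * coeff p i + y * coeff p i                 ≈⟨ +-cong (coeff-scale x p i) (coeff-scale y p i) ⟨
    coeff (scale x p) i + coeff (scale y p) i     ≈⟨ coeff-+ (scale x p) (scale y p) i ⟨
    coeff (scale x p +ₚ scale y p) i              ∎
    where open SetoidReasoning setoid

  scale-scale : ∀ x y p → scale (x * y) p ≈ₚ scale x (scale y p)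
  scale-scale x y p .at i = begin
    coeff (scale (x * y) p) i       ≈⟨ coeff-scale (x * y) p i ⟩
    x * y * coeff p i               ≈⟨ *-assoc _ _ _ ⟩
    x * (y * coeff p i)             ≈⟨ *-congˡ (coeff-scale y p i) ⟨
    x * coeff (scale y p) i         ≈⟨ coeff-scale x (scale y p) i ⟨
    coeff (scale x (scale y p)) i   ∎
    where open SetoidReasoning setoid

  scale-zero : ∀ {x} p → x ≈ 0# → scale x p ≈ₚ []
  scale-zero {x} p e .at i =
    trans (coeff-scale x p i) (trans (*-congʳ e) (zeroˡ _))

  scale-one : ∀ p → scale 1# p ≈ₚ p
  scale-one p .at i = trans (coeff-scale 1# p i) (*-identityˡ _)

  0∷[]≈[] : 0# ∷ [] ≈ₚ []
  0∷[]≈[] .at zero    = refl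
  0∷[]≈[] .at (suc i) = refl

  0∷-zero : ∀ {p} → p ≈ₚ [] → 0# ∷ p ≈ₚ []
  0∷-zero e = transₚ (∷-cong refl e) 0∷[]≈[]

  *ₚ-congˡ : ∀ p {q q′} → q ≈ₚ q′ → p *ₚ q ≈ₚ p *ₚ q′
  *ₚ-congˡ []      e = reflₚ
  *ₚ-congˡ (x ∷ p) e = +ₚ-cong (scale-cong refl e) (∷-cong refl (*ₚ-congˡ p e))

  *ₚ-zeroʳ : ∀ p → p *ₚ [] ≈ₚ []
  *ₚ-zeroʳ []      = reflₚ
  *ₚ-zeroʳ (x ∷ p) = 0∷-zero (*ₚ-zeroʳ p)

  *ₚ-∷ : ∀ p y q → p *ₚ (y ∷ q) ≈ₚ scale y p +ₚ (0# ∷ p *ₚ q)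
  *ₚ-∷ []      y q = symₚ 0∷[]≈[]
  *ₚ-∷ (x ∷ p) y q = ∷-cong (+-congʳ (*-comm x y)) (begin
    scale x q +ₚ p *ₚ (y ∷ q)                       ≈⟨ G.∙-congˡ (*ₚ-∷ p y q) ⟩
    scale x q +ₚ (scale y p +ₚ (0# ∷ p *ₚ q))       ≈⟨ +ₚ-CS.x∙yz≈y∙xz (scale x q) (scale y p) (0# ∷ p *ₚ q) ⟩
    scale y p +ₚ (scale x q +ₚ (0# ∷ p *ₚ q))       ∎)
    where open SetoidReasoning G.setoid

  *ₚ-comm : ∀ p q → p *ₚ q ≈ₚ q *ₚ p
  *ₚ-comm []      q = symₚ (*ₚ-zeroʳ q)
  *ₚ-comm (x ∷ p) q = begin
    scale x q +ₚ (0# ∷ p *ₚ q)   ≈⟨ G.∙-congˡ (∷-cong refl (*ₚ-comm p q)) ⟩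
    scale x q +ₚ (0# ∷ q *ₚ p)   ≈⟨ *ₚ-∷ q x p ⟨
    q *ₚ (x ∷ p)                 ∎
    where open SetoidReasoning G.setoid

  *ₚ-cong : ∀ {p p′ q q′} → p ≈ₚ p′ → q ≈ₚ q′ → p *ₚ q ≈ₚ p′ *ₚ q′
  *ₚ-cong {p} {p′} {q} {q′} e f = begin
    p *ₚ q    ≈⟨ *ₚ-congˡ p f ⟩
    p *ₚ q′   ≈⟨ *ₚ-comm p q′ ⟩
    q′ *ₚ p   ≈⟨ *ₚ-congˡ q′ e ⟩
    q′ *ₚ p′  ≈⟨ *ₚ-comm q′ p′ ⟩
    p′ *ₚ q′  ∎
    where open SetoidReasoning G.setoid

  0∷-+ : ∀ p q → 0# ∷ (p +ₚ q) ≈ₚ (0# ∷ p) +ₚ (0# ∷ q)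
  0∷-+ p q = ∷-cong (sym (+-identityˡ 0#)) reflₚ

  *ₚ-distribˡ : ∀ p q r → p *ₚ (q +ₚ r) ≈ₚ p *ₚ q +ₚ p *ₚ r
  *ₚ-distribˡ []      q r = reflₚ
  *ₚ-distribˡ (x ∷ p) q r = begin
    scale x (q +ₚ r) +ₚ (0# ∷ p *ₚ (q +ₚ r))
      ≈⟨ G.∙-cong (scale-+ x q r) (∷-cong refl (*ₚ-distribˡ p q r)) ⟩
    (scale x q +ₚ scale x r) +ₚ (0# ∷ (p *ₚ q +ₚ p *ₚ r))
      ≈⟨ G.∙-congˡ (0∷-+ (p *ₚ q) (p *ₚ r)) ⟩
    (scale x q +ₚ scale x r) +ₚ ((0# ∷ p *ₚ q) +ₚ (0# ∷ p *ₚ r))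
      ≈⟨ +ₚ-CS.interchange (scale x q) (scale x r) (0# ∷ p *ₚ q) (0# ∷ p *ₚ r) ⟩
    (scale x q +ₚ (0# ∷ p *ₚ q)) +ₚ (scale x r +ₚ (0# ∷ p *ₚ r)) ∎
    where open SetoidReasoning G.setoid

  *ₚ-distribʳ : ∀ p q r → (q +ₚ r) *ₚ p ≈ₚ q *ₚ p +ₚ r *ₚ p
  *ₚ-distribʳ p q r = begin
    (q +ₚ r) *ₚ p       ≈⟨ *ₚ-comm (q +ₚ r) p ⟩
    p *ₚ (q +ₚ r)       ≈⟨ *ₚ-distribˡ p q r ⟩
    p *ₚ q +ₚ p *ₚ r    ≈⟨ G.∙-cong (*ₚ-comm p q) (*ₚ-comm p r) ⟩
    q *ₚ p +ₚ r *ₚ p    ∎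
    where open SetoidReasoning G.setoid

  scale-* : ∀ x p q → scale x p *ₚ q ≈ₚ scale x (p *ₚ q)
  scale-* x []      q = reflₚ
  scale-* x (y ∷ p) q = begin
    scale (x * y) q +ₚ (0# ∷ scale x p *ₚ q)
      ≈⟨ G.∙-cong (scale-scale x y q) (∷-cong (sym (zeroʳ x)) (scale-* x p q)) ⟩
    scale x (scale y q) +ₚ scale x (0# ∷ p *ₚ q)
      ≈⟨ scale-+ x (scale y q) (0# ∷ p *ₚ q) ⟨
    scale x (scale y q +ₚ (0# ∷ p *ₚ q)) ∎
    where open SetoidReasoning G.setoid

  0∷-* : ∀ p q → (0# ∷ p) *ₚ q ≈ₚ 0# ∷ p *ₚ q
  0∷-* p q = G.∙-congʳ (scale-zero q refl)

  *ₚ-assoc : ∀ p q r → (p *ₚ q) *ₚ r ≈ₚ p *ₚ (q *ₚ r)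
  *ₚ-assoc []      q r = reflₚ
  *ₚ-assoc (x ∷ p) q r = begin
    (scale x q +ₚ (0# ∷ p *ₚ q)) *ₚ r
      ≈⟨ *ₚ-distribʳ r (scale x q) (0# ∷ p *ₚ q) ⟩
    scale x q *ₚ r +ₚ (0# ∷ p *ₚ q) *ₚ r
      ≈⟨ G.∙-cong (scale-* x q r) (0∷-* (p *ₚ q) r) ⟩
    scale x (q *ₚ r) +ₚ (0# ∷ (p *ₚ q) *ₚ r)
      ≈⟨ G.∙-congˡ (∷-cong refl (*ₚ-assoc p q r)) ⟩
    scale x (q *ₚ r) +ₚ (0# ∷ p *ₚ (q *ₚ r)) ∎
    where open SetoidReasoning G.setoid

  *ₚ-identityˡ : ∀ p → (1# ∷ []) *ₚ p ≈ₚ p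
  *ₚ-identityˡ p = begin
    scale 1# p +ₚ (0# ∷ [])   ≈⟨ G.∙-cong (scale-one p) 0∷[]≈[] ⟩
    p +ₚ []                   ≈⟨ +ₚ-identityʳ p ⟩
    p                         ∎
    where open SetoidReasoning G.setoid

  polynomialRing : CommutativeRing a b
  polynomialRing = record
    { Carrier = Poly ; _≈_ = _≈ₚ_ ; _+_ = _+ₚ_ ; _*_ = _*ₚ_ ; -_ = -ₚ_
    ; 0# = [] ; 1# = 1# ∷ []
    ; isCommutativeRing = record
      { isRing = record
        { +-isAbelianGroup = G.isAbelianGroup
        ; *-cong = *ₚ-cong
        ; *-assoc = *ₚ-assoc
        ; *-identity = *ₚ-identityˡ
                     , λ p → transₚ (*ₚ-comm p (1# ∷ [])) (*ₚ-identityˡ p)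
        ; distrib = *ₚ-distribˡ , *ₚ-distribʳ
        }
      ; *-comm = *ₚ-comm
      }
    }

  module NoZeroDivisors
    (zero-product : ∀ x y → x * y ≈ 0# → x ≈ 0# ⊎ y ≈ 0#) where

    zero-∷ : ∀ {x p} → x ≈ 0# → p ≈ₚ [] → x ∷ p ≈ₚ []
    zero-∷ e f = transₚ (∷-cong e reflₚ) (0∷-zero f)

    headZero : ∀ {x} p q → x ≈ 0# → (x ∷ p) *ₚ q ≈ₚ [] → p *ₚ q ≈ₚ []
    headZero p q e f =
      tail-zero (transₚ (symₚ (+ₚ-cong (scale-zero q e) reflₚ)) f)

    headZeroʳ : ∀ p {y} q → y ≈ 0# → p *ₚ (y ∷ q) ≈ₚ [] → p *ₚ q ≈ₚ []
    headZeroʳ p {y} q e f = transₚ (*ₚ-comm p q)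
      (headZero q p e (transₚ (*ₚ-comm (y ∷ q) p) f))

    zero-productₚ : ∀ p q → p *ₚ q ≈ₚ [] → p ≈ₚ [] ⊎ q ≈ₚ []
    zero-productₚ []      q       e = inj₁ reflₚ
    zero-productₚ (x ∷ p) []      e = inj₂ reflₚ
    zero-productₚ (x ∷ p) (y ∷ q) e = Sum.[
      (λ x≈0 → Sum.map₁ (zero-∷ x≈0)
        (zero-productₚ p (y ∷ q) (headZero p (y ∷ q) x≈0 e))) ,
      (λ y≈0 → Sum.map₂ (zero-∷ y≈0)
        (zero-productₚ (x ∷ p) q (headZeroʳ (x ∷ p) q y≈0 e)))
      ]′ (zero-product x y (trans (sym (+-identityʳ _)) (e .at 0)))

module PolynomialNotation {a b} (R : CommutativeRing a b) where
  open Polynomial R public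
    using (coeff; const; derivative; DegreeBelow; HasDegree; Monic; polynomialRing)
  open RingNotation polynomialRing public

-- R/(v), with the carrier of R and congruence modulo v as equality

module Quotient {a b} (R : CommutativeRing a b) (v : CommutativeRing.Carrier R) where
  open RingNotation R
  private
    module RP = RingProperties ring
    module AG = AbelianGroupProperties +-abelianGroup
    module D = DivisibilityProperties semiring
    module +-CS = CommutativeSemigroupProperties +-commutativeSemigroup

  infix 4 _≡ᵥ_
  record _≡ᵥ_ (x y : Carrier) : Set (a ⊔ b) where
    constructor mk≡ᵥ
    field
      divides : v ∣ x - y
  open _≡ᵥ_ public

  ∣-+ : ∀ {x y} → v ∣ x → v ∣ y → v ∣ x + y
  ∣-+ (p D., e) (q D., f) = (p + q) D., trans (distribʳ _ _ _) (+-cong e f)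

  ∣-neg : ∀ {x} → v ∣ x → v ∣ - x
  ∣-neg (p D., e) = (- p) D., trans (sym (RP.-‿distribˡ-* _ _)) (-‿cong e)

  ∣-*ˡ : ∀ {x} y → v ∣ x → v ∣ y * x
  ∣-*ˡ y (p D., e) = (y * p) D., trans (*-assoc _ _ _) (*-congˡ e)

  ∣-≈ : ∀ {x y} → x ≈ y → v ∣ x → v ∣ y
  ∣-≈ e (p D., f) = p D., trans f e

  cancelMid : ∀ x y z → (x - y) + (y - z) ≈ x - z
  cancelMid x y z = begin
    (x - y) + (y - z)       ≈⟨ +-assoc _ _ _ ⟩
    x + (- y + (y - z))     ≈⟨ +-congˡ (+-assoc _ _ _) ⟨
    x + ((- y + y) - z)     ≈⟨ +-congˡ (+-congʳ (-‿inverseˡ y)) ⟩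
    x + (0# - z)            ≈⟨ +-congˡ (+-identityˡ _) ⟩
    x - z                   ∎
    where open SetoidReasoning setoid

  fromEq : ∀ {x y} → x ≈ y → x ≡ᵥ y
  fromEq {x} {y} e .divides = 0# D., trans (zeroˡ v) (sym (AG.x≈y⇒x∙y⁻¹≈ε e))

  symᵥ : ∀ {x y} → x ≡ᵥ y → y ≡ᵥ x
  symᵥ {x} {y} e .divides = ∣-≈ (AG.⁻¹-anti-homo‿- x y) (∣-neg (divides e))

  transᵥ : ∀ {x y z} → x ≡ᵥ y → y ≡ᵥ z → x ≡ᵥ z
  transᵥ {x} {y} {z} e f .divides = ∣-≈ (cancelMid x y z) (∣-+ (divides e) (divides f))

  +-congᵥ : ∀ {x x′ y y′} → x ≡ᵥ x′ → y ≡ᵥ y′ → x + y ≡ᵥ x′ + y′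
  +-congᵥ {x} {x′} {y} {y′} e f .divides = ∣-≈
    (trans (+-CS.interchange x (- x′) y (- y′)) (+-congˡ (AG.⁻¹-∙-comm x′ y′)))
    (∣-+ (divides e) (divides f))

  *-congˡᵥ : ∀ x {y y′} → y ≡ᵥ y′ → x * y ≡ᵥ x * y′
  *-congˡᵥ x {y} {y′} e .divides = ∣-≈ (RP.x[y-z]≈xy-xz x y y′) (∣-*ˡ x (divides e))

  *-congᵥ : ∀ {x x′ y y′} → x ≡ᵥ x′ → y ≡ᵥ y′ → x * y ≡ᵥ x′ * y′
  *-congᵥ {x} {x′} {y} {y′} e f =
    transᵥ (*-congˡᵥ x f)
      (transᵥ (fromEq (*-comm x y′)) (transᵥ (*-congˡᵥ y′ e) (fromEq (*-comm y′ x′))))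

  -‿congᵥ : ∀ {x y} → x ≡ᵥ y → - x ≡ᵥ - y
  -‿congᵥ {x} {y} e .divides = ∣-≈ (sym (AG.⁻¹-∙-comm x (- y))) (∣-neg (divides e))

  quotientRing : CommutativeRing a (a ⊔ b)
  quotientRing = record
    { Carrier = Carrier ; _≈_ = _≡ᵥ_ ; _+_ = _+_ ; _*_ = _*_ ; -_ = -_
    ; 0# = 0# ; 1# = 1#
    ; isCommutativeRing = record
      { isRing = record
        { +-isAbelianGroup = record
          { isGroup = record
            { isMonoid = record
              { isSemigroup = record
                { isMagma = record
                  { isEquivalence = record { refl = fromEq refl ; sym = symᵥ ; trans = transᵥ }
                  ; ∙-cong = +-congᵥ
                  }
                ; assoc = λ x y z → fromEq (+-assoc x y z)
                }
              ; identity = (λ x → fromEq (+-identityˡ x)) , (λ x → fromEq (+-identityʳ x))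
              }
            ; inverse = (λ x → fromEq (-‿inverseˡ x)) , (λ x → fromEq (-‿inverseʳ x))
            ; ⁻¹-cong = -‿congᵥ
            }
          ; comm = λ x y → fromEq (+-comm x y)
          }
        ; *-cong = *-congᵥ
        ; *-assoc = λ x y z → fromEq (*-assoc x y z)
        ; *-identity = (λ x → fromEq (*-identityˡ x)) , (λ x → fromEq (*-identityʳ x))
        ; distrib = (λ x y z → fromEq (distribˡ x y z)) , (λ x y z → fromEq (distribʳ x y z))
        }
      ; *-comm = λ x y → fromEq (*-comm x y)
      }
    }

-- The v-adic completion of R, as the inverse limit of the R/(v ^ k)

module Completion {a b} (R : CommutativeRing a b) (v : CommutativeRing.Carrier R) where
  open RingNotation R
  private
    module Q (k : ℕ) = CommutativeRing (Quotient.quotientRing R (v ^ k))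

  record Adic : Set (a ⊔ b) where
    field
      seq      : ℕ → Carrier
      coherent : ∀ k → Q._≈_ k (seq (suc k)) (seq k)
  open Adic public

  infix 4 _≈ᵥ_
  record _≈ᵥ_ (x y : Adic) : Set (a ⊔ b) where
    constructor mk≈ᵥ
    field
      mod : ∀ k → Q._≈_ k (seq x k) (seq y k)
  open _≈ᵥ_ public

  ι : Carrier → Adic
  ι x .seq      _ = x
  ι x .coherent k = Q.refl k

  infixl 6 _+ᵥ_
  _+ᵥ_ : Adic → Adic → Adic
  (x +ᵥ y) .seq      k = seq x k + seq y k
  (x +ᵥ y) .coherent k = Q.+-cong k (coherent x k) (coherent y k)

  infixl 7 _*ᵥ_
  _*ᵥ_ : Adic → Adic → Adic
  (x *ᵥ y) .seq      k = seq x k * seq y k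
  (x *ᵥ y) .coherent k = Q.*-cong k (coherent x k) (coherent y k)

  -ᵥ_ : Adic → Adic
  (-ᵥ x) .seq      k = - seq x k
  (-ᵥ x) .coherent k = Q.-‿cong k (coherent x k)

  completionRing : CommutativeRing (a ⊔ b) (a ⊔ b)
  completionRing = record
    { Carrier = Adic ; _≈_ = _≈ᵥ_ ; _+_ = _+ᵥ_ ; _*_ = _*ᵥ_ ; -_ = -ᵥ_
    ; 0# = ι 0# ; 1# = ι 1#
    ; isCommutativeRing = record
      { isRing = record
        { +-isAbelianGroup = record
          { isGroup = record
            { isMonoid = record
              { isSemigroup = record
                { isMagma = record
                  { isEquivalence = record
                    { refl  = mk≈ᵥ λ k → Q.refl k
                    ; sym   = λ e → mk≈ᵥ λ k → Q.sym k (mod e k)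
                    ; trans = λ e f → mk≈ᵥ λ k → Q.trans k (mod e k) (mod f k)
                    }
                  ; ∙-cong = λ e f → mk≈ᵥ λ k → Q.+-cong k (mod e k) (mod f k)
                  }
                ; assoc = λ x y z → mk≈ᵥ λ k → Q.+-assoc k _ _ _
                }
              ; identity = (λ x → mk≈ᵥ λ k → Q.+-identityˡ k _)
                         , (λ x → mk≈ᵥ λ k → Q.+-identityʳ k _)
              }
            ; inverse = (λ x → mk≈ᵥ λ k → Q.-‿inverseˡ k _)
                      , (λ x → mk≈ᵥ λ k → Q.-‿inverseʳ k _)
            ; ⁻¹-cong = λ e → mk≈ᵥ λ k → Q.-‿cong k (mod e k)
            }
          ; comm = λ x y → mk≈ᵥ λ k → Q.+-comm k _ _
          }
        ; *-cong = λ e f → mk≈ᵥ λ k → Q.*-cong k (mod e k) (mod f k)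
        ; *-assoc = λ x y z → mk≈ᵥ λ k → Q.*-assoc k _ _ _
        ; *-identity = (λ x → mk≈ᵥ λ k → Q.*-identityˡ k _)
                     , (λ x → mk≈ᵥ λ k → Q.*-identityʳ k _)
        ; distrib = (λ x y z → mk≈ᵥ λ k → Q.distribˡ k _ _ _)
                  , (λ x y z → mk≈ᵥ λ k → Q.distribʳ k _ _ _)
        }
      ; *-comm = λ x y → mk≈ᵥ λ k → Q.*-comm k _ _
      }
    }

module Fractions {a b} (R : CommutativeRing a b)
  (1≉0 : CommutativeRing._≉_ R (CommutativeRing.1# R) (CommutativeRing.0# R))
  (cancel : AlmostLeftCancellative (CommutativeRing._≈_ R) (CommutativeRing.0# R)
              (CommutativeRing._*_ R))
  where

  open CommutativeRing R
  private
    module S = Solver commutativeSemiring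
  open S using () renaming (_:+_ to _⊕_; _:*_ to _⊗_; _:=_ to _⊜_)

  record Fraction : Set (a ⊔ b) where
    constructor mkFraction
    field
      num   : Carrier
      den   : Carrier
      den≉0 : den ≉ 0#
  open Fraction public

  infix 4 _≈ᶠ_
  record _≈ᶠ_ (x y : Fraction) : Set b where
    constructor mk≈ᶠ
    field
      cross : num x * den y ≈ num y * den x
  open _≈ᶠ_ public

  *-≉0 : ∀ {x y} → x ≉ 0# → y ≉ 0# → x * y ≉ 0#
  *-≉0 {x} {y} x≉0 y≉0 e = y≉0 (cancel x y 0# x≉0 (trans e (sym (zeroʳ x))))

  infixl 6 _+ᶠ_
  _+ᶠ_ : Fraction → Fraction → Fraction
  mkFraction m d d≉0 +ᶠ mkFraction n e e≉0 =
    mkFraction (m * e + n * d) (d * e) (*-≉0 d≉0 e≉0)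

  infixl 7 _*ᶠ_
  _*ᶠ_ : Fraction → Fraction → Fraction
  mkFraction m d d≉0 *ᶠ mkFraction n e e≉0 =
    mkFraction (m * n) (d * e) (*-≉0 d≉0 e≉0)

  -ᶠ_ : Fraction → Fraction
  -ᶠ mkFraction m d d≉0 = mkFraction (- m) d d≉0

  κ : Carrier → Fraction
  κ x = mkFraction x 1# 1≉0

  open SetoidReasoning setoid

  transᶠ : ∀ {x y z} → x ≈ᶠ y → y ≈ᶠ z → x ≈ᶠ z
  transᶠ {mkFraction m d _} {mkFraction n e e≉0} {mkFraction o f _} p q .cross =
    cancel e _ _ e≉0 (begin
      e * (m * f)   ≈⟨ S.solve 3 (λ e m f → (e ⊗ (m ⊗ f)) ⊜ (f ⊗ (m ⊗ e))) refl e m f ⟩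
      f * (m * e)   ≈⟨ *-congˡ (cross p) ⟩
      f * (n * d)   ≈⟨ S.solve 3 (λ f n d → (f ⊗ (n ⊗ d)) ⊜ (d ⊗ (n ⊗ f))) refl f n d ⟩
      d * (n * f)   ≈⟨ *-congˡ (cross q) ⟩
      d * (o * e)   ≈⟨ S.solve 3 (λ d o e → (d ⊗ (o ⊗ e)) ⊜ (e ⊗ (o ⊗ d))) refl d o e ⟩
      e * (o * d)   ∎)

  +ᶠ-cong : ∀ {x x′ y y′} → x ≈ᶠ x′ → y ≈ᶠ y′ → x +ᶠ y ≈ᶠ x′ +ᶠ y′
  +ᶠ-cong {mkFraction m d _} {mkFraction m′ d′ _} {mkFraction n e _} {mkFraction n′ e′ _} p q .cross =
    begin
      (m * e + n * d) * (d′ * e′)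
        ≈⟨ S.solve 6 (λ m d d′ n e e′ →
             ((m ⊗ e ⊕ n ⊗ d) ⊗ (d′ ⊗ e′)) ⊜ ((m ⊗ d′) ⊗ (e ⊗ e′) ⊕ (n ⊗ e′) ⊗ (d ⊗ d′)))
             refl m d d′ n e e′ ⟩
      (m * d′) * (e * e′) + (n * e′) * (d * d′)
        ≈⟨ +-cong (*-congʳ (cross p)) (*-congʳ (cross q)) ⟩
      (m′ * d) * (e * e′) + (n′ * e) * (d * d′)
        ≈⟨ S.solve 6 (λ m′ d d′ n′ e e′ →
             ((m′ ⊗ d) ⊗ (e ⊗ e′) ⊕ (n′ ⊗ e) ⊗ (d ⊗ d′)) ⊜ ((m′ ⊗ e′ ⊕ n′ ⊗ d′) ⊗ (d ⊗ e)))
             refl m′ d d′ n′ e e′ ⟩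
      (m′ * e′ + n′ * d′) * (d * e) ∎

  *ᶠ-cong : ∀ {x x′ y y′} → x ≈ᶠ x′ → y ≈ᶠ y′ → x *ᶠ y ≈ᶠ x′ *ᶠ y′
  *ᶠ-cong {mkFraction m d _} {mkFraction m′ d′ _} {mkFraction n e _} {mkFraction n′ e′ _} p q .cross =
    begin
      (m * n) * (d′ * e′)
        ≈⟨ S.solve 4 (λ m n d′ e′ → ((m ⊗ n) ⊗ (d′ ⊗ e′)) ⊜ ((m ⊗ d′) ⊗ (n ⊗ e′))) refl m n d′ e′ ⟩
      (m * d′) * (n * e′)
        ≈⟨ *-cong (cross p) (cross q) ⟩
      (m′ * d) * (n′ * e)
        ≈⟨ S.solve 4 (λ m n d e → ((m ⊗ d) ⊗ (n ⊗ e)) ⊜ ((m ⊗ n) ⊗ (d ⊗ e))) refl m′ n′ d e ⟩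
      (m′ * n′) * (d * e) ∎

  -ᶠ-cong : ∀ {x y} → x ≈ᶠ y → -ᶠ x ≈ᶠ -ᶠ y
  -ᶠ-cong {mkFraction m d _} {mkFraction n e _} p .cross =
    trans (sym (-‿distribˡ-* m e)) (trans (-‿cong (cross p)) (-‿distribˡ-* n d))
    where open RingProperties ring

  fromNum : ∀ {m n d e d≉0 e≉0} → m ≈ n → d ≈ e → mkFraction m d d≉0 ≈ᶠ mkFraction n e e≉0
  fromNum p q .cross = *-cong p (sym q)

  +ᶠ-assoc : ∀ x y z → (x +ᶠ y) +ᶠ z ≈ᶠ x +ᶠ (y +ᶠ z)
  +ᶠ-assoc (mkFraction m d _) (mkFraction n e _) (mkFraction o f _) = fromNum
    (S.solve 6 (λ m d n e o f →
      ((m ⊗ e ⊕ n ⊗ d) ⊗ f ⊕ o ⊗ (d ⊗ e)) ⊜ (m ⊗ (e ⊗ f) ⊕ (n ⊗ f ⊕ o ⊗ e) ⊗ d))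
      refl m d n e o f)
    (*-assoc d e f)

  +ᶠ-comm : ∀ x y → x +ᶠ y ≈ᶠ y +ᶠ x
  +ᶠ-comm (mkFraction m d _) (mkFraction n e _) = fromNum (+-comm _ _) (*-comm d e)

  +ᶠ-identityʳ : ∀ x → x +ᶠ κ 0# ≈ᶠ x
  +ᶠ-identityʳ (mkFraction m d _) = fromNum
    (trans (+-cong (*-identityʳ m) (zeroˡ d)) (+-identityʳ m)) (*-identityʳ d)

  -ᶠ-inverseʳ : ∀ x → x +ᶠ (-ᶠ x) ≈ᶠ κ 0#
  -ᶠ-inverseʳ (mkFraction m d _) .cross = begin
    (m * d + - m * d) * 1#   ≈⟨ *-identityʳ _ ⟩
    m * d + - m * d          ≈⟨ distribʳ d m (- m) ⟨
    (m - m) * d              ≈⟨ *-congʳ (-‿inverseʳ m) ⟩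
    0# * d                   ≈⟨ zeroˡ d ⟩
    0#                       ≈⟨ zeroˡ _ ⟨
    0# * (d * d)             ∎

  *ᶠ-identityʳ : ∀ x → x *ᶠ κ 1# ≈ᶠ x
  *ᶠ-identityʳ (mkFraction m d _) = fromNum (*-identityʳ m) (*-identityʳ d)

  *ᶠ-comm : ∀ x y → x *ᶠ y ≈ᶠ y *ᶠ x
  *ᶠ-comm (mkFraction m d _) (mkFraction n e _) = fromNum (*-comm m n) (*-comm d e)

  *ᶠ-distribˡ : ∀ x y z → x *ᶠ (y +ᶠ z) ≈ᶠ x *ᶠ y +ᶠ x *ᶠ z
  *ᶠ-distribˡ (mkFraction m d _) (mkFraction n e _) (mkFraction o f _) .cross =
    S.solve 6 (λ m d n e o f →
      ((m ⊗ (n ⊗ f ⊕ o ⊗ e)) ⊗ ((d ⊗ e) ⊗ (d ⊗ f)))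
      ⊜ (((m ⊗ n) ⊗ (d ⊗ f) ⊕ (m ⊗ o) ⊗ (d ⊗ e)) ⊗ (d ⊗ (e ⊗ f))))
      refl m d n e o f

  fractionField : CommutativeRing (a ⊔ b) b
  fractionField = record
    { Carrier = Fraction ; _≈_ = _≈ᶠ_ ; _+_ = _+ᶠ_ ; _*_ = _*ᶠ_ ; -_ = -ᶠ_
    ; 0# = κ 0# ; 1# = κ 1#
    ; isCommutativeRing = record
      { isRing = record
        { +-isAbelianGroup = record
          { isGroup = record
            { isMonoid = record
              { isSemigroup = record
                { isMagma = record
                  { isEquivalence = record
                    { refl  = mk≈ᶠ refl
                    ; sym   = λ p → mk≈ᶠ (sym (cross p))
                    ; trans = transᶠ
                    }
                  ; ∙-cong = +ᶠ-cong
                  }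
                ; assoc = +ᶠ-assoc
                }
              ; identity = (λ x → transᶠ (+ᶠ-comm (κ 0#) x) (+ᶠ-identityʳ x)) , +ᶠ-identityʳ
              }
            ; inverse = (λ x → transᶠ (+ᶠ-comm (-ᶠ x) x) (-ᶠ-inverseʳ x)) , -ᶠ-inverseʳ
            ; ⁻¹-cong = -ᶠ-cong
            }
          ; comm = +ᶠ-comm
          }
        ; *-cong = *ᶠ-cong
        ; *-assoc = λ x y z → fromNum (*-assoc _ _ _) (*-assoc _ _ _)
        ; *-identity = (λ x → transᶠ (*ᶠ-comm (κ 1#) x) (*ᶠ-identityʳ x)) , *ᶠ-identityʳ
        ; distrib = *ᶠ-distribˡ
                  , λ x y z → transᶠ (*ᶠ-comm (y +ᶠ z) x)
                                (transᶠ (*ᶠ-distribˡ x y z)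
                                  (+ᶠ-cong (*ᶠ-comm x y) (*ᶠ-comm x z)))
        }
      ; *-comm = *ᶠ-comm
      }
    }

-- 𝔽_q with q = p ^ w elements.  The field characteristic, which makes 𝔽_p
-- act on 𝔽_q, follows from the others.

record FiniteField a b (p w : ℕ) : Set (lsuc (a ⊔ b)) where
  field
    commutativeRing : CommutativeRing a b
  open RingNotation commutativeRing
  field
    p-prime        : Prime p
    enumeration    : Inverse setoid (≡.setoid (Fin (p ℕ.^ w)))
    characteristic : p · 1# ≈ 0#
    1≉0            : 1# ≉ 0#
    inverse        : ∀ x → x ≉ 0# → ∃ λ y → x * y ≈ 1#

  _≟_ : Decidable _≈_
  _≟_ = via-injection (Inverse⇒Injection enumeration) Finₚ._≟_

  zero-product : ∀ x y → x * y ≈ 0# → x ≈ 0# ⊎ y ≈ 0#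
  zero-product x y e with x ≟ 0#
  ... | yes x≈0 = inj₁ x≈0
  ... | no  x≉0 with inverse x x≉0
  ...   | x⁻¹ , f = inj₂ (begin
    y               ≈⟨ *-identityˡ y ⟨
    1# * y          ≈⟨ *-congʳ (trans (*-comm x⁻¹ x) f) ⟨
    (x⁻¹ * x) * y   ≈⟨ *-assoc _ _ _ ⟩
    x⁻¹ * (x * y)   ≈⟨ *-congˡ e ⟩
    x⁻¹ * 0#        ≈⟨ zeroʳ x⁻¹ ⟩
    0#              ∎)
    where open SetoidReasoning setoid

module Global {a b} {p w : ℕ} (Fq : FiniteField a b p w) where

  module 𝔽 = RingNotation (FiniteField.commutativeRing Fq)

  -- 𝔽_p = ℤ/(p)
  module 𝔽ₚ = RingNotation (Quotient.quotientRing ℤₚ.+-*-commutativeRing (ℤ.+ p))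

  𝔽ₚ⇒𝔽 : 𝔽ₚ.Carrier → 𝔽.Carrier
  𝔽ₚ⇒𝔽 (ℤ.+ k)      = k 𝔽.· 𝔽.1#
  𝔽ₚ⇒𝔽 (ℤ.-[1+ k ]) = 𝔽.- (suc k 𝔽.· 𝔽.1#)

  -- An 𝔽_p-basis γ of 𝔽_q together with its coordinate map ψ
  record Basis : Set (a ⊔ b) where
    field
      γ           : Fin w → 𝔽.Carrier
      ψ           : 𝔽.Carrier → Vector 𝔽ₚ.Carrier w
      spanning    : ∀ x → x 𝔽.≈ 𝔽.sum (λ l → 𝔽ₚ⇒𝔽 (ψ x l) 𝔽.* γ l)
      independent : ∀ (c : Vector 𝔽ₚ.Carrier w) →
                    𝔽.sum (λ l → 𝔽ₚ⇒𝔽 (c l) 𝔽.* γ l) 𝔽.≈ 𝔽.0# →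
                    ∀ l → c l 𝔽ₚ.≈ 𝔽ₚ.0#

  -- 𝒪 = 𝔽_q[t]
  module 𝒪    = PolynomialNotation (FiniteField.commutativeRing Fq)
  module 𝒪[X] = PolynomialNotation 𝒪.polynomialRing

  1≉0 : 𝒪.1# 𝒪.≉ 𝒪.0#
  1≉0 e = FiniteField.1≉0 Fq (Polynomial._≈ₚ_.at e 0)

  cancel : AlmostLeftCancellative 𝒪._≈_ 𝒪.0# 𝒪._*_
  cancel x y z x≉0 e
    with zero-productₚ x (y 𝒪.- z) (𝒪.trans (x[y-z]≈xy-xz x y z) (x≈y⇒x∙y⁻¹≈ε e))
    where
    open Polynomial.NoZeroDivisors (FiniteField.commutativeRing Fq)
      (FiniteField.zero-product Fq)
    open RingProperties 𝒪.ring using (x[y-z]≈xy-xz)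
    open AbelianGroupProperties 𝒪.+-abelianGroup using (x≈y⇒x∙y⁻¹≈ε)
  ... | inj₁ x≈0   = ⊥-elim (x≉0 x≈0)
  ... | inj₂ y-z≈0 = x∙y⁻¹≈ε⇒x≈y y z y-z≈0
    where open AbelianGroupProperties 𝒪.+-abelianGroup using (x∙y⁻¹≈ε⇒x≈y)

  module Frac = Fractions 𝒪.polynomialRing 1≉0 cancel

  -- K = 𝔽_q(t)
  module K    = RingNotation Frac.fractionField
  module K[X] = PolynomialNotation Frac.fractionField

  toK[X] : 𝒪[X].Carrier → K[X].Carrier
  toK[X] = map Frac.κ

  Separable : 𝒪[X].Carrier → Set (a ⊔ b)
  Separable f = K[X].Coprime (toK[X] f) (K[X].derivative (toK[X] f))

  HasDegreeₜ : 𝒪[X].Carrier → ℕ → Set b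
  HasDegreeₜ f d = (∀ i → 𝒪.DegreeBelow (𝒪[X].coeff f i) (suc d))
                 × ∃ λ i → 𝒪.coeff (𝒪[X].coeff f i) d 𝔽.≉ 𝔽.0#

  φ : (m σ : ℕ) → 𝒪.Carrier → Vector 𝔽.Carrier (σ ∸ m)
  φ m σ c k = 𝒪.coeff c (m ℕ.+ toℕ k)

  -- Each entry x of M becomes the column ψ x: row i of M is replaced by
  -- the w consecutive rows numbered i * w, …, i * w + (w - 1).
  expand : Basis → ∀ {h r} → 𝔽.Matrix h r → 𝔽ₚ.Matrix (h ℕ.* w) r
  expand B M row j =
    let i , l = remQuot w row in Basis.ψ B (M i j) l

  module Local (v : 𝒪.Carrier) where

    -- k = 𝔽_q[t]/(v)
    module k[X] = PolynomialNotation (Quotient.quotientRing 𝒪.polynomialRing v)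

    -- 𝔽_q[t] and k have the same carrier, so reduction modulo v only
    -- changes the equality.
    reduce : 𝒪[X].Carrier → k[X].Carrier
    reduce f = f

    module Compl = Completion 𝒪.polynomialRing v
    module 𝒪ᵥ    = RingNotation Compl.completionRing
    module 𝒪ᵥ[X] = PolynomialNotation Compl.completionRing

    open Compl public using (ι)

    to𝒪ᵥ[X] : 𝒪[X].Carrier → 𝒪ᵥ[X].Carrier
    to𝒪ᵥ[X] = map ι

    -- Equality of x ∈ K and y ∈ 𝒪ᵥ inside the fraction field of 𝒪ᵥ
    infix 4 _≈ᴷᵛ_ _≈ᴷᵛ[X]_
    _≈ᴷᵛ_ : K.Carrier → 𝒪ᵥ.Carrier → Set (a ⊔ b)
    x ≈ᴷᵛ y = ι (Frac.num x) 𝒪ᵥ.≈ y 𝒪ᵥ.* ι (Frac.den x)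

    _≈ᴷᵛ[X]_ : K[X].Carrier → 𝒪ᵥ[X].Carrier → Set (a ⊔ b)
    g ≈ᴷᵛ[X] h = ∀ i → K[X].coeff g i ≈ᴷᵛ 𝒪ᵥ[X].coeff h i

    -- y is the representative of x modulo v ^ ℓ of degree less than σ;
    -- it is unique when σ = ℓ · deg v.
    IsResidue : (ℓ σ : ℕ) → 𝒪ᵥ.Carrier → 𝒪.Carrier → Set (a ⊔ b)
    IsResidue ℓ σ x y = 𝒪.DegreeBelow y σ × ι v 𝒪ᵥ.^ ℓ 𝒪ᵥ.∣ ι y 𝒪ᵥ.- x

{-# OPTIONS --safe #-}

-- For e ∈ 𝔽_p^r let Λ(e) be the reduction of Σᵢ eᵢ Φ(fᵢ) modulo v^ℓ; then
-- e ∈ L′ if and only if deg_t Λ(e) ≤ deg_t f.  By Gauss' lemma f = Hⱼ Gⱼ over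
-- 𝔽_q[t], with Gⱼ a primitive multiple of gⱼ.  For e = wⱼ the logarithmic
-- derivative gives Λ(wⱼ) = Hⱼ Gⱼ′, whence W ⊆ L′.  Conversely, let e ∈ L′ vanish
-- at some fᵢ dividing gⱼ, so that fᵢ divides both Gⱼ and Λ(e) modulo v^ℓ.  As
-- σ > (2n-1) deg_t f, the pigeonhole principle over 𝔽_q (in place of a resultant)
-- gives a nontrivial relation Gⱼ x + Λ(e) y + z = 0 with z free of X and
-- deg_t z < σ.  Modulo v^ℓ the constant z is divisible by fᵢ, so z = 0, and the
-- irreducible gⱼ divides Λ(e).  Then every fₖ dividing gⱼ divides Λ(e), hence
-- eₖ fₖ′ ∏_{l≠k} fₗ, modulo v; since f is squarefree modulo v and the residue
-- field is perfect, eₖ = 0.  Subtracting a multiple of wⱼ, every e ∈ L′ is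
-- constant on the blocks {i : fᵢ ∣ gⱼ}, and these partition {1, …, r}.

module Submission where

open import Defs
open import Algebra.Bundles using (CommutativeRing)
open import Algebra.Definitions using (AlmostLeftCancellative)
import Algebra.Properties.AbelianGroup as AbelianGroupProperties
import Algebra.Properties.CommutativeMonoid.Mult as CommutativeMonoidMult
import Algebra.Properties.CommutativeMonoid.Sum as MonoidSum
import Algebra.Properties.CommutativeSemiring.Binomial as Binomial
import Algebra.Properties.CommutativeSemiring.Exp as CommutativeExp
import Algebra.Properties.Monoid.Mult as MonoidMult
import Algebra.Properties.Ring as RingProperties
import Algebra.Properties.Semiring.Divisibility as DivisibilityProperties
import Algebra.Properties.Semiring.Exp as SemiringExp
import Algebra.Properties.Semiring.Mult as SemiringMult
import Algebra.Properties.Semiring.Sum as SemiringSum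
import Algebra.Solver.Ring.NaturalCoefficients.Default as Solver
open import Data.Empty using (⊥)
open import Data.Fin.Base as Fin using (Fin; zero; suc; toℕ; punchIn; punchOut)
import Data.Fin.Properties as Finₚ
import Data.Integer.Base as ℤ
import Data.Integer.Properties as ℤₚ
open import Data.List.Base as List using (List; []; _∷_; map; length)
import Data.List.Properties as Listₚ
open import Data.Nat.Base as ℕ using (ℕ; zero; suc; _≤_; z≤n; s≤s)
open import Data.Nat.Combinatorics
  using (_C_; nCn≡1; nCk≡nC[n∸k]; nCk≡n!/k![n-k]!; k![n∸k]!∣n!)
import Data.Nat.Coprimality as Coprimality
import Data.Nat.Divisibility as ∣ℕ
import Data.Nat.DivMod as DivMod
import Data.Nat.GCD as GCD
open import Data.Nat.Primality
  using (Prime; euclidsLemma; prime⇒irreducible; ¬prime[0]; ¬prime[1])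
import Data.Nat.Properties as ℕₚ
open import Data.Product.Base using (∃; _×_; _,_; proj₁; proj₂)
open import Data.Sum.Base using (inj₁; inj₂)
open import Data.Vec.Functional using (Vector; removeAt)
open import Function.Base using (_∘_)
open import Function.Bundles using (Inverse; Injection; _⇔_; mk⇔)
open import Function.Properties.Inverse using (Inverse⇒Injection)
open import Level using (Level; _⊔_) renaming (suc to lsuc)
open import Relation.Binary.PropositionalEquality as ≡ using (_≡_; _≢_)
import Relation.Binary.Reasoning.Setoid as SetoidReasoning
open import Relation.Nullary using (¬_; Dec; yes; no; contradiction)

-- The constant `2 n - 1` has the same origin as the size of a Sylvester matrix. If `Gⱼ` has degree
-- `D` and `Λ(e)` has degree at most `E = n - 1` in `X`, then `x` has `E` free coefficients, `y` has
-- `D` and `z` has one, each a polynomial in `t` of degree below `σ`, while a value has `D + E`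
-- coefficients of degree below `deg_t f + σ`. A collision is forced as soon as
-- `(D + E) deg_t f < σ`, and `D + E` is at most `2 n - 1`. Two obstacles shape the rest. Modulo
-- `v^ℓ` there are zero divisors, so only polynomials with regular leading coefficient are
-- cancelled: the monic `fᵢ`, and `Gⱼ`, whose leading coefficient divides that of `f` and is
-- therefore prime to `v`. And `K` does not map into the completion, so identities over `K` are
-- carried there by a single-valued relation instead of a homomorphism. Perfectness of the residue
-- field enters because `fₖ′ = 0` modulo `v` would make `fₖ` a `p`-th power there, against
-- squarefreeness.

private
  variable
    a b c d t : Level
    n : ℕ

-- Divisibility, regular elements and comaximality.

module CommutativeRingLemmas (R : CommutativeRing a b) where
  open RingNotation R hiding (zero)
  open DivisibilityProperties semiring public
    using (_,_; ∣ʳ-trans; ∣ʳ-refl; ∣ʳ-respʳ-≈; ∣ʳ-respˡ-≈; ∣ʳ-reflexive; x∣ʳyx; x∣ʳy⇒x∣ʳzy)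
    renaming (_∣0 to x∣0)
  open SemiringSum semiring public
    using (sum-cong-≋; sum-init-last; ∑-comm; *-distribˡ-sum; *-distribʳ-sum)
  private
    module +-Sum = SemiringSum semiring
    module *-Sum = MonoidSum *-commutativeMonoid
    module S = Solver commutativeSemiring
  open RingProperties ring public
    using (-‿distribˡ-*; x[y-z]≈xy-xz)
  open AbelianGroupProperties +-abelianGroup public
    using (x≈y⇒x∙y⁻¹≈ε; x∙y⁻¹≈ε⇒x≈y; ⁻¹-involutive; inverseʳ-unique)
    renaming (ε⁻¹≈ε to -0≈0)
  open SetoidReasoning setoid

  ·-zero : ∀ n → n · 0# ≈ 0#
  ·-zero zero    = refl
  ·-zero (suc n) = trans (+-identityˡ _) (·-zero n)

  -- A property of single elements, because the main computations take place modulo `v ^ ℓ`, where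
  -- cancellation is available only for some of them.
  Regular : Carrier → Set (a ⊔ b)
  Regular x = ∀ y → x * y ≈ 0# → y ≈ 0#

  regular-cancel : ∀ {x} → Regular x → ∀ {y z} → x * y ≈ x * z → y ≈ z
  regular-cancel {x} reg {y} {z} e = x∙y⁻¹≈ε⇒x≈y y z
    (reg _ (trans (x[y-z]≈xy-xz x y z) (x≈y⇒x∙y⁻¹≈ε e)))

  regular-1 : ∀ {x} → x ≈ 1# → Regular x
  regular-1 e y f = trans (sym (*-identityˡ y)) (trans (*-congʳ (sym e)) f)

  ∣-*ʳ : ∀ {x y} z → x ∣ y → x ∣ y * z
  ∣-*ʳ z x∣y = ∣ʳ-respʳ-≈ (*-comm _ _) (x∣ʳy⇒x∣ʳzy z x∣y)

  ∣-+ : ∀ {x y z} → x ∣ y → x ∣ z → x ∣ y + z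
  ∣-+ (p , e) (q , f) = p + q , trans (distribʳ _ _ _) (+-cong e f)

  ∣-neg : ∀ {x y} → x ∣ y → x ∣ - y
  ∣-neg (p , e) = - p , trans (sym (-‿distribˡ-* _ _)) (-‿cong e)

  ∣-sum : ∀ {x} (t : Vector Carrier n) → (∀ i → x ∣ t i) → x ∣ sum t
  ∣-sum {n = zero}  t h = x∣0 _
  ∣-sum {n = suc n} t h = ∣-+ (h zero) (∣-sum (t ∘ suc) (h ∘ suc))

  ∣-sum⁻ : ∀ {x} (t : Vector Carrier n) i → (∀ j → j ≢ i → x ∣ t j) → x ∣ sum t → x ∣ t i
  ∣-sum⁻ {n = suc n} {x} t i h s = ∣ʳ-respʳ-≈ eq
    (∣-+ s (∣-neg (∣-sum (removeAt t i) (λ j → h (punchIn i j) (Finₚ.punchInᵢ≢i i j)))))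
    where
    eq : sum t - sum (removeAt t i) ≈ t i
    eq = begin
      sum t - sum (removeAt t i)                            ≈⟨ +-congʳ (+-Sum.sum-remove t) ⟩
      (t i + sum (removeAt t i)) - sum (removeAt t i)       ≈⟨ +-assoc _ _ _ ⟩
      t i + (sum (removeAt t i) - sum (removeAt t i))       ≈⟨ +-congˡ (-‿inverseʳ _) ⟩
      t i + 0#                                              ≈⟨ +-identityʳ _ ⟩
      t i                                                   ∎

  sum-zero : (t : Vector Carrier n) → (∀ i → t i ≈ 0#) → sum t ≈ 0#
  sum-zero {n = n} t h = trans (+-Sum.sum-cong-≋ h) (+-Sum.sum-replicate-zero n)

  sum-single : (t : Vector Carrier n) → ∀ i → (∀ j → j ≢ i → t j ≈ 0#) → sum t ≈ t i
  sum-single {n = suc n} t i h = trans (+-Sum.sum-remove t)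
    (trans (+-congˡ (sum-zero (removeAt t i) (λ j → h (punchIn i j) (Finₚ.punchInᵢ≢i i j))))
      (+-identityʳ _))

  ∣-product : (t : Vector Carrier n) → ∀ i → t i ∣ product t
  ∣-product {n = suc n} t i = product (removeAt t i) ,
    trans (*-comm _ _) (sym (*-Sum.sum-remove t))

  ∣²-product : (t : Vector Carrier n) → ∀ {i j} → i ≢ j → t i * t j ∣ product t
  ∣²-product {n = suc zero}    t {zero} {zero} i≢j = contradiction ≡.refl i≢j
  ∣²-product {n = suc (suc n)} t {i} {j} i≢j = product (removeAt (removeAt t i) k) , (begin
    w * (t i * t j)     ≈⟨ S.solve 3 (λ w x y → w S.:* (x S.:* y) S.:= x S.:* (y S.:* w)) refl w (t i) (t j) ⟩
    t i * (t j * w)     ≡⟨ ≡.cong (λ l → t i * (t l * w)) (Finₚ.punchIn-punchOut i≢j) ⟨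
    t i * (removeAt t i k * w)  ≈⟨ *-congˡ (*-Sum.sum-remove (removeAt t i)) ⟨
    t i * product (removeAt t i) ≈⟨ *-Sum.sum-remove t ⟨
    product t                   ∎)
    where
    k = punchOut i≢j
    w = product (removeAt (removeAt t i) k)

  ∣-product-^ : (t : Vector Carrier n) (w : Fin n → Fin 2) → ∀ i → w i ≡ suc zero → t i ∣ product (λ i → t i ^ toℕ (w i))
  ∣-product-^ t w i e = ∣ʳ-trans
    (∣ʳ-reflexive (trans (sym (*-identityʳ (t i))) (reflexive (≡.cong (λ k → t i ^ toℕ k) (≡.sym e)))))
    (∣-product (λ i → t i ^ toℕ (w i)) i)

  *-∣-product : ∀ {x y} (t : Vector Carrier n) → ∀ {i j} → i ≢ j → x ∣ t i → y ∣ t j → x * y ∣ product t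
  *-∣-product t i≢j (p , e) (q , f) = ∣ʳ-trans
    (p * q , trans (S.solve 4 (λ p q x y → (p S.:* q) S.:* (x S.:* y) S.:= (p S.:* x) S.:* (q S.:* y)) refl p q _ _) (*-cong e f))
    (∣²-product t i≢j)

  record Bezout (x y : Carrier) : Set (a ⊔ b) where
    constructor mkBezout
    field
      gcd u w : Carrier
      combination : u * x + w * y ≈ gcd
      gcd∣x : gcd ∣ x
      gcd∣y : gcd ∣ y

  Comaximal : Carrier → Carrier → Set (a ⊔ b)
  Comaximal x y = ∃ λ u → ∃ λ w → u * x + w * y ≈ 1#

  comaximal-1 : ∀ x {y} → y ≈ 1# → Comaximal x y
  comaximal-1 x {y} e = 0# , 1# , trans (+-cong (zeroˡ x) (trans (*-identityˡ y) e)) (+-identityˡ 1#)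

  -- In the product of the two relations for `1#`, every term except `w w′ y z` contains `x`.
  comaximal-* : ∀ {x y z} → Comaximal x y → Comaximal x z → Comaximal x (y * z)
  comaximal-* {x} {y} {z} (u , w , e) (u′ , w′ , e′) =
    u * (u′ * x + w′ * z) + w * (y * u′) , w * w′ , (begin
      (u * (u′ * x + w′ * z) + w * (y * u′)) * x + w * w′ * (y * z)
        ≈⟨ S.solve 7 (λ u u′ w w′ x y z →
             (u S.:* (u′ S.:* x S.:+ w′ S.:* z) S.:+ w S.:* (y S.:* u′)) S.:* x S.:+ w S.:* w′ S.:* (y S.:* z)
             S.:= (u S.:* x S.:+ w S.:* y) S.:* (u′ S.:* x S.:+ w′ S.:* z)) refl u u′ w w′ x y z ⟩
      (u * x + w * y) * (u′ * x + w′ * z)   ≈⟨ *-cong e e′ ⟩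
      1# * 1#                               ≈⟨ *-identityˡ 1# ⟩
      1#                                    ∎)

  comaximal-product : ∀ {x} (t : Vector Carrier n) → (∀ i → Comaximal x (t i)) → Comaximal x (product t)
  comaximal-product {n = zero}  {x} t h = comaximal-1 x refl
  comaximal-product {n = suc n} t h = comaximal-* (h zero) (comaximal-product (t ∘ suc) (h ∘ suc))

  comaximal-cofactor : (t : Vector Carrier n) → ∀ i → (∀ j → j ≢ i → Comaximal (t i) (t j)) →
                       ∃ λ y → product t ≈ t i * y × Comaximal (t i) y
  comaximal-cofactor {n = suc n} t i h = product (removeAt t i) , *-Sum.sum-remove t ,
    comaximal-product (removeAt t i) (λ j → h (punchIn i j) (Finₚ.punchInᵢ≢i i j))

  comaximal-∣ : ∀ {x y z} → Comaximal x y → x ∣ z * y → x ∣ z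
  comaximal-∣ {x} {y} {z} (u , w , e) (q , f) = z * u + w * q , (begin
    (z * u + w * q) * x        ≈⟨ S.solve 5 (λ x z u w q → (z S.:* u S.:+ w S.:* q) S.:* x S.:= z S.:* (u S.:* x) S.:+ w S.:* (q S.:* x)) refl x z u w q ⟩
    z * (u * x) + w * (q * x)  ≈⟨ +-congˡ (*-congˡ f) ⟩
    z * (u * x) + w * (z * y)  ≈⟨ S.solve 5 (λ x y z u w → z S.:* (u S.:* x) S.:+ w S.:* (z S.:* y) S.:= z S.:* (u S.:* x S.:+ w S.:* y)) refl x y z u w ⟩
    z * (u * x + w * y)        ≈⟨ *-congˡ e ⟩
    z * 1#                     ≈⟨ *-identityʳ z ⟩
    z                          ∎)

  comaximal-sym : ∀ {x y} → Comaximal x y → Comaximal y x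
  comaximal-sym (u , w , e) = w , u , trans (+-comm _ _) e

  comaximal-^ : ∀ {x y} n → Comaximal x y → Comaximal x (y ^ n)
  comaximal-^ {x} zero    h = comaximal-1 x refl
  comaximal-^     (suc n) h = comaximal-* h (comaximal-^ n h)

  ^-∣-1 : ∀ {x} n → x ∣ 1# → x ^ n ∣ 1#
  ^-∣-1 zero    h = ∣ʳ-refl
  ^-∣-1 {x} (suc n) (q , e) with ^-∣-1 n (q , e)
  ... | q′ , e′ = q * q′ , (begin
    q * q′ * (x * x ^ n)    ≈⟨ S.solve 4 (λ q q′ x y → (q S.:* q′) S.:* (x S.:* y) S.:= (q S.:* x) S.:* (q′ S.:* y)) refl q q′ x (x ^ n) ⟩
    (q * x) * (q′ * x ^ n)  ≈⟨ *-cong e e′ ⟩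
    1# * 1#                 ≈⟨ *-identityˡ 1# ⟩
    1#                      ∎)

-- Transfer of identities between rings and between their polynomial rings.

record RingRelation (R : CommutativeRing a b) (S : CommutativeRing c d) t
  : Set (a ⊔ b ⊔ c ⊔ d ⊔ lsuc t) where
  private
    module R = RingNotation R
    module S = RingNotation S
  infix 4 _∼_
  field
    _∼_    : R.Carrier → S.Carrier → Set t
    respˡ  : ∀ {x x′ y} → x R.≈ x′ → x ∼ y → x′ ∼ y
    respʳ  : ∀ {x y y′} → y S.≈ y′ → x ∼ y → x ∼ y′
    -- Relations are single-valued but need not be total: a fraction with `v` in its reduced
    -- denominator has no counterpart in the completion. An identity can be moved by `transfer` as
    -- soon as both of its sides have counterparts.
    unique : ∀ {x y y′} → x ∼ y → x ∼ y′ → y S.≈ y′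
    0-∼    : R.0# ∼ S.0#
    1-∼    : R.1# ∼ S.1#
    +-∼    : ∀ {x x′ y y′} → x ∼ y → x′ ∼ y′ → x R.+ x′ ∼ y S.+ y′
    *-∼    : ∀ {x x′ y y′} → x ∼ y → x′ ∼ y′ → x R.* x′ ∼ y S.* y′

  transfer : ∀ {x x′ y y′} → x ∼ y → x′ ∼ y′ → x R.≈ x′ → y S.≈ y′
  transfer h h′ e = unique (respˡ e h) h′

  sum-∼ : ∀ {t : Vector R.Carrier n} {u : Vector S.Carrier n} → (∀ i → t i ∼ u i) → R.sum t ∼ S.sum u
  sum-∼ {n = zero}  h = 0-∼
  sum-∼ {n = suc n} h = +-∼ (h zero) (sum-∼ (h ∘ suc))

  product-∼ : ∀ {t : Vector R.Carrier n} {u : Vector S.Carrier n} → (∀ i → t i ∼ u i) →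
              R.product t ∼ S.product u
  product-∼ {n = zero}  h = 1-∼
  product-∼ {n = suc n} h = *-∼ (h zero) (product-∼ (h ∘ suc))

  ^-∼ : ∀ {x y} n → x ∼ y → x R.^ n ∼ y S.^ n
  ^-∼ zero    h = 1-∼
  ^-∼ (suc n) h = *-∼ h (^-∼ n h)

  ·-∼ : ∀ {x y} n → x ∼ y → n R.· x ∼ n S.· y
  ·-∼ zero    h = 0-∼
  ·-∼ (suc n) h = +-∼ h (·-∼ n h)

-- Coefficients, degree bounds, derivatives and McCoy's theorem.

module PolynomialLemmas (R : CommutativeRing a b) where
  open RingNotation R hiding (zero)
  open Polynomial R
  open CommutativeRingLemmas R
  module P where
    open RingNotation polynomialRing public
    open CommutativeRingLemmas polynomialRing public
  private
    module PS = Solver P.commutativeSemiring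
  open SetoidReasoning setoid

  -- The Cauchy product on coefficient sequences instead of lists, so that trailing zeros of lists
  -- play no part in statements about products.
  convolution : (ℕ → Carrier) → (ℕ → Carrier) → ℕ → Carrier
  convolution x y zero    = x 0 * y 0
  convolution x y (suc i) = x 0 * y (suc i) + convolution (x ∘ suc) y i

  convolution-zeroˡ : ∀ x y → (∀ i → x i ≈ 0#) → ∀ i → convolution x y i ≈ 0#
  convolution-zeroˡ x y h zero    = trans (*-congʳ (h 0)) (zeroˡ _)
  convolution-zeroˡ x y h (suc i) = trans
    (+-cong (trans (*-congʳ (h 0)) (zeroˡ _)) (convolution-zeroˡ (x ∘ suc) y (h ∘ suc) i))
    (+-identityˡ 0#)

  coeff-* : ∀ p q i → coeff (p *ₚ q) i ≈ convolution (coeff p) (coeff q) i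
  coeff-* []      q i       = sym (convolution-zeroˡ _ (coeff q) (λ _ → refl) i)
  coeff-* (x ∷ p) q zero    = trans (coeff-+ (scale x q) (0# ∷ p *ₚ q) 0)
    (trans (+-congʳ (coeff-scale x q 0)) (+-identityʳ _))
  coeff-* (x ∷ p) q (suc i) = trans (coeff-+ (scale x q) (0# ∷ p *ₚ q) (suc i))
    (+-cong (coeff-scale x q (suc i)) (coeff-* p q i))

  -- The bounds are deliberately unlike: degree at most `D` times degree below `E` is degree below
  -- `D + E`. This avoids subtraction, and `E = 0` covers the zero polynomial.
  convolution-below : ∀ {x y} D E → (∀ i → suc D ≤ i → x i ≈ 0#) → (∀ i → E ≤ i → y i ≈ 0#) →
                      ∀ i → D ℕ.+ E ≤ i → convolution x y i ≈ 0#
  convolution-below         zero    E hx hy zero    le = trans (*-congˡ (hy 0 le)) (zeroʳ _)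
  convolution-below {x} {y} zero    E hx hy (suc i) le = trans
    (+-cong (trans (*-congˡ (hy (suc i) le)) (zeroʳ _))
            (convolution-zeroˡ (x ∘ suc) y (λ i → hx (suc i) (s≤s z≤n)) i))
    (+-identityˡ 0#)
  convolution-below (suc D) E hx hy (suc i) (s≤s le) = trans
    (+-cong (trans (*-congˡ (hy (suc i) (ℕₚ.≤-trans (ℕₚ.m≤n+m E (suc D)) (s≤s le)))) (zeroʳ _))
            (convolution-below D E (λ i h → hx (suc i) (s≤s h)) hy i le))
    (+-identityˡ 0#)

  convolution-top : ∀ {x y} D E → (∀ i → suc D ≤ i → x i ≈ 0#) → (∀ i → suc E ≤ i → y i ≈ 0#) →
                    convolution x y (D ℕ.+ E) ≈ x D * y E
  convolution-top         zero    zero    hx hy = refl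
  convolution-top {x} {y} zero    (suc E) hx hy = trans
    (+-congˡ (convolution-zeroˡ (x ∘ suc) y (λ i → hx (suc i) (s≤s z≤n)) E)) (+-identityʳ _)
  convolution-top {x} {y} (suc D) E       hx hy = trans
    (+-congʳ (trans (*-congˡ (hy _ (s≤s (ℕₚ.m≤n+m E D)))) (zeroʳ _)))
    (trans (+-identityˡ _) (convolution-top D E (λ i h → hx (suc i) (s≤s h)) hy))

  below-cong : ∀ {p q D} → p ≈ₚ q → DegreeBelow p D → DegreeBelow q D
  below-cong e h i le = trans (sym (e .at i)) (h i le)

  below-≤ : ∀ {p D E} → D ≤ E → DegreeBelow p D → DegreeBelow p E
  below-≤ le h i E≤i = h i (ℕₚ.≤-trans le E≤i)

  below-length : ∀ p → DegreeBelow p (length p)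
  below-length []      i       le       = refl
  below-length (x ∷ p) (suc i) (s≤s le) = below-length p i le

  below-0⇒≈0 : ∀ {p} → DegreeBelow p 0 → p ≈ₚ []
  below-0⇒≈0 h .at i = h i z≤n

  below-suc : ∀ {p D} → DegreeBelow p (suc D) → coeff p D ≈ 0# → DegreeBelow p D
  below-suc {D = D} h e i le with ℕₚ.m≤n⇒m<n∨m≡n le
  ... | inj₁ D<i    = h i D<i
  ... | inj₂ ≡.refl = e

  below-+ : ∀ p q {D} → DegreeBelow p D → DegreeBelow q D → DegreeBelow (p +ₚ q) D
  below-+ p q hp hq i le = trans (coeff-+ p q i)
    (trans (+-cong (hp i le) (hq i le)) (+-identityˡ 0#))

  below-neg : ∀ p {D} → DegreeBelow p D → DegreeBelow (-ₚ p) D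
  below-neg p hp i le = trans (coeff-neg p i) (trans (-‿cong (hp i le)) -0≈0)

  below-* : ∀ p q {D E} → DegreeBelow p (suc D) → DegreeBelow q E → DegreeBelow (p *ₚ q) (D ℕ.+ E)
  below-* p q {D} {E} hp hq i le = trans (coeff-* p q i) (convolution-below D E hp hq i le)

  coeff-*-top : ∀ p q D E → DegreeBelow p (suc D) → DegreeBelow q (suc E) →
                coeff (p *ₚ q) (D ℕ.+ E) ≈ coeff p D * coeff q E
  coeff-*-top p q D E hp hq = trans (coeff-* p q (D ℕ.+ E)) (convolution-top D E hp hq)

  -- The bound on `q` starts at its length and is lowered step by step: at the current top `L` the
  -- product has coefficient `coeff p D * coeff q L`, and regularity kills the second factor. No
  -- zero test is made, so the argument is valid modulo `v ^ ℓ`.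
  below-*⁻ : ∀ p q D E → DegreeBelow p (suc D) → Regular (coeff p D) →
             DegreeBelow (p *ₚ q) (D ℕ.+ E) → DegreeBelow q E
  below-*⁻ p q D E hp reg h = descend (length q) (below-length q)
    where
    descend : ∀ L → DegreeBelow q L → DegreeBelow q E
    descend L hq with L ℕₚ.≤? E
    ... | yes L≤E = below-≤ {q} L≤E hq
    descend zero    hq | no L≰E = contradiction z≤n L≰E
    descend (suc L) hq | no L≰E = descend L (below-suc {q} hq (reg _ (trans
      (sym (coeff-*-top p q D L hp hq)) (h _ (ℕₚ.+-monoʳ-≤ D (ℕₚ.≤-pred (ℕₚ.≰⇒> L≰E)))))))

  lead-regular : ∀ {p D} → DegreeBelow p (suc D) → Regular (coeff p D) → P.Regular p
  lead-regular {p} {D} hp reg q e = below-0⇒≈0 (below-*⁻ p q D 0 hp reg (λ i _ → e .at i))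

  -- The usual degree comparison, for coefficient rings with zero divisors. Over `𝒪 / (v ^ ℓ)` it
  -- later forces a constant divisible by a local factor to vanish.
  lead-below-∣ : ∀ {p q D} → DegreeBelow p (suc D) → Regular (coeff p D) → DegreeBelow q D →
                 p P.∣ q → q ≈ₚ []
  lead-below-∣ {p} {q} {D} hp reg hq (s , e) = transₚ (symₚ e) (*ₚ-cong s≈0 (reflₚ {p}))
    where
    s≈0 : s ≈ₚ []
    s≈0 = below-0⇒≈0 (below-*⁻ p s D 0 hp reg (below-cong {q} {p *ₚ s}
      (transₚ (symₚ e) (*ₚ-comm s p)) (below-≤ {q} (ℕₚ.≤-reflexive (≡.sym (ℕₚ.+-identityʳ D))) hq)))

  coeff-const-* : ∀ x p i → coeff (const x *ₚ p) i ≈ x * coeff p i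
  coeff-const-* x p i = trans (coeff-+ (scale x p) (0# ∷ []) i)
    (trans (+-cong (coeff-scale x p i) (0∷[]≈[] .at i)) (+-identityʳ _))

  coeff-sum : ∀ (t : Vector Poly n) i → coeff (P.sum t) i ≈ sum (λ j → coeff (t j) i)
  coeff-sum {n = zero}  t i = refl
  coeff-sum {n = suc n} t i = trans (coeff-+ (t zero) (P.sum (t ∘ suc)) i) (+-congˡ (coeff-sum (t ∘ suc) i))

  below-sum : ∀ (t : Vector Poly n) {D} → (∀ i → DegreeBelow (t i) D) → DegreeBelow (P.sum t) D
  below-sum {n = n} t h i le = trans (coeff-sum t i) (sum-zero (λ j → coeff (t j) i) (λ j → h j i le))

  const-∼ : ∀ x y → const (x * y) ≈ₚ const x *ₚ const y
  const-∼ x y .at zero    = sym (trans (coeff-const-* x (const y) 0) refl)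
  const-∼ x y .at (suc i) = sym (trans (coeff-const-* x (const y) (suc i)) (zeroʳ x))

  const-cong : ∀ {x y} → x ≈ y → const x ≈ₚ const y
  const-cong e = ∷-cong e reflₚ

  const-^ : ∀ x n → const (x ^ n) ≈ₚ const x P.^ n
  const-^ x zero    = reflₚ
  const-^ x (suc n) = transₚ (const-∼ x (x ^ n)) (*ₚ-congˡ (const x) (const-^ x n))

  const-· : ∀ n → n P.· P.1# ≈ₚ const (n · 1#)
  const-· zero    = symₚ 0∷[]≈[]
  const-· (suc n) = transₚ (P.+-congˡ {P.1#} (const-· n)) (∷-cong refl reflₚ)

  const-regular : ∀ {x} → Regular x → P.Regular (const x)
  const-regular {x} reg = lead-regular {const x} {0} (λ { (suc i) _ → refl }) reg

  unit-const-∣ : ∀ {x y p q} → x * y ≈ 1# → p P.∣ const x *ₚ q → p P.∣ q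
  unit-const-∣ {x} {y} {p} {q} e h = P.∣ʳ-respʳ-≈ (P.trans (symₚ (*ₚ-assoc (const y) (const x) q))
    (P.trans (*ₚ-cong (transₚ (symₚ (const-∼ y x)) (const-cong (trans (*-comm y x) e))) (reflₚ {q})) (*ₚ-identityˡ q)))
    (P.x∣ʳy⇒x∣ʳzy (const y) h)

  X : Poly
  X = 0# ∷ 1# ∷ []

  X-* : ∀ p → X *ₚ p ≈ₚ 0# ∷ p
  X-* p = transₚ (0∷-* (1# ∷ []) p) (∷-cong refl (*ₚ-identityˡ p))

  ∷≈const+X* : ∀ x p → x ∷ p ≈ₚ const x +ₚ X *ₚ p
  ∷≈const+X* x p = transₚ (∷-cong (sym (+-identityʳ x)) reflₚ)
    (+ₚ-cong (reflₚ {const x}) (symₚ (X-* p)))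

  coeff-tabulate : (g : Fin n → Carrier) → ∀ i → coeff (List.tabulate g) (toℕ i) ≈ g i
  coeff-tabulate g zero    = refl
  coeff-tabulate g (suc i) = coeff-tabulate (g ∘ suc) i

  below-tabulate : (g : Fin n → Carrier) → DegreeBelow (List.tabulate g) n
  below-tabulate {n = zero}  g i       le       = refl
  below-tabulate {n = suc n} g (suc i) (s≤s le) = below-tabulate (g ∘ suc) i le

  module _ where
    open MonoidMult +-monoid using (×-congʳ)
    open SemiringMult semiring using (×-comm-*)

    coeff-weighted : ∀ k p i → coeff (weighted k p) i ≈ (k ℕ.+ i) · coeff p i
    coeff-weighted k []      i       = sym (·-zero (k ℕ.+ i))
    coeff-weighted k (x ∷ p) zero    = reflexive (≡.cong (_· x) (≡.sym (ℕₚ.+-identityʳ k)))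
    coeff-weighted k (x ∷ p) (suc i) = trans (coeff-weighted (suc k) p i)
      (reflexive (≡.cong (_· coeff p i) (≡.sym (ℕₚ.+-suc k i))))

    coeff-derivative : ∀ p i → coeff (derivative p) i ≈ suc i · coeff p (suc i)
    coeff-derivative []      i = sym (·-zero (suc i))
    coeff-derivative (x ∷ p) i = coeff-weighted 1 p i

    derivative-cong : ∀ {p q} → p ≈ₚ q → derivative p ≈ₚ derivative q
    derivative-cong {p} {q} e .at i = trans (coeff-derivative p i)
      (trans (×-congʳ (suc i) (e .at (suc i))) (sym (coeff-derivative q i)))

    below-derivative : ∀ p {D} → DegreeBelow p (suc D) → DegreeBelow (derivative p) D
    below-derivative p h i le = trans (coeff-derivative p i)
      (trans (×-congʳ (suc i) (h (suc i) (s≤s le))) (sym (coeff-derivative [] i)))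

    derivative-∷ : ∀ x p → derivative (x ∷ p) ≈ₚ p +ₚ (0# ∷ derivative p)
    derivative-∷ x p .at zero    = trans (coeff-weighted 1 p 0) (sym (coeff-+ p (0# ∷ derivative p) 0))
    derivative-∷ x p .at (suc i) = trans (coeff-weighted 1 p (suc i))
      (trans (+-congˡ (sym (coeff-derivative p i))) (sym (coeff-+ p (0# ∷ derivative p) (suc i))))

    derivative-scale : ∀ x p → derivative (scale x p) ≈ₚ scale x (derivative p)
    derivative-scale x p .at i = begin
      coeff (derivative (scale x p)) i     ≈⟨ coeff-derivative (scale x p) i ⟩
      suc i · coeff (scale x p) (suc i)    ≈⟨ ×-congʳ (suc i) (coeff-scale x p (suc i)) ⟩
      suc i · (x * coeff p (suc i))        ≈⟨ ×-comm-* (suc i) x _ ⟨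
      x * (suc i · coeff p (suc i))        ≈⟨ *-congˡ (coeff-derivative p i) ⟨
      x * coeff (derivative p) i           ≈⟨ coeff-scale x (derivative p) i ⟨
      coeff (scale x (derivative p)) i     ∎

    derivative-+ : ∀ p q → derivative (p +ₚ q) ≈ₚ derivative p +ₚ derivative q
    derivative-+ p q .at i = begin
      coeff (derivative (p +ₚ q)) i                       ≈⟨ coeff-derivative (p +ₚ q) i ⟩
      suc i · coeff (p +ₚ q) (suc i)                      ≈⟨ ×-congʳ (suc i) (coeff-+ p q (suc i)) ⟩
      suc i · (coeff p (suc i) + coeff q (suc i))         ≈⟨ ×-distrib-+ _ _ (suc i) ⟩
      suc i · coeff p (suc i) + suc i · coeff q (suc i)   ≈⟨ +-cong (coeff-derivative p i) (coeff-derivative q i) ⟨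
      coeff (derivative p) i + coeff (derivative q) i     ≈⟨ coeff-+ (derivative p) (derivative q) i ⟨
      coeff (derivative p +ₚ derivative q) i              ∎
      where open CommutativeMonoidMult +-commutativeMonoid using (×-distrib-+)

    derivative-* : ∀ p q → derivative (p *ₚ q) ≈ₚ derivative p *ₚ q +ₚ p *ₚ derivative q
    derivative-* []      q = reflₚ
    derivative-* (x ∷ p) q = R.begin
      derivative (scale x q +ₚ (0# ∷ p *ₚ q))
        R.≈⟨ derivative-+ (scale x q) (0# ∷ p *ₚ q) ⟩
      derivative (scale x q) +ₚ derivative (0# ∷ p *ₚ q)
        R.≈⟨ +ₚ-cong (derivative-scale x q) (derivative-∷ 0# (p *ₚ q)) ⟩
      scale x q′ +ₚ (p *ₚ q +ₚ (0# ∷ derivative (p *ₚ q)))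
        R.≈⟨ P.+-congˡ {scale x q′} (P.+-congˡ {p *ₚ q} (transₚ (∷-cong refl (derivative-* p q)) (0∷-+ (p′ *ₚ q) (p *ₚ q′)))) ⟩
      scale x q′ +ₚ (p *ₚ q +ₚ ((0# ∷ p′ *ₚ q) +ₚ (0# ∷ p *ₚ q′)))
        R.≈⟨ PS.solve 4 (λ a b c d → a PS.:+ (b PS.:+ (c PS.:+ d)) PS.:= (b PS.:+ c) PS.:+ (a PS.:+ d)) reflₚ
               (scale x q′) (p *ₚ q) (0# ∷ p′ *ₚ q) (0# ∷ p *ₚ q′) ⟩
      (p *ₚ q +ₚ (0# ∷ p′ *ₚ q)) +ₚ (scale x q′ +ₚ (0# ∷ p *ₚ q′))
        R.≈⟨ P.+-congʳ (P.+-congˡ {p *ₚ q} (0∷-* p′ q)) ⟨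
      (p *ₚ q +ₚ (0# ∷ p′) *ₚ q) +ₚ (x ∷ p) *ₚ q′
        R.≈⟨ P.+-congʳ (*ₚ-distribʳ q p (0# ∷ p′)) ⟨
      (p +ₚ (0# ∷ p′)) *ₚ q +ₚ (x ∷ p) *ₚ q′
        R.≈⟨ P.+-congʳ (*ₚ-cong (derivative-∷ x p) (reflₚ {q})) ⟨
      derivative (x ∷ p) *ₚ q +ₚ (x ∷ p) *ₚ q′ R.∎
      where
      module R = SetoidReasoning P.setoid
      p′ = derivative p
      q′ = derivative q

  derivative-const-* : ∀ x p → derivative (const x *ₚ p) ≈ₚ const x *ₚ derivative p
  derivative-const-* x p = transₚ (derivative-* (const x) p) reflₚ

  -- McCoy's theorem in contrapositive form: if no nonzero scalar annihilates all coefficients of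
  -- `p`, then no nonzero polynomial annihilates `p`. Over a quotient `R / (c)` it becomes Gauss'
  -- lemma.
  mccoy : ∀ p → (∀ x → (∀ i → coeff p i * x ≈ 0#) → x ≈ 0#) → P.Regular p
  mccoy p faithful q e = transₚ (symₚ (scale-one q))
    (scaled q 1# (transₚ (*ₚ-congˡ p (scale-one q)) e))
    where
    low : ∀ (u w : ℕ → Carrier) i → (∀ j → j ℕ.< i → u j * w (i ℕ.∸ j) ≈ 0#) →
          convolution u w i ≈ u i * w 0
    low u w zero    h = refl
    low u w (suc i) h = trans (+-cong (h 0 (s≤s z≤n))
      (low (u ∘ suc) w i (λ j lt → h (suc j) (s≤s lt)))) (+-identityˡ _)

    -- The scalar is generalised because the induction on `q` passes to the tail multiplied by a
    -- coefficient of `p`.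
    scaled : ∀ q x → p *ₚ scale x q ≈ₚ [] → scale x q ≈ₚ []
    scaled []      x e = reflₚ
    scaled (y ∷ q) x e = record { at = λ k → faithful _ (λ i →
      trans (sym (coeff-scale (coeff p i) r k)) (kills i .at k)) }
      where
      r = scale x (y ∷ q)
      -- Once the coefficients of p below i annihilate r, the i-th one annihilates the
      -- constant term of r, so that p times the scaled tail vanishes and q gets shorter.
      kill : ∀ i → (∀ j → j ℕ.< i → scale (coeff p j) r ≈ₚ []) → scale (coeff p i) r ≈ₚ []
      kill i below = transₚ
        (∷-cong z≈0 (transₚ (symₚ (scale-scale (coeff p i) x q)) (scaled q (coeff p i * x) pq≈0)))
        0∷[]≈[]
        where
        z≈0 : coeff p i * (x * y) ≈ 0#
        z≈0 = begin
          coeff p i * (x * y)                  ≈⟨ low (coeff p) (coeff r) i (λ j lt →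
            trans (sym (coeff-scale (coeff p j) r (i ℕ.∸ j))) (below j lt .at (i ℕ.∸ j))) ⟨
          convolution (coeff p) (coeff r) i    ≈⟨ coeff-* p r i ⟨
          coeff (p *ₚ r) i                     ≈⟨ e .at i ⟩
          0#                                   ∎
        pq≈0 : p *ₚ scale (coeff p i * x) q ≈ₚ []
        pq≈0 = tail-zero {0#} (P-R.begin
          0# ∷ p *ₚ scale (coeff p i * x) q   P-R.≈⟨ ∷-cong refl (*ₚ-congˡ p (scale-scale (coeff p i) x q)) ⟩
          0# ∷ p *ₚ s                         P-R.≈⟨ symₚ (P.+-congʳ (scale-zero p refl)) ⟩
          scale 0# p +ₚ (0# ∷ p *ₚ s)         P-R.≈⟨ symₚ (*ₚ-∷ p 0# s) ⟩
          p *ₚ (0# ∷ s)                       P-R.≈⟨ *ₚ-congˡ p (∷-cong (sym z≈0) reflₚ) ⟩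
          p *ₚ scale (coeff p i) r            P-R.≈⟨ *ₚ-comm p (scale (coeff p i) r) ⟩
          scale (coeff p i) r *ₚ p            P-R.≈⟨ scale-* (coeff p i) r p ⟩
          scale (coeff p i) (r *ₚ p)          P-R.≈⟨ scale-cong refl (transₚ (*ₚ-comm r p) e) ⟩
          []                                  P-R.∎)
          where
          s = scale (coeff p i) (scale x q)
          module P-R = SetoidReasoning P.setoid
      killsBelow : ∀ i j → j ℕ.< i → scale (coeff p j) r ≈ₚ []
      killsBelow (suc i) j (s≤s le) = kill j (λ k lt → killsBelow i k (ℕₚ.<-≤-trans lt le))
      kills : ∀ i → scale (coeff p i) r ≈ₚ []
      kills i = killsBelow (suc i) i ℕₚ.≤-refl

module PolynomialRelation {R : CommutativeRing a b} {S : CommutativeRing c d}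
  (T : RingRelation R S t) where
  private
    module R  = RingNotation R
    module S  = RingNotation S
    module R[X] = Polynomial R
    module S[X] = Polynomial S
    module RL = PolynomialLemmas R
    module SL = PolynomialLemmas S
    module T  = RingRelation T
  open T using (_∼_)

  infix 4 _∼ₚ_
  record _∼ₚ_ (p : R[X].Poly) (q : S[X].Poly) : Set t where
    constructor mk∼ₚ
    field at∼ : ∀ i → R[X].coeff p i ∼ S[X].coeff q i
  open _∼ₚ_ public

  convolution-∼ : ∀ {x y u w} → (∀ i → x i ∼ u i) → (∀ i → y i ∼ w i) →
                  ∀ i → RL.convolution x y i ∼ SL.convolution u w i
  convolution-∼ h k zero    = T.*-∼ (h 0) (k 0)
  convolution-∼ h k (suc i) = T.+-∼ (T.*-∼ (h 0) (k (suc i))) (convolution-∼ (h ∘ suc) k i)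

  ∷-∼ : ∀ {x y p q} → x ∼ y → p ∼ₚ q → (x ∷ p) ∼ₚ (y ∷ q)
  ∷-∼ h k .at∼ zero    = h
  ∷-∼ h k .at∼ (suc i) = k .at∼ i

  []-∼ : [] ∼ₚ []
  []-∼ .at∼ i = T.0-∼

  polynomialRelation : RingRelation R[X].polynomialRing S[X].polynomialRing t
  polynomialRelation = record
    { _∼_    = _∼ₚ_
    ; respˡ  = λ e h → mk∼ₚ λ i → T.respˡ (R[X].at e i) (h .at∼ i)
    ; respʳ  = λ e h → mk∼ₚ λ i → T.respʳ (S[X].at e i) (h .at∼ i)
    ; unique = λ h k → S[X].mk≈ₚ λ i → T.unique (h .at∼ i) (k .at∼ i)
    ; 0-∼    = []-∼
    ; 1-∼    = ∷-∼ T.1-∼ []-∼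
    ; +-∼    = λ {p} {p′} {q} {q′} h k → mk∼ₚ λ i →
        T.respˡ (R.sym (R[X].coeff-+ p p′ i)) (T.respʳ (S.sym (S[X].coeff-+ q q′ i))
          (T.+-∼ (h .at∼ i) (k .at∼ i)))
    ; *-∼    = λ {p} {p′} {q} {q′} h k → mk∼ₚ λ i →
        T.respˡ (R.sym (RL.coeff-* p p′ i)) (T.respʳ (S.sym (SL.coeff-* q q′ i))
          (convolution-∼ (h .at∼) (k .at∼) i))
    }

  const-∼ : ∀ {x y} → x ∼ y → R[X].const x ∼ₚ S[X].const y
  const-∼ h = ∷-∼ h []-∼

  derivative-∼ : ∀ {p q} → p ∼ₚ q → R[X].derivative p ∼ₚ S[X].derivative q
  derivative-∼ {p} {q} h .at∼ i = T.respˡ (R.sym (RL.coeff-derivative p i))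
    (T.respʳ (S.sym (SL.coeff-derivative q i)) (T.·-∼ (suc i) (h .at∼ (suc i))))

  map-∼ : ∀ {φ : R.Carrier → S.Carrier} → (∀ x → x ∼ φ x) → ∀ p → p ∼ₚ map φ p
  map-∼ h []      = []-∼
  map-∼ h (x ∷ p) = ∷-∼ (h x) (map-∼ h p)

  below-∼ : ∀ {p q D} → p ∼ₚ q → R[X].DegreeBelow p D → S[X].DegreeBelow q D
  below-∼ h below i le = T.unique (T.respˡ (below i le) (h .at∼ i)) T.0-∼

-- Division with remainder, and Euclid's algorithm over a field.

module Division (R : CommutativeRing a b) where
  open RingNotation R hiding (zero)
  open Polynomial R
  open CommutativeRingLemmas R
  open PolynomialLemmas R

  -- Horner's scheme: if `r` is the remainder of `p`, then `x ∷ r` has degree at most `D`, and one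
  -- multiple of `q` removes its coefficient at `D`. The quotient enters with a plus sign.
  divide : ∀ q {D} → DegreeBelow q (suc D) → (∃ λ l → coeff q D * l ≈ 1#) →
           ∀ p → ∃ λ s → DegreeBelow (p +ₚ s *ₚ q) D
  divide q     hq (l , e) []      = [] , λ i _ → refl
  divide q {D} hq (l , e) (x ∷ p) with divide q hq (l , e) p
  ... | s , hr = (0# ∷ s) +ₚ const y , below-suc {u} (below-cong {(x ∷ r) +ₚ const y *ₚ q} (symₚ eq)
        (below-+ (x ∷ r) (const y *ₚ q) below-∷ (λ i le → trans (coeff-const-* y q i) (trans (*-congˡ (hq i le)) (zeroʳ y)))))
        (trans (eq .at D) (trans (coeff-+ (x ∷ r) (const y *ₚ q) D) cancelled))
    where
    r = p +ₚ s *ₚ q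
    z = coeff (x ∷ r) D
    y = - (z * l)
    u = (x ∷ p) +ₚ ((0# ∷ s) +ₚ const y) *ₚ q
    below-∷ : DegreeBelow (x ∷ r) (suc D)
    below-∷ (suc i) (s≤s le) = hr i le
    cancelled : z + coeff (const y *ₚ q) D ≈ 0#
    cancelled = begin
      z + coeff (const y *ₚ q) D     ≈⟨ +-congˡ (coeff-const-* y q D) ⟩
      z + - (z * l) * coeff q D      ≈⟨ +-congˡ (-‿distribˡ-* (z * l) (coeff q D)) ⟨
      z - z * l * coeff q D          ≈⟨ +-congˡ (-‿cong (trans (*-assoc _ _ _) (*-congˡ (trans (*-comm _ _) e)))) ⟩
      z - z * 1#                     ≈⟨ +-congˡ (-‿cong (*-identityʳ z)) ⟩
      z - z                          ≈⟨ -‿inverseʳ z ⟩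
      0#                             ∎
      where open SetoidReasoning setoid
    eq : u ≈ₚ (x ∷ r) +ₚ const y *ₚ q
    eq = begin
      (x ∷ p) +ₚ ((0# ∷ s) +ₚ const y) *ₚ q
        ≈⟨ P.+-congˡ {x ∷ p} (*ₚ-distribʳ q (0# ∷ s) (const y)) ⟩
      (x ∷ p) +ₚ ((0# ∷ s) *ₚ q +ₚ const y *ₚ q)
        ≈⟨ +ₚ-assoc (x ∷ p) ((0# ∷ s) *ₚ q) (const y *ₚ q) ⟨
      (x ∷ p) +ₚ (0# ∷ s) *ₚ q +ₚ const y *ₚ q
        ≈⟨ P.+-congʳ (P.+-congˡ {x ∷ p} (0∷-* s q)) ⟩
      (x + 0# ∷ r) +ₚ const y *ₚ q
        ≈⟨ P.+-congʳ {const y *ₚ q} {x + 0# ∷ r} (∷-cong (+-identityʳ x) reflₚ) ⟩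
      (x ∷ r) +ₚ const y *ₚ q ∎
      where open SetoidReasoning P.setoid

record IsField (R : CommutativeRing a b) : Set (a ⊔ b) where
  open RingNotation R
  field
    1≉0     : 1# ≉ 0#
    zero?   : ∀ x → Dec (x ≈ 0#)
    inverse : ∀ x → x ≉ 0# → ∃ λ y → x * y ≈ 1#

module FieldPolynomials (R : CommutativeRing a b) (isField : IsField R) where
  open RingNotation R hiding (zero)
  open IsField isField
  open Polynomial R
  open CommutativeRingLemmas R
  open PolynomialLemmas R
  open Division R
  private
    module R[X] = PolynomialNotation R
    module PS   = Solver P.commutativeSemiring

  nonzero-regular : ∀ {x} → x ≉ 0# → Regular x
  nonzero-regular {x} x≉0 y e with inverse x x≉0
  ... | l , f = begin
    y            ≈⟨ *-identityˡ y ⟨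
    1# * y       ≈⟨ *-congʳ (trans (*-comm l x) f) ⟨
    l * x * y    ≈⟨ *-assoc l x y ⟩
    l * (x * y)  ≈⟨ *-congˡ e ⟩
    l * 0#       ≈⟨ zeroʳ l ⟩
    0#           ∎
    where open SetoidReasoning setoid

  zeroₚ? : ∀ p → Dec (p ≈ₚ [])
  zeroₚ? []      = yes reflₚ
  zeroₚ? (x ∷ p) with zero? x | zeroₚ? p
  ... | yes e | yes h = yes (transₚ (∷-cong e h) 0∷[]≈[])
  ... | no ¬e | _     = no λ h → ¬e (h .at 0)
  ... | yes _ | no ¬h = no λ h → ¬h (tail-zero h)

  degree-below : ∀ p D → DegreeBelow p D → ¬ (p ≈ₚ []) → ∃ λ E → suc E ≤ D × R[X].HasDegree p E
  degree-below p zero    hp p≉0 = contradiction (below-0⇒≈0 hp) p≉0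
  degree-below p (suc D) hp p≉0 with zero? (coeff p D)
  ... | no  e = D , ℕₚ.≤-refl , e , hp
  ... | yes e with degree-below p D (below-suc {p} hp e) p≉0
  ...   | E , le , h = E , ℕₚ.m≤n⇒m≤1+n le , h

  degree : ∀ p → ¬ (p ≈ₚ []) → ∃ (R[X].HasDegree p)
  degree p p≉0 with degree-below p (length p) (below-length p) p≉0
  ... | E , _ , h = E , h

  -- Euclid's algorithm with the degree bound of the second argument as recursion measure; it drops
  -- either because a top coefficient is zero or because a remainder is taken.
  bezout-below : ∀ D p q → DegreeBelow q D → P.Bezout p q
  bezout-below zero    p q hq = P.mkBezout p P.1# P.0#
    (P.trans (P.+-identityʳ _) (P.*-identityˡ p)) P.∣ʳ-refl
    (P.∣ʳ-respʳ-≈ (P.sym (below-0⇒≈0 hq)) (P.x∣0 p))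
  bezout-below (suc D) p q hq with zero? (coeff q D)
  ... | yes e = bezout-below D p q (below-suc {q} hq e)
  ... | no ¬e with divide q hq (inverse _ ¬e) p
  ...   | s , hr with bezout-below D q (p +ₚ s *ₚ q) hr
  ...     | P.mkBezout g u w e g∣q g∣r = P.mkBezout g w (u +ₚ w *ₚ s)
    (P.trans (PS.solve 5 (λ p q s u w → w PS.:* p PS.:+ (u PS.:+ w PS.:* s) PS.:* q
       PS.:= u PS.:* q PS.:+ w PS.:* (p PS.:+ s PS.:* q)) reflₚ p q s u w) e)
    (P.∣ʳ-respʳ-≈ eq (P.∣-+ g∣r (P.∣-neg (P.x∣ʳy⇒x∣ʳzy s g∣q)))) g∣q
    where
    eq : (p +ₚ s *ₚ q) P.- s *ₚ q ≈ₚ p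
    eq = P.trans (+ₚ-assoc p (s *ₚ q) (-ₚ (s *ₚ q)))
      (P.trans (P.+-congˡ {p} (-ₚ-inverseʳ (s *ₚ q))) (+ₚ-identityʳ p))

  bezout : ∀ p q → P.Bezout p q
  bezout p q = bezout-below (length q) p q (below-length q)

  unit-gcd⇒comaximal : ∀ {p q} (B : P.Bezout p q) → P.Bezout.gcd B P.∣ P.1# → P.Comaximal p q
  unit-gcd⇒comaximal {p} {q} (P.mkBezout g u w e _ _) (l P., f) = l *ₚ u , l *ₚ w , P.trans
    (PS.solve 5 (λ p q l u w → (l PS.:* u) PS.:* p PS.:+ (l PS.:* w) PS.:* q
       PS.:= l PS.:* (u PS.:* p PS.:+ w PS.:* q)) reflₚ p q l u w)
    (P.trans (*ₚ-congˡ l e) f)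

  squarefree⇒comaximal : ∀ {f} → P.Squarefree f → ∀ p q → p *ₚ q P.∣ f → P.Comaximal p q
  squarefree⇒comaximal sf p q pq∣f = unit-gcd⇒comaximal B (sf (P.∣ʳ-trans g²∣pq pq∣f))
    where
    B = bezout p q
    open P.Bezout B
    g²∣pq : gcd *ₚ gcd P.∣ p *ₚ q
    g²∣pq with gcd∣x | gcd∣y
    ... | s P., e | r P., f = (s *ₚ r) P., P.trans
      (PS.solve 3 (λ s r g → (s PS.:* r) PS.:* (g PS.:* g) PS.:= (s PS.:* g) PS.:* (r PS.:* g)) reflₚ s r gcd)
      (*ₚ-cong e f)

  nonzero-regularₚ : ∀ {p} → ¬ (p ≈ₚ []) → P.Regular p
  nonzero-regularₚ {p} p≉0 with degree p p≉0
  ... | D , lead , hp = lead-regular {p} hp (nonzero-regular lead)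

  irreducible⇒comaximal : ∀ {v p} → P.Irreducible v → ¬ (v P.∣ p) → P.Comaximal p v
  irreducible⇒comaximal {v} {p} irr v∤p with bezout p v
  ... | B@(P.mkBezout g u w e g∣p (s P., sg≈v)) with P.Irreducible.split-∣1 irr {s} {g} (symₚ sg≈v)
  ...   | inj₂ g∣1        = unit-gcd⇒comaximal B g∣1
  ...   | inj₁ (l P., ls≈1) = contradiction (P.∣ʳ-trans (l P., lv≈g) g∣p) v∤p
    where
    lv≈g : l *ₚ v ≈ₚ g
    lv≈g = transₚ (*ₚ-congˡ l (symₚ sg≈v)) (transₚ (symₚ (*ₚ-assoc l s g))
      (transₚ (*ₚ-cong ls≈1 (reflₚ {g})) (*ₚ-identityˡ g)))

-- Frobenius, perfectness of finite fields, and nonvanishing derivatives.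

prime∤! : ∀ {p} → Prime p → ∀ k → k ℕ.< p → ¬ (p ∣ℕ.∣ (k ℕ.!))
prime∤! pr zero    k<p p∣1 = contradiction (≡.subst Prime (∣ℕ.∣1⇒≡1 p∣1) pr) ¬prime[1]
prime∤! pr (suc k) k<p p∣! with euclidsLemma (suc k) (k ℕ.!) pr p∣!
... | inj₁ h = ℕₚ.<⇒≱ k<p (∣ℕ.∣⇒≤ h)
... | inj₂ h = prime∤! pr k (ℕₚ.<-trans (ℕₚ.n<1+n k) k<p) h

prime∣C : ∀ {p} → Prime p → ∀ k → 0 ℕ.< k → k ℕ.< p → p ∣ℕ.∣ (p C k)
prime∣C {zero}  pr k 0<k ()
prime∣C {suc q} pr k 0<k k<p with euclidsLemma (suc q C k) (k ℕ.! ℕ.* (suc q ℕ.∸ k) ℕ.!) pr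
  (≡.subst (suc q ∣ℕ.∣_) (≡.sym factored) (∣ℕ.m∣m*n (q ℕ.!)))
  where
  instance _ = ℕₚ._!*_!≢0 k (suc q ℕ.∸ k)
  factored : (suc q C k) ℕ.* (k ℕ.! ℕ.* (suc q ℕ.∸ k) ℕ.!) ≡ (suc q) ℕ.!
  factored = ≡.trans
    (≡.cong (ℕ._* (k ℕ.! ℕ.* (suc q ℕ.∸ k) ℕ.!)) (nCk≡n!/k![n-k]! (ℕₚ.<⇒≤ k<p)))
    (DivMod.m/n*n≡m (k![n∸k]!∣n! (ℕₚ.<⇒≤ k<p)))
... | inj₁ h = h
... | inj₂ h with euclidsLemma (k ℕ.!) ((suc q ℕ.∸ k) ℕ.!) pr h
...   | inj₁ h′ = contradiction h′ (prime∤! pr k k<p)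
...   | inj₂ h′ = contradiction h′ (prime∤! pr (suc q ℕ.∸ k) (ℕₚ.∸-monoʳ-< 0<k (ℕₚ.<⇒≤ k<p)))

HasCharacteristic : CommutativeRing a b → ℕ → Set b
HasCharacteristic R p = p · 1# ≈ 0#
  where open RingNotation R

HasRoots : CommutativeRing a b → ℕ → Set (a ⊔ b)
HasRoots R p = ∀ x → ∃ λ y → y ^ p ≈ x
  where open RingNotation R

module Frobenius (R : CommutativeRing a b) {p} (prime : Prime p) (char : HasCharacteristic R p) where
  open RingNotation R hiding (zero)
  open CommutativeRingLemmas R
  open SemiringMult semiring using (×-assocˡ; ×-assoc-*; ×-congʳ; ×-homo-1)
  open SemiringExp semiring using (^-congˡ)

  p·≈0 : ∀ x → p · x ≈ 0#
  p·≈0 x = begin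
    p · x           ≈⟨ ×-congʳ p (*-identityˡ x) ⟨
    p · (1# * x)    ≈⟨ ×-assoc-* p 1# x ⟨
    (p · 1#) * x    ≈⟨ *-congʳ char ⟩
    0# * x          ≈⟨ zeroˡ x ⟩
    0#              ∎
    where open SetoidReasoning setoid

  ∣⇒·≈0 : ∀ {n} → p ∣ℕ.∣ n → ∀ x → n · x ≈ 0#
  ∣⇒·≈0 (∣ℕ.divides q ≡.refl) x = trans (sym (×-assocˡ x q p))
    (trans (×-congʳ q (p·≈0 x)) (·-zero q))

  ·-bezout : ∀ x u w k l → 1 ℕ.+ w ℕ.* k ≡ u ℕ.* l → k · x ≈ 0# → l · x ≈ 0# → x ≈ 0#
  ·-bezout x u w k l eq e f = begin
    x                       ≈⟨ +-identityʳ x ⟨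
    x + 0#                  ≈⟨ +-congˡ (trans (sym (×-assocˡ x w k)) (trans (×-congʳ w e) (·-zero w))) ⟨
    x + (w ℕ.* k) · x       ≡⟨ ≡.cong (_· x) eq ⟩
    (u ℕ.* l) · x           ≈⟨ trans (sym (×-assocˡ x u l)) (trans (×-congʳ u f) (·-zero u)) ⟩
    0#                      ∎
    where open SetoidReasoning setoid

  ∤∧·≈0⇒≈0 : ∀ {n} → ¬ (p ∣ℕ.∣ n) → ∀ x → n · x ≈ 0# → x ≈ 0#
  ∤∧·≈0⇒≈0 {n} p∤n x e with Coprimality.coprime-Bézout coprime
    where
    coprime : Coprimality.Coprime p n
    coprime (d∣p , d∣n) with prime⇒irreducible prime d∣p
    ... | inj₁ d≡1    = d≡1
    ... | inj₂ ≡.refl = contradiction d∣n p∤n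
  ... | GCD.Bézout.+- u w eq = ·-bezout x u w n p eq e (p·≈0 x)
  ... | GCD.Bézout.-+ u w eq = ·-bezout x w u p n eq (p·≈0 x) e

  frobenius-+ : ∀ x y → (x + y) ^ p ≈ x ^ p + y ^ p
  frobenius-+ x y = go p ≡.refl
    where
    open Binomial commutativeSemiring using (theorem; binomialTerm; binomial)
    -- `p` is a fixed parameter, so the case split that isolates the first and last binomial terms
    -- is made on a variable equal to it.
    go : ∀ q → q ≡ p → (x + y) ^ q ≈ x ^ q + y ^ q
    go zero    e = contradiction (≡.subst Prime (≡.sym e) prime) ¬prime[0]
    go (suc q) e = begin
      (x + y) ^ suc q                        ≈⟨ theorem (suc q) x y ⟩
      term zero + sum (term ∘ suc)                 ≈⟨ +-congˡ (sum-init-last (term ∘ suc)) ⟩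
      term zero + (sum middle + term (suc (Fin.fromℕ q)))   ≈⟨ +-congˡ (+-congʳ (sum-zero middle vanishes)) ⟩
      term zero + (0# + term (suc (Fin.fromℕ q)))  ≈⟨ +-cong first (trans (+-identityˡ _) last) ⟩
      y ^ suc q + x ^ suc q                  ≈⟨ +-comm _ _ ⟩
      x ^ suc q + y ^ suc q                  ∎
      where
      open SetoidReasoning setoid
      term = binomialTerm x y (suc q)
      middle : Vector Carrier q
      middle i = term (suc (Fin.inject₁ i))
      first : term zero ≈ y ^ suc q
      first = trans (reflexive (≡.cong (_· binomial x y (suc q) zero)
          (≡.trans (nCk≡nC[n∸k] {0} {suc q} z≤n) (nCn≡1 (suc q)))))
        (trans (×-homo-1 _) (*-identityˡ _))
      last : term (suc (Fin.fromℕ q)) ≈ x ^ suc q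
      last = begin
        term (suc (Fin.fromℕ q))
          ≡⟨ ≡.cong (λ k → (suc q C suc k) · (x ^ suc k * y ^ (q ℕ.∸ k))) (Finₚ.toℕ-fromℕ q) ⟩
        (suc q C suc q) · (x ^ suc q * y ^ (q ℕ.∸ q))
          ≡⟨ ≡.cong₂ (λ c k → c · (x ^ suc q * y ^ k)) (nCn≡1 (suc q)) (ℕₚ.n∸n≡0 q) ⟩
        1 · (x ^ suc q * 1#)   ≈⟨ ×-homo-1 _ ⟩
        x ^ suc q * 1#         ≈⟨ *-identityʳ _ ⟩
        x ^ suc q              ∎
      vanishes : ∀ i → middle i ≈ 0#
      vanishes i = ∣⇒·≈0 (≡.subst (λ p → p ∣ℕ.∣ (suc q C k)) e
        (prime∣C (≡.subst Prime (≡.sym e) prime) k (s≤s z≤n)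
          (s≤s (≡.subst (ℕ._< q) (≡.sym (Finₚ.toℕ-inject₁ i)) (Finₚ.toℕ<n i))))) _
        where k = toℕ (suc (Fin.inject₁ i))

  frobenius-0 : 0# ^ p ≈ 0#
  frobenius-0 = go p ≡.refl
    where
    go : ∀ q → q ≡ p → 0# ^ q ≈ 0#
    go zero    e = contradiction (≡.subst Prime (≡.sym e) prime) ¬prime[0]
    go (suc q) e = zeroˡ _

  iterate : ℕ → Carrier → Carrier
  iterate zero    x = x
  iterate (suc n) x = iterate n x ^ p

  module _ (reduced : ∀ n x → x ^ n ≈ 0# → x ≈ 0#) where

    frobenius-injective : ∀ {x y} → x ^ p ≈ y ^ p → x ≈ y
    frobenius-injective {x} {y} e = x∙y⁻¹≈ε⇒x≈y x y (reduced p (x - y) (begin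
      (x - y) ^ p             ≈⟨ frobenius-+ x (- y) ⟩
      x ^ p + (- y) ^ p       ≈⟨ +-congʳ e ⟩
      y ^ p + (- y) ^ p       ≈⟨ frobenius-+ y (- y) ⟨
      (y - y) ^ p             ≈⟨ ^-congˡ p (-‿inverseʳ y) ⟩
      0# ^ p                  ≈⟨ frobenius-0 ⟩
      0#                      ∎))
      where open SetoidReasoning setoid

    -- Among `x`, `x ^ p`, `(x ^ p) ^ p`, ... two agree by the pigeonhole principle. Injectivity of
    -- Frobenius strips common `p`-th powers until `x` itself equals a later iterate, which is a
    -- `p`-th power. An injective code of the classes into `Fin N` suffices for this.
    finite⇒perfect : ∀ {N} (code : Carrier → Fin N) → (∀ {x y} → code x ≡ code y → x ≈ y) →
                     HasRoots R p
    finite⇒perfect {N} code injective x with Finₚ.pigeonhole (ℕₚ.n<1+n N) (λ i → code (iterate (toℕ i) x))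
    ... | i , j , i<j , e = root (toℕ j) i<j (injective e)
      where
      root : ∀ {i} j → i ℕ.< j → iterate i x ≈ iterate j x → ∃ λ y → y ^ p ≈ x
      root {zero}  (suc j) _         e = iterate j x , sym e
      root {suc i} (suc j) (s≤s i<j) e = root j i<j (frobenius-injective e)

module PerfectField (R : CommutativeRing a b) (isField : IsField R)
  {p} (prime : Prime p) (char : HasCharacteristic R p) (perfect : HasRoots R p) where
  open RingNotation R hiding (zero)
  open IsField isField
  open Polynomial R
  open CommutativeRingLemmas R
  open PolynomialLemmas R
  open FieldPolynomials R isField
  open Frobenius R prime char using (∤∧·≈0⇒≈0)
  private module R[X] = PolynomialNotation R

  charₚ : p P.· P.1# ≈ₚ P.0#
  charₚ = transₚ (const-· p) (transₚ (const-cong char) 0∷[]≈[])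

  open Frobenius polynomialRing prime charₚ using () renaming (frobenius-+ to frobeniusₚ-+)
  open SemiringExp P.semiring using (^-congˡ)
  open CommutativeExp P.commutativeSemiring using (^-distrib-*)

  X^-* : ∀ n u → (∀ i → i ℕ.< n → coeff u i ≈ 0#) → X P.^ n *ₚ List.drop n u ≈ₚ u
  X^-* zero    u       h = *ₚ-identityˡ u
  X^-* (suc n) []      h = *ₚ-zeroʳ (X P.^ suc n)
  X^-* (suc n) (x ∷ u) h = transₚ (*ₚ-assoc X (X P.^ n) (List.drop n u))
    (transₚ (*ₚ-congˡ X (X^-* n u (λ i lt → h (suc i) (s≤s lt))))
      (transₚ (X-* u) (∷-cong (sym (h 0 (s≤s z≤n))) reflₚ)))

  coeff-drop : ∀ n u i → coeff (List.drop n u) i ≈ coeff u (n ℕ.+ i)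
  coeff-drop zero    u       i = refl
  coeff-drop (suc n) []      i = refl
  coeff-drop (suc n) (x ∷ u) i = coeff-drop n u i

  -- Such a polynomial is `x + X ^ p u₁` with `u₁` of the same kind. If `y ^ p = x` and
  -- `h ^ p = u₁`, then additivity of Frobenius gives `(y + X h) ^ p = x + X ^ p u₁`.
  p-th-root : ∀ u → (∀ i → ¬ (p ∣ℕ.∣ i) → coeff u i ≈ 0#) → ∃ λ h → h P.^ p ≈ₚ u
  p-th-root u sparse = go p ≡.refl (length u) u ℕₚ.≤-refl sparse
    where
    -- `L` drives the recursion, since dropping entries is not structural. Again `q` replaces the
    -- parameter `p`, in order to be split as a successor.
    go : ∀ q → q ≡ p → ∀ L u → length u ≤ L → (∀ i → ¬ (p ∣ℕ.∣ i) → coeff u i ≈ 0#) → ∃ λ h → h P.^ p ≈ₚ u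
    go zero    e L u le sparse = contradiction (≡.subst Prime (≡.sym e) prime) ¬prime[0]
    go (suc q) ≡.refl L []      le sparse = [] , reflₚ
    go (suc q) ≡.refl (suc L) (x ∷ u) (s≤s le) sparse
      with go (suc q) ≡.refl L (List.drop q u)
             (ℕₚ.≤-trans (ℕₚ.≤-reflexive (Listₚ.length-drop q u)) (ℕₚ.≤-trans (ℕₚ.m∸n≤m (length u) q) le))
             (λ i p∤i → trans (coeff-drop q u i)
               (sparse (suc q ℕ.+ i) (λ d → p∤i (∣ℕ.∣m+n∣m⇒∣n d ∣ℕ.∣-refl))))
         | perfect x
    ... | h , e | y , f = y ∷ h , (begin
      (y ∷ h) P.^ p                        ≈⟨ ^-congˡ p (∷≈const+X* y h) ⟩
      (const y +ₚ X *ₚ h) P.^ p            ≈⟨ frobeniusₚ-+ (const y) (X *ₚ h) ⟩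
      const y P.^ p +ₚ (X *ₚ h) P.^ p      ≈⟨ P.+-cong (transₚ (symₚ (const-^ y p)) (const-cong f)) (^-distrib-* X h p) ⟩
      const x +ₚ X P.^ p *ₚ h P.^ p        ≈⟨ P.+-congˡ {const x} (*ₚ-congˡ (X P.^ p) e) ⟩
      const x +ₚ X P.^ p *ₚ List.drop q u  ≈⟨ P.+-congˡ {const x} (*ₚ-assoc X (X P.^ q) (List.drop q u)) ⟩
      const x +ₚ X *ₚ (X P.^ q *ₚ List.drop q u)
        -- With `p = suc q`, the entries dropped from `u` are the coefficients `1`, ..., `q` of
        -- `x ∷ u`, whose indices `p` does not divide.
        ≈⟨ P.+-congˡ {const x} (*ₚ-congˡ X (X^-* q u (λ i lt → sparse (suc i) (λ d → ℕₚ.<⇒≱ (s≤s lt) (∣ℕ.∣⇒≤ d))))) ⟩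
      const x +ₚ X *ₚ u                    ≈⟨ ∷≈const+X* x u ⟨
      x ∷ u                                ∎)
      where open SetoidReasoning P.setoid

  -- If `u′` vanished, the exponents occurring in `u` would be multiples of `p`, so `u = h ^ p`.
  -- Then `h * h` divides `f`, so `h` is a unit, and so is `u`, against its positive degree.
  derivative-squarefree-≉0 : ∀ {f u D} → P.Squarefree f → u P.∣ f → R[X].HasDegree u (suc D) →
                             ¬ (derivative u ≈ₚ [])
  derivative-squarefree-≉0 {f} {u} {D} sf u∣f (lead , below) u′≈0
    with p-th-root u sparse
    where
    sparse : ∀ i → ¬ (p ∣ℕ.∣ i) → coeff u i ≈ 0#
    sparse zero    p∤0 = contradiction (p ∣ℕ.∣0) p∤0
    sparse (suc i) p∤i = ∤∧·≈0⇒≈0 p∤i _ (trans (sym (coeff-derivative u i)) (u′≈0 .at i))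
  ... | h , e = 1≉0 (lead-below-∣ below (nonzero-regular lead) (λ { (suc i) _ → refl }) u∣1 .at 0)
    where
    h²∣h^ : ∀ q → Prime q → h *ₚ h P.∣ h P.^ q
    h²∣h^ zero          pr = contradiction pr ¬prime[0]
    h²∣h^ (suc zero)    pr = contradiction pr ¬prime[1]
    h²∣h^ (suc (suc q)) pr = h P.^ q P., transₚ (*ₚ-comm (h P.^ q) (h *ₚ h)) (*ₚ-assoc h h (h P.^ q))
    u∣1 : u P.∣ P.1#
    u∣1 = P.∣ʳ-respˡ-≈ e (P.^-∣-1 p (sf (P.∣ʳ-trans (P.∣ʳ-respʳ-≈ e (h²∣h^ p prime)) u∣f)))

-- Fractions and quotients of a ring.

module FractionLemmas (R : CommutativeRing a b)
  (1≉0 : CommutativeRing._≉_ R (CommutativeRing.1# R) (CommutativeRing.0# R))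
  (cancel : AlmostLeftCancellative (CommutativeRing._≈_ R) (CommutativeRing.0# R)
              (CommutativeRing._*_ R)) where
  open RingNotation R hiding (zero)
  open Fractions R 1≉0 cancel
  private
    module S     = Solver commutativeSemiring
    module K     = RingNotation fractionField

  κ-cong : ∀ {x y} → x ≈ y → κ x K.≈ κ y
  κ-cong e = fromNum e refl

  κ-+ : ∀ x y → κ (x + y) K.≈ κ x K.+ κ y
  κ-+ x y = fromNum (sym (+-cong (*-identityʳ x) (*-identityʳ y))) (sym (*-identityʳ 1#))

  κ-* : ∀ x y → κ (x * y) K.≈ κ x K.* κ y
  κ-* x y = fromNum refl (sym (*-identityʳ 1#))

  κ-injective : ∀ {x y} → κ x K.≈ κ y → x ≈ y
  κ-injective (mk≈ᶠ e) = trans (sym (*-identityʳ _)) (trans e (*-identityʳ _))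

  κ-den-* : ∀ x → κ (den x) K.* x K.≈ κ (num x)
  κ-den-* (mkFraction m d _) .cross = S.solve 2 (λ m d → (d S.:* m) S.:* S.con 1 S.:= m S.:* (S.con 1 S.:* d)) refl m d

  fraction-zero? : (∀ x → Dec (x ≈ 0#)) → ∀ x → Dec (x K.≈ K.0#)
  fraction-zero? zero? (mkFraction m d _) with zero? m
  ... | yes m≈0 = yes (mk≈ᶠ (trans (*-congʳ m≈0) (trans (zeroˡ 1#) (sym (zeroˡ d)))))
  ... | no  m≉0 = no λ { (mk≈ᶠ e) → m≉0 (trans (sym (*-identityʳ m)) (trans e (zeroˡ d))) }

  fraction-inverse : ∀ x → x K.≉ K.0# → ∃ λ y → x K.* y K.≈ K.1#
  fraction-inverse (mkFraction m d d≉0) x≉0 =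
    mkFraction d m (λ m≈0 → x≉0 (mk≈ᶠ (trans (*-congʳ m≈0) (trans (zeroˡ 1#) (sym (zeroˡ d)))))) ,
    mk≈ᶠ (trans (*-identityʳ _) (trans (*-comm m d) (sym (*-identityˡ _))))

  fraction-1≉0 : K.1# K.≉ K.0#
  fraction-1≉0 e = 1≉0 (κ-injective e)

module QuotientLemmas (R : CommutativeRing a b) (v : CommutativeRing.Carrier R) where
  open RingNotation R hiding (zero)
  open CommutativeRingLemmas R
  open Quotient R v using (_≡ᵥ_; mk≡ᵥ; divides; fromEq; transᵥ; symᵥ; +-congᵥ; *-congᵥ; quotientRing)

  ∣⇒≡0 : ∀ {x} → v ∣ x → x ≡ᵥ 0#
  ∣⇒≡0 v∣x = mk≡ᵥ (∣ʳ-respʳ-≈ (sym (trans (+-congˡ -0≈0) (+-identityʳ _))) v∣x)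

  ≡0⇒∣ : ∀ {x} → x ≡ᵥ 0# → v ∣ x
  ≡0⇒∣ e = ∣ʳ-respʳ-≈ (trans (+-congˡ -0≈0) (+-identityʳ _)) (divides e)

  quotient-relation : RingRelation R quotientRing (a ⊔ b)
  quotient-relation = record
    { _∼_    = _≡ᵥ_
    ; respˡ  = λ e h → transᵥ (fromEq (sym e)) h
    ; respʳ  = λ e h → transᵥ h e
    ; unique = λ h k → transᵥ (symᵥ h) k
    ; 0-∼    = fromEq refl
    ; 1-∼    = fromEq refl
    ; +-∼    = +-congᵥ
    ; *-∼    = *-congᵥ
    }

  private
    module R[X] = Polynomial R
    module Q[X] = Polynomial quotientRing
  open PolynomialRelation quotient-relation using (_∼ₚ_; at∼; []-∼; ∷-∼)

  -- A polynomial keeps its list when the equality of the coefficients is coarsened, but `coeff` is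
  -- then the function of another ring.
  coeff-≡ : ∀ p i → R[X].coeff p i ≡ Q[X].coeff p i
  coeff-≡ []      i       = ≡.refl
  coeff-≡ (x ∷ p) zero    = ≡.refl
  coeff-≡ (x ∷ p) (suc i) = coeff-≡ p i

  reduction : ∀ p → p ∼ₚ p
  reduction p .at∼ i = fromEq (reflexive (coeff-≡ p i))

-- Contents, primitive polynomials and Gauss' lemma over a Bézout domain.

record IsBezoutDomain (R : CommutativeRing a b) : Set (a ⊔ b) where
  open RingNotation R
  open CommutativeRingLemmas R
  field
    zero?           : ∀ x → Dec (x ≈ 0#)
    nonzero-regular : ∀ {x} → x ≉ 0# → Regular x
    bezout          : ∀ x y → Bezout x y

record IsFractionField (R : CommutativeRing a b) (K : CommutativeRing c d) : Set (a ⊔ b ⊔ c ⊔ d) where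
  private
    module R = RingNotation R
    module K = RingNotation K
  field
    isField     : IsField K
    κ           : R.Carrier → K.Carrier
    κ-cong      : ∀ {x y} → x R.≈ y → κ x K.≈ κ y
    κ-0         : κ R.0# K.≈ K.0#
    κ-1         : κ R.1# K.≈ K.1#
    κ-+         : ∀ x y → κ (x R.+ y) K.≈ κ x K.+ κ y
    κ-*         : ∀ x y → κ (x R.* y) K.≈ κ x K.* κ y
    κ-injective : ∀ {x y} → κ x K.≈ κ y → x R.≈ y
    fraction    : ∀ x → ∃ λ m → ∃ λ n → n R.≉ R.0# × κ n K.* x K.≈ κ m

module Content (R : CommutativeRing a b) (isBezoutDomain : IsBezoutDomain R) where
  open RingNotation R hiding (zero)
  open IsBezoutDomain isBezoutDomain
  open Polynomial R
  open CommutativeRingLemmas R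
  open PolynomialLemmas R
  private module S = Solver commutativeSemiring

  -- Over a Bézout domain this means that the coefficients generate the unit ideal. In this form it
  -- reads: modulo each `c`, only zero is annihilated by all coefficients of `p`, which is the
  -- hypothesis of `mccoy` over `R / (c)`.
  Primitive : Poly → Set (a ⊔ b)
  Primitive p = ∀ c x → (∀ i → c ∣ coeff p i * x) → c ∣ x

  const-∣ : ∀ {c} p → (∀ i → c ∣ coeff p i) → const c P.∣ p
  const-∣ {c} p h with divided p h
    where
    divided : ∀ p → (∀ i → c ∣ coeff p i) → ∃ λ q → scale c q ≈ₚ p
    divided []      h = [] , reflₚ
    divided (x ∷ p) h with h 0 | divided p (h ∘ suc)
    ... | y , e | q , f = (y ∷ q) , ∷-cong (trans (*-comm c y) e) f
  ... | q , e = q P., transₚ (*ₚ-comm q (const c))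
    (transₚ (P.+-congˡ {scale c q} 0∷[]≈[]) (transₚ (+ₚ-identityʳ _) e))

  -- McCoy's theorem over `R / (c)` takes the place of the argument modulo a prime, so `c` may be
  -- arbitrary and no factorization into primes is made.
  gauss : ∀ {p q c} → Primitive p → const c P.∣ p *ₚ q → const c P.∣ q
  gauss {p} {q} {c} prim (s P., e) = const-∣ q λ i → ∣ʳ-respʳ-≈ (reflexive (≡.sym (coeff-≡ q i))) (≡0⇒∣ (q≈0 .Q[X].at i))
    where
    open QuotientLemmas R c
    open Quotient R c using (quotientRing; transᵥ; symᵥ)
    module Q[X] = Polynomial quotientRing
    module QL   = PolynomialLemmas quotientRing
    open PolynomialRelation quotient-relation
    open RingRelation polynomialRelation using (*-∼)
    pq≈0 : p Q[X].*ₚ q Q[X].≈ₚ []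
    pq≈0 .Q[X].at i = transᵥ (symᵥ (*-∼ (reduction p) (reduction q) .at∼ i))
      (∣⇒≡0 (coeff s i , trans (*-comm _ _) (trans (sym (coeff-const-* c s i))
        (trans (*ₚ-comm (const c) s .at i) (e .at i)))))
    q≈0 : q Q[X].≈ₚ []
    q≈0 = QL.mccoy p (λ x h → ∣⇒≡0 (prim c x (λ i → ∣ʳ-respʳ-≈ (*-congʳ (reflexive (≡.sym (coeff-≡ p i)))) (≡0⇒∣ (h i))))) q pq≈0

  record PrimitivePart (p : Poly) : Set (a ⊔ b) where
    constructor mkPrimitivePart
    field
      content   : Carrier
      part      : Poly
      factor    : p ≈ₚ scale content part
      part-primitive : Primitive part

  primitivePart : ∀ p → PrimitivePart p
  primitivePart []      = mkPrimitivePart 0# (const 1#) (symₚ (scale-zero (const 1#) refl))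
    (λ c x h → ∣ʳ-respʳ-≈ (*-identityˡ x) (h 0))
  primitivePart (x ∷ p) with primitivePart p
  ... | mkPrimitivePart e q f prim with bezout x e
  ...   | mkBezout g u w comb (x₁ , x₁g≈x) (e₁ , e₁g≈e) with zero? g
  -- A zero gcd forces `x` and `e` to vanish, hence the whole polynomial. Its content is then zero,
  -- and the constant one serves as primitive part.
  ...     | yes g≈0 = mkPrimitivePart 0# (const 1#)
    (transₚ (∷-cong (trans (sym x₁g≈x) (trans (*-congˡ g≈0) (zeroʳ x₁)))
      (transₚ f (scale-zero q (trans (sym e₁g≈e) (trans (*-congˡ g≈0) (zeroʳ e₁))))))
      (transₚ 0∷[]≈[] (symₚ (scale-zero (const 1#) refl))))
    (λ c x h → ∣ʳ-respʳ-≈ (*-identityˡ x) (h 0))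
  ...     | no  g≉0 = mkPrimitivePart g (x₁ ∷ scale e₁ q)
    (∷-cong (trans (sym x₁g≈x) (*-comm x₁ g))
      (transₚ f (transₚ (scale-cong (trans (sym e₁g≈e) (*-comm e₁ g)) reflₚ) (scale-scale g e₁ q))))
    -- `c` divides `x₁ y` and, `q` being primitive, also `e₁ y`; hence it divides `(u x₁ + w e₁) y`,
    -- which is `y`.
    λ c y h → ∣ʳ-respʳ-≈ (unit y) (∣-+ (x∣ʳy⇒x∣ʳzy u (h 0))
      (x∣ʳy⇒x∣ʳzy w (prim c (e₁ * y) (λ i → ∣ʳ-respʳ-≈
        (trans (*-congʳ (coeff-scale e₁ q i)) (S.solve 3 (λ e z y → (e S.:* z) S.:* y S.:= z S.:* (e S.:* y)) refl e₁ (coeff q i) y))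
        (h (suc i))))))
    where
    open SetoidReasoning setoid
    unit-combination : u * x₁ + w * e₁ ≈ 1#
    unit-combination = regular-cancel (nonzero-regular g≉0) (begin
      g * (u * x₁ + w * e₁)          ≈⟨ S.solve 5 (λ g u x w e → g S.:* (u S.:* x S.:+ w S.:* e) S.:= u S.:* (x S.:* g) S.:+ w S.:* (e S.:* g)) refl g u x₁ w e₁ ⟩
      u * (x₁ * g) + w * (e₁ * g)    ≈⟨ +-cong (*-congˡ x₁g≈x) (*-congˡ e₁g≈e) ⟩
      u * x + w * e                  ≈⟨ comb ⟩
      g                              ≈⟨ *-identityʳ g ⟨
      g * 1#                         ∎)
    unit : ∀ y → u * (x₁ * y) + w * (e₁ * y) ≈ y
    unit y = trans (S.solve 5 (λ u x w e y → u S.:* (x S.:* y) S.:+ w S.:* (e S.:* y) S.:= (u S.:* x S.:+ w S.:* e) S.:* y) refl u x₁ w e₁ y)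
      (trans (*-congʳ unit-combination) (*-identityˡ y))

module GaussLemma (R : CommutativeRing a b) (K : CommutativeRing c d)
  (isBezoutDomain : IsBezoutDomain R) (isFractionField : IsFractionField R K) where
  open IsBezoutDomain isBezoutDomain
  open IsFractionField isFractionField
  private
    module R = RingNotation R
    module K = RingNotation K
    module R[X] = PolynomialNotation R
    module K[X] = PolynomialNotation K
    module RP = Polynomial R
    module KP = Polynomial K
    module KL = CommutativeRingLemmas K
    module PL = PolynomialLemmas R
    module KPL = PolynomialLemmas K
    module KS  = Solver K.commutativeSemiring
    module RXS = Solver R[X].commutativeSemiring
    module KXS = Solver K[X].commutativeSemiring
  open Content R isBezoutDomain public

  κ-relation : RingRelation R K d
  κ-relation = record
    { _∼_    = λ x y → κ x K.≈ y
    ; respˡ  = λ e h → K.trans (κ-cong (R.sym e)) h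
    ; respʳ  = λ e h → K.trans h e
    ; unique = λ h k → K.trans (K.sym h) k
    ; 0-∼    = κ-0
    ; 1-∼    = κ-1
    ; +-∼    = λ h k → K.trans (κ-+ _ _) (K.+-cong h k)
    ; *-∼    = λ h k → K.trans (κ-* _ _) (K.*-cong h k)
    }

  open PolynomialRelation κ-relation public
  private module T = RingRelation polynomialRelation

  ∼-injective : ∀ {p p′ q} → p ∼ₚ q → p′ ∼ₚ q → p R[X].≈ p′
  ∼-injective h k .RP.at i = κ-injective (K.trans (h .at∼ i) (K.sym (k .at∼ i)))

  κ-≉0 : ∀ {x} → x R.≉ R.0# → κ x K.≉ K.0#
  κ-≉0 x≉0 e = x≉0 (κ-injective (K.trans e (K.sym κ-0)))

  nonzero-* : ∀ {x y} → x R.≉ R.0# → y R.≉ R.0# → x R.* y R.≉ R.0#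
  nonzero-* x≉0 y≉0 e = y≉0 (nonzero-regular x≉0 _ e)

  clear-denominators : ∀ q → ∃ λ x → ∃ λ p → x R.≉ R.0# × p ∼ₚ KP.const (κ x) K[X].* q
  clear-denominators q with cleared q
    where
    cleared : ∀ q → ∃ λ x → ∃ λ p → x R.≉ R.0# × (∀ i → κ (RP.coeff p i) K.≈ κ x K.* KP.coeff q i)
    cleared []      = R.1# , [] , (λ e → 1≉0 e) , λ i → K.trans κ-0 (K.sym (K.zeroʳ _))
      where
      1≉0 : R.1# R.≉ R.0#
      1≉0 e with fraction K.0#
      ... | m , n , n≉0 , _ = n≉0 (R.trans (R.sym (R.*-identityʳ n)) (R.trans (R.*-congˡ e) (R.zeroʳ n)))
    cleared (y ∷ q) with fraction y | cleared q
    ... | m , n , n≉0 , e | x , p , x≉0 , h =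
      n R.* x , x R.* m ∷ RP.scale n p , nonzero-* n≉0 x≉0 , λ
      { zero    → begin
          κ (x R.* m)               ≈⟨ κ-* x m ⟩
          κ x K.* κ m               ≈⟨ K.*-congˡ e ⟨
          κ x K.* (κ n K.* y)       ≈⟨ KS.solve 3 (λ x n y → x KS.:* (n KS.:* y) KS.:= (n KS.:* x) KS.:* y) K.refl (κ x) (κ n) y ⟩
          (κ n K.* κ x) K.* y       ≈⟨ K.*-congʳ (κ-* n x) ⟨
          κ (n R.* x) K.* y         ∎
      ; (suc i) → begin
          κ (RP.coeff (RP.scale n p) i)         ≈⟨ κ-cong (RP.coeff-scale n p i) ⟩
          κ (n R.* RP.coeff p i)                ≈⟨ κ-* n _ ⟩
          κ n K.* κ (RP.coeff p i)              ≈⟨ K.*-congˡ (h i) ⟩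
          κ n K.* (κ x K.* KP.coeff q i)        ≈⟨ K.*-assoc _ _ _ ⟨
          κ n K.* κ x K.* KP.coeff q i          ≈⟨ K.*-congʳ (κ-* n x) ⟨
          κ (n R.* x) K.* KP.coeff q i          ∎ }
      where open SetoidReasoning K.setoid
  ... | x , p , x≉0 , h = x , p , x≉0 , mk∼ₚ λ i → K.trans (h i) (K.sym (KPL.coeff-const-* (κ x) q i))

  -- Since `g` is monic of degree `D`, the scalar relating it to its primitive multiple can only be
  -- the leading coefficient of that multiple; no separate scalar is stored.
  record PrimitiveAssociate (g : K[X].Carrier) (D : ℕ) : Set (a ⊔ b ⊔ c ⊔ d) where
    field
      poly      : R[X].Carrier
      associate : poly ∼ₚ KP.const (κ (RP.coeff poly D)) K[X].* g
      lead≉0    : RP.coeff poly D R.≉ R.0#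
      below     : R[X].DegreeBelow poly (suc D)
      prim      : Primitive poly

  primitiveAssociate : ∀ g D → KP.coeff g D K.≈ K.1# → K[X].DegreeBelow g (suc D) → PrimitiveAssociate g D
  primitiveAssociate g D monic hg with clear-denominators g
  ... | x , p , x≉0 , h with primitivePart p
  ...   | mkPrimitivePart y q f prim = record
    { poly      = q
    ; associate = mk∼ₚ assoc
    ; lead≉0    = λ e → x≉0 (κ-injective (begin
        κ x                              ≈⟨ lead ⟨
        κ y K.* κ (RP.coeff q D)         ≈⟨ K.*-congˡ (K.trans (κ-cong e) κ-0) ⟩
        κ y K.* K.0#                     ≈⟨ K.zeroʳ _ ⟩
        K.0#                             ≈⟨ κ-0 ⟨
        κ R.0#                           ∎))
    ; below     = λ i le → κ-injective (K.trans (assoc i) (K.trans (KPL.coeff-const-* _ g i)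
        (K.trans (K.*-congˡ (hg i le)) (K.trans (K.zeroʳ _) (K.sym κ-0)))))
    ; prim      = prim
    }
    where
    open SetoidReasoning K.setoid
    scaled : ∀ i → κ y K.* κ (RP.coeff q i) K.≈ κ x K.* KP.coeff g i
    scaled i = begin
      κ y K.* κ (RP.coeff q i)              ≈⟨ κ-* y _ ⟨
      κ (y R.* RP.coeff q i)                ≈⟨ κ-cong (RP.coeff-scale y q i) ⟨
      κ (RP.coeff (RP.scale y q) i)         ≈⟨ κ-cong (f .RP.at i) ⟨
      κ (RP.coeff p i)                      ≈⟨ h .at∼ i ⟩
      KP.coeff (KP.const (κ x) K[X].* g) i  ≈⟨ KPL.coeff-const-* (κ x) g i ⟩
      κ x K.* KP.coeff g i                  ∎
    lead : κ y K.* κ (RP.coeff q D) K.≈ κ x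
    lead = K.trans (scaled D) (K.trans (K.*-congˡ monic) (K.*-identityʳ _))
    κy≉0 : κ y K.≉ K.0#
    κy≉0 e = κ-≉0 x≉0 (K.trans (K.sym lead) (K.trans (K.*-congʳ e) (K.zeroˡ _)))
    assoc : ∀ i → κ (RP.coeff q i) K.≈ KP.coeff (KP.const (κ (RP.coeff q D)) K[X].* g) i
    assoc i = KL.regular-cancel (FieldPolynomials.nonzero-regular K isField κy≉0) (begin
      κ y K.* κ (RP.coeff q i)                      ≈⟨ scaled i ⟩
      κ x K.* KP.coeff g i                          ≈⟨ K.*-congʳ lead ⟨
      κ y K.* κ (RP.coeff q D) K.* KP.coeff g i     ≈⟨ K.*-assoc _ _ _ ⟩
      κ y K.* (κ (RP.coeff q D) K.* KP.coeff g i)   ≈⟨ K.*-congˡ (KPL.coeff-const-* _ g i) ⟨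
      κ y K.* KP.coeff (KP.const (κ (RP.coeff q D)) K[X].* g) i ∎)

  module _ {g D} (A : PrimitiveAssociate g D) where
    open PrimitiveAssociate A

    -- Write `q = s g` and let `x` clear the denominators of `s`, giving `S`. Then `poly S = p y`
    -- over `R` with `y = x lead`. As `poly` is primitive, `y` divides `S`, and cancelling `y` shows
    -- that `poly` divides `p`.
    associate-∣ : ∀ {p q} → p ∼ₚ q → g K[X].∣ q → poly R[X].∣ p
    associate-∣ {p} {q} p∼q (s KPL.P., sg≈q) with clear-denominators s
    ... | x , S , x≉0 , h = divisible (gauss {poly} {S} {y} prim (p PL.P., ∼-injective
          (T.*-∼ p∼q (const-∼ (κ-* x lead))) (T.respʳ eq (T.*-∼ associate h))))
      where
      lead = RP.coeff poly D
      y    = x R.* lead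
      open KXS using (solve; _:*_; _:=_)
      eq : (KP.const (κ lead) K[X].* g) K[X].* (KP.const (κ x) K[X].* s)
           K[X].≈ q K[X].* KP.const (κ x K.* κ lead)
      eq = K[X].trans
        (solve 4 (λ l g x s → (l :* g) :* (x :* s) := (s :* g) :* (x :* l)) K[X].refl (KP.const (κ lead)) g (KP.const (κ x)) s)
        (K[X].*-cong sg≈q (K[X].sym (KPL.const-∼ (κ x) (κ lead))))
      divisible : RP.const y R[X].∣ S → poly R[X].∣ p
      divisible (u PL.P., uy≈S) = u PL.P., PL.P.regular-cancel {RP.const y}
        (PL.const-regular (nonzero-regular (nonzero-* x≉0 lead≉0))) (begin
          RP.const y R[X].* (u R[X].* poly)   ≈⟨ R[X].*-comm (RP.const y) (u R[X].* poly) ⟩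
          u R[X].* poly R[X].* RP.const y     ≈⟨ RXS.solve 3 (λ u p y → (u RXS.:* p) RXS.:* y RXS.:= p RXS.:* (u RXS.:* y)) R[X].refl u poly (RP.const y) ⟩
          poly R[X].* (u R[X].* RP.const y)   ≈⟨ R[X].*-congˡ {poly} uy≈S ⟩
          poly R[X].* S                       ≈⟨ ∼-injective (T.*-∼ p∼q (const-∼ (κ-* x lead))) (T.respʳ eq (T.*-∼ associate h)) ⟨
          p R[X].* RP.const y                 ≈⟨ R[X].*-comm p (RP.const y) ⟩
          RP.const y R[X].* p                 ∎)
        where open SetoidReasoning R[X].setoid

-- Logarithmic derivatives.

module LogarithmicDerivative (R : CommutativeRing a b) where
  open RingNotation R hiding (zero)
  open Polynomial R
  open CommutativeRingLemmas R
  open PolynomialLemmas R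
  open SetoidReasoning P.setoid
  private module PS = Solver P.commutativeSemiring
  open PS using (solve; _:+_; _:*_; _:=_)

  -- The hypothesis says `h = f g′ / g` without a division, and the conclusion is the rule that the
  -- logarithmic derivative of `g ^ w` is `w` times that of `g`. The scalar is kept apart from `w`
  -- because the vectors `e` have entries in the field, not in `ℕ`.
  log-derivative-^ : ∀ f g h → h *ₚ g ≈ₚ f *ₚ derivative g →
                     ∀ w {x} → x ≈ w · 1# → (const x *ₚ h) *ₚ g P.^ w ≈ₚ f *ₚ derivative (g P.^ w)
  log-derivative-^ f g h e zero    {x} x≈0 = begin
    (const x *ₚ h) *ₚ P.1#   ≈⟨ P.*-congʳ {P.1#} (*ₚ-cong (transₚ (const-cong x≈0) 0∷[]≈[]) (reflₚ {h})) ⟩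
    []                       ≈⟨ *ₚ-zeroʳ f ⟨
    f *ₚ []                  ∎
  log-derivative-^ f g h e (suc w) {x} x≈ = begin
    (const x *ₚ h) *ₚ (g *ₚ gʷ)
      ≈⟨ P.*-congʳ {g *ₚ gʷ} (P.*-congʳ {h} (const-cong x≈)) ⟩
    ((P.1# +ₚ y) *ₚ h) *ₚ (g *ₚ gʷ)
      ≈⟨ solve 5 (λ o y h g k → ((o :+ y) :* h) :* (g :* k) := o :* (h :* g) :* k :+ g :* ((y :* h) :* k)) reflₚ P.1# y h g gʷ ⟩
    P.1# *ₚ (h *ₚ g) *ₚ gʷ +ₚ g *ₚ ((y *ₚ h) *ₚ gʷ)
      ≈⟨ P.+-cong (P.*-congʳ {gʷ} (transₚ (*ₚ-identityˡ (h *ₚ g)) e)) (*ₚ-congˡ g (log-derivative-^ f g h e w refl)) ⟩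
    f *ₚ derivative g *ₚ gʷ +ₚ g *ₚ (f *ₚ derivative gʷ)
      ≈⟨ solve 5 (λ f g′ k g k′ → f :* g′ :* k :+ g :* (f :* k′) := f :* (g′ :* k :+ g :* k′)) reflₚ f (derivative g) gʷ g (derivative gʷ) ⟩
    f *ₚ (derivative g *ₚ gʷ +ₚ g *ₚ derivative gʷ)
      ≈⟨ *ₚ-congˡ f (derivative-* g gʷ) ⟨
    f *ₚ derivative (g *ₚ gʷ) ∎
    where
    gʷ = g P.^ w
    y  = const (w · 1#)

  log-derivative-product : ∀ f (gs hs : Vector Poly n) → (∀ i → hs i *ₚ gs i ≈ₚ f *ₚ derivative (gs i)) →
    (w : Fin n → ℕ) (x : Vector Carrier n) → (∀ i → x i ≈ w i · 1#) →
    P.sum (λ i → const (x i) *ₚ hs i) *ₚ P.product (λ i → gs i P.^ w i)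
      ≈ₚ f *ₚ derivative (P.product (λ i → gs i P.^ w i))
  log-derivative-product {n = zero}  f gs hs e w x x≈ = symₚ (*ₚ-zeroʳ f)
  log-derivative-product {n = suc n} f gs hs e w x x≈ = begin
    (s +ₚ S) *ₚ (g *ₚ G)
      ≈⟨ solve 4 (λ s S g G → (s :+ S) :* (g :* G) := (s :* g) :* G :+ g :* (S :* G)) reflₚ s S g G ⟩
    (s *ₚ g) *ₚ G +ₚ g *ₚ (S *ₚ G)
      ≈⟨ P.+-cong (P.*-congʳ {G} (log-derivative-^ f (gs zero) (hs zero) (e zero) (w zero) (x≈ zero)))
           (*ₚ-congˡ g (log-derivative-product f (gs ∘ suc) (hs ∘ suc) (e ∘ suc) (w ∘ suc) (x ∘ suc) (x≈ ∘ suc))) ⟩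
    (f *ₚ derivative g) *ₚ G +ₚ g *ₚ (f *ₚ derivative G)
      ≈⟨ solve 5 (λ f g g′ G G′ → (f :* g′) :* G :+ g :* (f :* G′) := f :* (g′ :* G :+ g :* G′)) reflₚ f g (derivative g) G (derivative G) ⟩
    f *ₚ (derivative g *ₚ G +ₚ g *ₚ derivative G)
      ≈⟨ *ₚ-congˡ f (derivative-* g G) ⟨
    f *ₚ derivative (g *ₚ G) ∎
    where
    s = const (x zero) *ₚ hs zero
    S = P.sum (λ i → const (x (suc i)) *ₚ hs (suc i))
    g = gs zero P.^ w zero
    G = P.product (λ i → gs (suc i) P.^ w (suc i))

  -- Removing `gs j` from `f` leaves the factor `gs i` in place. Modulo `gs i`, therefore, only the
  -- `i`-th summand of a combination of the `hs` survives.
  log-derivative-∣ : ∀ {f c} (gs hs : Vector Poly n) → (∀ i → hs i *ₚ gs i ≈ₚ f *ₚ derivative (gs i)) →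
    f ≈ₚ c *ₚ P.product gs → ∀ {i j} → i ≢ j → P.Regular (gs j) → gs i P.∣ hs j
  log-derivative-∣ {f = f} {c} gs hs e f≈ {i} {j} i≢j reg with P.∣²-product gs i≢j
  ... | q P., qgg≈ = c *ₚ q *ₚ derivative (gs j) P., symₚ (P.regular-cancel {gs j} reg (begin
    gs j *ₚ hs j                                        ≈⟨ *ₚ-comm (gs j) (hs j) ⟩
    hs j *ₚ gs j                                        ≈⟨ e j ⟩
    f *ₚ gs′                                            ≈⟨ P.*-congʳ {gs′} f≈ ⟩
    c *ₚ P.product gs *ₚ gs′                            ≈⟨ P.*-congʳ {gs′} (*ₚ-congˡ c qgg≈) ⟨
    c *ₚ (q *ₚ (gs i *ₚ gs j)) *ₚ gs′
      ≈⟨ solve 5 (λ c q x y z → c :* (q :* (x :* y)) :* z := y :* (c :* q :* z :* x)) reflₚ c q (gs i) (gs j) gs′ ⟩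
    gs j *ₚ (c *ₚ q *ₚ gs′ *ₚ gs i)                     ∎))
    where gs′ = derivative (gs j)

  -- Passes from a monic product `γ` of local factors to its scalar multiple `g`: with `f = h g`,
  -- the polynomial `m = f γ′ / γ` equals `h g′`. For `g = Gⱼ` the right side comes from polynomials
  -- over `𝔽_q[t]` of controlled degree.
  log-derivative-factor : ∀ {f g h γ l m} → h *ₚ g ≈ₚ f → g ≈ₚ const l *ₚ γ → P.Regular g →
                          m *ₚ γ ≈ₚ f *ₚ derivative γ → m ≈ₚ h *ₚ derivative g
  log-derivative-factor {f} {g} {h} {γ} {l} {m} hg≈f g≈ reg e = P.regular-cancel {g} reg (begin
    g *ₚ m                               ≈⟨ P.*-congʳ {m} g≈ ⟩
    const l *ₚ γ *ₚ m                    ≈⟨ solve 3 (λ l γ m → l :* γ :* m := l :* (m :* γ)) reflₚ (const l) γ m ⟩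
    const l *ₚ (m *ₚ γ)                  ≈⟨ *ₚ-congˡ (const l) e ⟩
    const l *ₚ (f *ₚ derivative γ)       ≈⟨ solve 3 (λ l f d → l :* (f :* d) := f :* (l :* d)) reflₚ (const l) f (derivative γ) ⟩
    f *ₚ (const l *ₚ derivative γ)       ≈⟨ *ₚ-congˡ f (derivative-const-* l γ) ⟨
    f *ₚ derivative (const l *ₚ γ)       ≈⟨ *ₚ-congˡ f (derivative-cong g≈) ⟨
    f *ₚ derivative g                    ≈⟨ P.*-congʳ {derivative g} hg≈f ⟨
    h *ₚ g *ₚ derivative g               ≈⟨ solve 3 (λ h g d → h :* g :* d := g :* (h :* d)) reflₚ h g (derivative g) ⟩
    g *ₚ (h *ₚ derivative g)             ∎)

  combination-∣ : ∀ {u} (x : Vector Carrier n) (hs : Vector Poly n) i → (∀ j → j ≢ i → u P.∣ hs j) → x i ≈ 0# →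
                  u P.∣ P.sum (λ j → const (x j) *ₚ hs j)
  combination-∣ {u = u} x hs i h x≈0 = P.∣-sum (λ j → const (x j) *ₚ hs j) term
    where
    term : ∀ j → u P.∣ const (x j) *ₚ hs j
    term j with j Finₚ.≟ i
    ... | no  j≢i    = P.x∣ʳy⇒x∣ʳzy (const (x j)) (h j j≢i)
    ... | yes ≡.refl = P.∣ʳ-respʳ-≈ (symₚ (*ₚ-cong (transₚ (const-cong x≈0) 0∷[]≈[]) (reflₚ {hs j}))) (P.x∣0 u)

  combination-∣⁻ : ∀ {u} (x : Vector Carrier n) (hs : Vector Poly n) i → (∀ j → j ≢ i → u P.∣ hs j) →
                   u P.∣ P.sum (λ j → const (x j) *ₚ hs j) → u P.∣ const (x i) *ₚ hs i
  combination-∣⁻ x hs i h = P.∣-sum⁻ (λ j → const (x j) *ₚ hs j) i (λ j j≢i → P.x∣ʳy⇒x∣ʳzy (const (x j)) (h j j≢i))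

-- Factors of a squarefree polynomial over a perfect field.

module SquarefreeFactors (R : CommutativeRing a b) (isField : IsField R)
  {p} (prime : Prime p) (char : HasCharacteristic R p) (perfect : HasRoots R p) where
  open RingNotation R hiding (zero)
  open IsField isField
  open Polynomial R
  open CommutativeRingLemmas R
  open PolynomialLemmas R
  open FieldPolynomials R isField
  open PerfectField R isField prime char perfect
  private
    module R[X] = PolynomialNotation R
    module PS   = Solver P.commutativeSemiring

  module _ {r f l} (squarefree : P.Squarefree f) (l≉0 : l ≉ 0#)
    (gs : Vector Poly r) (f≈ : f ≈ₚ const l *ₚ P.product gs)
    (deg : Fin r → ℕ) (has-degree : ∀ i → R[X].HasDegree (gs i) (suc (deg i))) where

    factor∤1 : ∀ i → ¬ (gs i P.∣ P.1#)
    factor∤1 i h = 1≉0 (lead-below-∣ (proj₂ (has-degree i)) (nonzero-regular (proj₁ (has-degree i)))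
      (λ { (suc i) _ → refl }) h .at 0)

    factor-regular : ∀ i → P.Regular (gs i)
    factor-regular i = lead-regular {gs i} (proj₂ (has-degree i)) (nonzero-regular (proj₁ (has-degree i)))

    product∣f : P.product gs P.∣ f
    product∣f = const l P., symₚ f≈

    factor∣f : ∀ i → gs i P.∣ f
    factor∣f i = P.∣ʳ-trans (P.∣-product gs i) product∣f

    factors-comaximal : ∀ {i j} → i ≢ j → P.Comaximal (gs i) (gs j)
    factors-comaximal {i} {j} i≢j =
      squarefree⇒comaximal squarefree (gs i) (gs j) (P.∣ʳ-trans (P.∣²-product gs i≢j) product∣f)

    comaximal-lead : ∀ p → P.Comaximal p (const l)
    comaximal-lead p with inverse l l≉0
    ... | y , e = P.0# , const y , transₚ (symₚ (const-∼ y l)) (const-cong (trans (*-comm y l) e))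

    -- Cancellation gives `h = g′ l q`, where `q` is the product of the other factors. Both `l` and
    -- `q` are comaximal to `gs i`, so divisibility of `h` would pass to `g′`, whose smaller degree
    -- would make it zero.
    factor∤log-derivative : ∀ {h i} → h *ₚ gs i ≈ₚ f *ₚ derivative (gs i) → ¬ (gs i P.∣ h)
    factor∤log-derivative {h} {i} e g∣h = impossible
      (P.comaximal-cofactor gs i (λ j j≢i → factors-comaximal (j≢i ∘ ≡.sym)))
      where
      open SetoidReasoning P.setoid
      open PS using (solve; _:*_; _:=_)
      g′ = derivative (gs i)
      h≈ : ∀ q → P.product gs ≈ₚ gs i *ₚ q → h ≈ₚ g′ *ₚ const l *ₚ q
      h≈ q ∏≈ = P.regular-cancel {gs i} (factor-regular i) (begin
        gs i *ₚ h                           ≈⟨ *ₚ-comm (gs i) h ⟩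
        h *ₚ gs i                           ≈⟨ e ⟩
        f *ₚ g′                             ≈⟨ P.*-congʳ {g′} (transₚ f≈ (*ₚ-congˡ (const l) ∏≈)) ⟩
        const l *ₚ (gs i *ₚ q) *ₚ g′        ≈⟨ solve 4 (λ l g q g′ → l :* (g :* q) :* g′ := g :* (g′ :* l :* q)) reflₚ (const l) (gs i) q g′ ⟩
        gs i *ₚ (g′ *ₚ const l *ₚ q)        ∎)
      impossible : (∃ λ q → P.product gs ≈ₚ gs i *ₚ q × P.Comaximal (gs i) q) → ⊥
      impossible (q , ∏≈ , comax) = derivative-squarefree-≉0 squarefree (factor∣f i) (has-degree i)
        (lead-below-∣ {gs i} {g′} (proj₂ (has-degree i)) (nonzero-regular (proj₁ (has-degree i)))
          (below-derivative (gs i) (proj₂ (has-degree i)))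
          (P.comaximal-∣ {gs i} {const l} {g′} (comaximal-lead (gs i))
            (P.comaximal-∣ {gs i} {q} {g′ *ₚ const l} comax (P.∣ʳ-respʳ-≈ (h≈ q ∏≈) g∣h))))

    module _ {s} (ω : Fin s → Fin r → Fin 2)
      (f≈′ : f ≈ₚ const l *ₚ P.product (λ j → P.product (λ i → gs i P.^ toℕ (ω j i)))) where

      -- Were every exponent of `gs i` zero, `gs i` would be comaximal to each block and to the
      -- leading constant, hence to `f`, which it divides.
      in-some-block : ∀ i → ∃ λ j → ω j i ≡ suc zero
      in-some-block i with Finₚ.any? (λ j → ω j i Finₚ.≟ suc zero)
      ... | yes h = h
      ... | no ¬h = contradiction (P.comaximal-∣
          {gs i} {const l *ₚ P.product blocks} {P.1#}
          (P.comaximal-* (comaximal-lead (gs i)) (P.comaximal-product blocks (λ j → P.comaximal-product (λ k → gs k P.^ toℕ (ω j k)) (λ k → power j k))))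
          (P.∣ʳ-respʳ-≈ (transₚ f≈′ (symₚ (*ₚ-identityˡ _))) (factor∣f i)))
          (factor∤1 i)
        where
        blocks : Vector Poly s
        blocks j = P.product (λ i → gs i P.^ toℕ (ω j i))
        power : ∀ j k → P.Comaximal (gs i) (gs k P.^ toℕ (ω j k))
        power j k with i Finₚ.≟ k
        ... | no  i≢k    = P.comaximal-^ (toℕ (ω j k)) (factors-comaximal i≢k)
        ... | yes ≡.refl with ω j i in eq
        ...   | zero     = P.comaximal-1 (gs i) reflₚ
        ...   | suc zero = contradiction (j , eq) ¬h

      -- Two blocks containing `i` would put the square of `gs i` into `f`.
      in-unique-block : ∀ {i j k} → ω j i ≡ suc zero → ω k i ≡ suc zero → j ≡ k
      in-unique-block {i} {j} {k} e e′ with j Finₚ.≟ k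
      ... | yes j≡k = j≡k
      ... | no  j≢k = contradiction (squarefree (P.∣ʳ-trans
        (P.*-∣-product (λ j → P.product (λ i → gs i P.^ toℕ (ω j i))) j≢k (P.∣-product-^ gs (ω j) i e) (P.∣-product-^ gs (ω k) i e′))
        (const l P., symₚ f≈′))) (factor∤1 i)

-- Degree in the coefficient variable of a polynomial in two variables.

module CoefficientBounds (R : CommutativeRing a b) where
  open RingNotation R hiding (zero)
  open Polynomial R
  open CommutativeRingLemmas R
  open PolynomialLemmas R
  private
    module R[X]    = PolynomialNotation R
    module R[X][Y] = PolynomialNotation polynomialRing
    module YP      = Polynomial polynomialRing
    module YL      = PolynomialLemmas polynomialRing

  -- Here `R[X][Y]` stands for `𝔽_q[t][X]`: the inner variable is `t`, the outer one `X`, and this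
  -- is a bound on the degree in `t`.
  CoefficientsBelow : R[X][Y].Carrier → ℕ → Set b
  CoefficientsBelow p D = ∀ i → DegreeBelow (YP.coeff p i) D

  coefficientsBelow-≤ : ∀ p {D E} → D ≤ E → CoefficientsBelow p D → CoefficientsBelow p E
  coefficientsBelow-≤ p le h i = below-≤ {YP.coeff p i} le (h i)

  coefficientsBelow-cong : ∀ p q {D} → p R[X][Y].≈ q → CoefficientsBelow p D → CoefficientsBelow q D
  coefficientsBelow-cong p q e h i = below-cong {YP.coeff p i} (e .YP.at i) (h i)

  coefficientsBelow-+ : ∀ p q {D} → CoefficientsBelow p D → CoefficientsBelow q D → CoefficientsBelow (p YP.+ₚ q) D
  coefficientsBelow-+ p q hp hq i = below-cong {YP.coeff p i +ₚ YP.coeff q i} (symₚ (YP.coeff-+ p q i))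
    (below-+ (YP.coeff p i) (YP.coeff q i) (hp i) (hq i))

  coefficientsBelow-* : ∀ p q {D E} → CoefficientsBelow p (suc D) → CoefficientsBelow q E →
                        CoefficientsBelow (p YP.*ₚ q) (D ℕ.+ E)
  coefficientsBelow-* p q {D} {E} hp hq i = below-cong {YL.convolution (YP.coeff p) (YP.coeff q) i}
    (symₚ (YL.coeff-* p q i)) (convolved (YP.coeff p) (YP.coeff q) hp hq i)
    where
    convolved : ∀ x y → (∀ i → DegreeBelow (x i) (suc D)) → (∀ i → DegreeBelow (y i) E) →
                ∀ i → DegreeBelow (YL.convolution x y i) (D ℕ.+ E)
    convolved x y hx hy zero    = below-* (x 0) (y 0) (hx 0) (hy 0)
    convolved x y hx hy (suc i) = below-+ (x 0 *ₚ y (suc i)) (YL.convolution (x ∘ suc) y i)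
      (below-* (x 0) (y (suc i)) (hx 0) (hy (suc i))) (convolved (x ∘ suc) y (hx ∘ suc) hy i)

  coefficientsBelow-derivative : ∀ p {D} → CoefficientsBelow p D → CoefficientsBelow (YP.derivative p) D
  coefficientsBelow-derivative p {D} h i = below-cong {suc i R[X].· YP.coeff p (suc i)}
    (symₚ (YL.coeff-derivative p i)) (multiple (suc i))
    where
    multiple : ∀ n → DegreeBelow (n R[X].· YP.coeff p (suc i)) D
    multiple zero    j le = refl
    multiple (suc n)      = below-+ (YP.coeff p (suc i)) (n R[X].· YP.coeff p (suc i)) (h (suc i)) (multiple n)

module CoefficientDegree (R : CommutativeRing a b) (isField : IsField R) where
  open RingNotation R hiding (zero)
  open IsField isField
  open FieldPolynomials R isField using (zeroₚ?; nonzero-regularₚ)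
  open Polynomial R
  open CommutativeRingLemmas R
  open PolynomialLemmas R
  private
    module R[X][Y] = PolynomialNotation polynomialRing
    module YP      = Polynomial polynomialRing
    module YL      = PolynomialLemmas polynomialRing

  open CoefficientBounds R

  -- The coefficient of the `D`-th power of the inner variable, as a polynomial in the outer one. At
  -- the top degree it is multiplicative, and since polynomials over a field have no zero divisors,
  -- degrees in the inner variable add up.
  slice : ℕ → R[X][Y].Carrier → Poly
  slice D = map (λ x → coeff x D)

  coeff-slice : ∀ D p i → coeff (slice D p) i ≈ coeff (YP.coeff p i) D
  coeff-slice D []      i       = refl
  coeff-slice D (x ∷ p) zero    = refl
  coeff-slice D (x ∷ p) (suc i) = coeff-slice D p i

  slice-* : ∀ p q D E → CoefficientsBelow p (suc D) → CoefficientsBelow q (suc E) →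
            slice (D ℕ.+ E) (p YP.*ₚ q) ≈ₚ slice D p *ₚ slice E q
  slice-* p q D E hp hq .at i = begin
    coeff (slice (D ℕ.+ E) (p YP.*ₚ q)) i                            ≈⟨ coeff-slice (D ℕ.+ E) (p YP.*ₚ q) i ⟩
    coeff (YP.coeff (p YP.*ₚ q) i) (D ℕ.+ E)                         ≈⟨ YL.coeff-* p q i .at (D ℕ.+ E) ⟩
    coeff (YL.convolution (YP.coeff p) (YP.coeff q) i) (D ℕ.+ E)
      ≈⟨ sliced (YP.coeff p) (YP.coeff q) (coeff (slice D p)) (coeff (slice E q)) hp hq (coeff-slice D p) (coeff-slice E q) i ⟩
    convolution (coeff (slice D p)) (coeff (slice E q)) i            ≈⟨ coeff-* (slice D p) (slice E q) i ⟨
    coeff (slice D p *ₚ slice E q) i                                 ∎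
    where
    open SetoidReasoning setoid
    sliced : ∀ x y u w → (∀ i → DegreeBelow (x i) (suc D)) → (∀ i → DegreeBelow (y i) (suc E)) →
             (∀ i → u i ≈ coeff (x i) D) → (∀ i → w i ≈ coeff (y i) E) →
             ∀ i → coeff (YL.convolution x y i) (D ℕ.+ E) ≈ convolution u w i
    sliced x y u w hx hy hu hw zero    = trans (coeff-*-top (x 0) (y 0) D E (hx 0) (hy 0))
      (sym (*-cong (hu 0) (hw 0)))
    sliced x y u w hx hy hu hw (suc i) = trans
      (coeff-+ (x 0 *ₚ y (suc i)) (YL.convolution (x ∘ suc) y i) (D ℕ.+ E))
      (+-cong (trans (coeff-*-top (x 0) (y (suc i)) D E (hx 0) (hy (suc i))) (sym (*-cong (hu 0) (hw (suc i)))))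
              (sliced (x ∘ suc) y (u ∘ suc) w (hx ∘ suc) hy (hu ∘ suc) hw i))

  coefficientDegree : ∀ p → ¬ (p R[X][Y].≈ []) → ∃ λ D → CoefficientsBelow p (suc D) × ¬ (slice D p ≈ₚ [])
  coefficientDegree p p≉0 = descend (proj₁ (bound p)) (proj₂ (bound p))
    where
    bound : ∀ p → ∃ (CoefficientsBelow p)
    bound []      = 0 , λ i j le → refl
    bound (x ∷ p) = length x ℕ.+ proj₁ (bound p) , λ
      { zero    → below-≤ {x} (ℕₚ.m≤m+n _ _) (below-length x)
      ; (suc i) → below-≤ {YP.coeff p i} (ℕₚ.m≤n+m _ _) (proj₂ (bound p) i) }
    descend : ∀ D → CoefficientsBelow p D → ∃ λ D → CoefficientsBelow p (suc D) × ¬ (slice D p ≈ₚ [])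
    descend zero    h = contradiction (record { at = λ i → below-0⇒≈0 (h i) }) p≉0
    descend (suc D) h with zeroₚ? (slice D p)
    ... | no ¬e = D , h , ¬e
    ... | yes e = descend D (λ i → below-suc {YP.coeff p i} (h i) (trans (sym (coeff-slice D p i)) (e .at i)))

  coefficientDegree-factors : ∀ p q {D} →
    ¬ (p R[X][Y].≈ []) → ¬ (q R[X][Y].≈ []) → CoefficientsBelow (p YP.*ₚ q) (suc D) →
    ∃ λ E → ∃ λ E′ → CoefficientsBelow p (suc E) × CoefficientsBelow q (suc E′) × E ℕ.+ E′ ≤ D
  coefficientDegree-factors p q {D} p≉0 q≉0 h = bounded (coefficientDegree p p≉0) (coefficientDegree q q≉0)
    where
    bounded : (∃ λ D → CoefficientsBelow p (suc D) × ¬ (slice D p ≈ₚ [])) →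
              (∃ λ D → CoefficientsBelow q (suc D) × ¬ (slice D q ≈ₚ [])) →
              ∃ λ E → ∃ λ E′ → CoefficientsBelow p (suc E) × CoefficientsBelow q (suc E′) × E ℕ.+ E′ ≤ D
    bounded (E , hp , p≉) (E′ , hq , q≉) = E , E′ , hp , hq , ℕₚ.≮⇒≥ (λ D<E+E′ →
      q≉ (nonzero-regularₚ p≉ (slice E′ q) (transₚ (symₚ (slice-* p q E E′ hp hq))
        (record { at = λ i → trans (coeff-slice (E ℕ.+ E′) (p YP.*ₚ q) i) (h i (E ℕ.+ E′) D<E+E′) }))))

-- A linear relation from the pigeonhole principle.

record IsFinite (R : CommutativeRing a b) (q : ℕ) : Set (a ⊔ b) where
  open RingNotation R
  field
    1<q            : 1 ℕ.< q
    to             : Carrier → Fin q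
    from           : Fin q → Carrier
    to-injective   : ∀ {x y} → to x ≡ to y → x ≈ y
    from-injective : ∀ {x y} → from x ≈ from y → x ≡ y

-- A triple (x , y , z) with g x + p y + z = 0 exists by counting: there are more
-- triples within the degree bounds than possible values of g x + p y + z.
module Counting (R : CommutativeRing a b) {q} (isFinite : IsFinite R q) where
  open RingNotation R hiding (zero)
  open IsFinite isFinite
  open Polynomial R
  open CommutativeRingLemmas R
  open PolynomialLemmas R
  private
    module R[X]    = PolynomialNotation R
    module R[X][Y] = PolynomialNotation polynomialRing
    module YP      = Polynomial polynomialRing
    module YL      = PolynomialLemmas polynomialRing
    module YS      = Solver R[X][Y].commutativeSemiring

  funToFin-cong : ∀ {m n} {f g : Fin m → Fin n} → (∀ i → f i ≡ g i) → Fin.funToFin f ≡ Fin.funToFin g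
  funToFin-cong {zero}  h = ≡.refl
  funToFin-cong {suc m} h = ≡.cong₂ Fin.combine (h zero) (funToFin-cong (h ∘ suc))

  module _ (D E d σ : ℕ) (0<D : 0 ℕ.< D) (bound : (D ℕ.+ E) ℕ.* d ℕ.< σ) where
    open CoefficientBounds R
    rows = D ℕ.+ E

    module _ (u : Fin (q ℕ.^ (suc rows ℕ.* σ))) where
      -- The number `u` is read in base `q` as `1 + D + E` polynomials of degree below `σ`: row zero
      -- is `z`, the next `D` rows are the coefficients of `y`, the last `E` rows those of `x`.
      entry : Fin (suc rows) → Fin σ → Carrier
      entry i k = from (Fin.finToFun u (Fin.combine i k))

      row : Fin (suc rows) → Poly
      row i = List.tabulate (entry i)

      -- The lengths are crossed, `E` for `x` and `D` for `y`, so that `g x` and `p y` both have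
      -- degree below `D + E`.
      x-part y-part : List Poly
      x-part = List.tabulate (λ i → row (suc (D Fin.↑ʳ i)))
      y-part = List.tabulate (λ i → row (suc (i Fin.↑ˡ E)))

    below-row : ∀ u i → DegreeBelow (row u i) σ
    below-row u i = below-tabulate (entry u i)

    tabulate-below : ∀ {n} (t : Fin n → Poly) → (∀ i → DegreeBelow (t i) σ) →
                     ∀ i → DegreeBelow (YP.coeff (List.tabulate t) i) σ
    tabulate-below {zero}  t h i       j le = refl
    tabulate-below {suc n} t h zero         = h zero
    tabulate-below {suc n} t h (suc i)      = tabulate-below (t ∘ suc) (h ∘ suc) i

    part-injective : ∀ u u′ → x-part u R[X][Y].≈ x-part u′ → y-part u R[X][Y].≈ y-part u′ →
                     row u zero ≈ₚ row u′ zero → u ≡ u′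
    part-injective u u′ ex ey ez = ≡.trans (≡.sym (Finₚ.funToFin-finToFin {suc rows ℕ.* σ} u))
      (≡.trans (funToFin-cong digits) (Finₚ.funToFin-finToFin {suc rows ℕ.* σ} u′))
      where
      rows-agree : ∀ i → row u i ≈ₚ row u′ i
      rows-agree zero    = ez
      rows-agree (suc i) with Fin.splitAt D i in eq
      ... | inj₁ k = ≡.subst (λ i → row u (suc i) ≈ₚ row u′ (suc i)) (≡.trans (≡.cong (Fin.join D E) (≡.sym eq)) (Finₚ.join-splitAt D E i))
        (transₚ (symₚ (YL.coeff-tabulate (λ i → row u (suc (i Fin.↑ˡ E))) k))
          (transₚ (ey .YP.at (toℕ k)) (YL.coeff-tabulate (λ i → row u′ (suc (i Fin.↑ˡ E))) k)))
      ... | inj₂ k = ≡.subst (λ i → row u (suc i) ≈ₚ row u′ (suc i)) (≡.trans (≡.cong (Fin.join D E) (≡.sym eq)) (Finₚ.join-splitAt D E i))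
        (transₚ (symₚ (YL.coeff-tabulate (λ i → row u (suc (D Fin.↑ʳ i))) k))
          (transₚ (ex .YP.at (toℕ k)) (YL.coeff-tabulate (λ i → row u′ (suc (D Fin.↑ʳ i))) k)))
      digits : ∀ z → Fin.finToFun u z ≡ Fin.finToFun u′ z
      digits z = ≡.subst (λ z → Fin.finToFun {q} {suc rows ℕ.* σ} u z ≡ Fin.finToFun u′ z) (Finₚ.combine-remQuot {suc rows} σ z)
        (from-injective (trans (sym (coeff-tabulate (entry u i) k))
          (trans (rows-agree i .at (toℕ k)) (coeff-tabulate (entry u′ i) k))))
        where
        i = proj₁ (Fin.remQuot {suc rows} σ z)
        k = proj₂ (Fin.remQuot {suc rows} σ z)

    -- The bound on `y` keeps it from being a nonzero multiple of a monic polynomial of degree `D`;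
    -- the bound on `z` lets its class modulo `v ^ ℓ` determine it.
    record Syzygy (g p : R[X][Y].Carrier) : Set (a ⊔ b) where
      field
        x y        : R[X][Y].Carrier
        z          : R[X].Carrier
        relation   : g YP.*ₚ x YP.+ₚ p YP.*ₚ y YP.+ₚ YP.const z R[X][Y].≈ []
        below-y    : R[X][Y].DegreeBelow y D
        below-z    : DegreeBelow z σ
        nontrivial : x R[X][Y].≈ [] → y R[X][Y].≈ [] → z ≈ₚ [] → ⊥

    syzygy : ∀ g p → R[X][Y].DegreeBelow g (suc D) → R[X][Y].DegreeBelow p (suc E) →
             CoefficientsBelow g (suc d) → CoefficientsBelow p (suc d) → Syzygy g p
    syzygy g p hg hp cg cp = fromCollision (Finₚ.pigeonhole more-triples code)
      where
      value : Fin (q ℕ.^ (suc rows ℕ.* σ)) → R[X][Y].Carrier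
      value u = g YP.*ₚ x-part u YP.+ₚ p YP.*ₚ y-part u YP.+ₚ YP.const (row u zero)

      code : Fin (q ℕ.^ (suc rows ℕ.* σ)) → Fin (q ℕ.^ (rows ℕ.* (d ℕ.+ σ)))
      code u = Fin.funToFin (λ z → let i , k = Fin.remQuot {rows} (d ℕ.+ σ) z in
        to (coeff (YP.coeff (value u) (toℕ i)) (toℕ k)))

      -- The exponents count field elements: `(1 + D + E) σ` in a triple against `(D + E) (d + σ)`
      -- in a value. Their comparison is `bound` with `(D + E) σ` added to both sides.
      more-triples : q ℕ.^ (rows ℕ.* (d ℕ.+ σ)) ℕ.< q ℕ.^ (suc rows ℕ.* σ)
      more-triples = ℕₚ.^-monoʳ-< q 1<q (≡.subst (ℕ._< suc rows ℕ.* σ)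
        (≡.sym (ℕₚ.*-distribˡ-+ rows d σ)) (ℕₚ.+-monoˡ-< (rows ℕ.* σ) bound))

      value-below : ∀ u → R[X][Y].DegreeBelow (value u) rows
      value-below u = YL.below-+ (g YP.*ₚ x-part u YP.+ₚ p YP.*ₚ y-part u) (YP.const (row u zero))
        (YL.below-+ (g YP.*ₚ x-part u) (p YP.*ₚ y-part u)
          (YL.below-* g (x-part u) hg (YL.below-tabulate _))
          (YL.below-≤ {p YP.*ₚ y-part u} (ℕₚ.≤-reflexive (ℕₚ.+-comm E D))
            (YL.below-* p (y-part u) hp (YL.below-tabulate _))))
        -- The constant `z` fits because `D + E` is positive.
        (YL.below-≤ {YP.const (row u zero)} (ℕₚ.≤-trans 0<D (ℕₚ.m≤m+n D E)) (λ { (suc i) _ → R[X].refl }))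

      value-coefficients : ∀ u → CoefficientsBelow (value u) (d ℕ.+ σ)
      value-coefficients u = coefficientsBelow-+ (g YP.*ₚ x-part u YP.+ₚ p YP.*ₚ y-part u) (YP.const (row u zero))
        (coefficientsBelow-+ (g YP.*ₚ x-part u) (p YP.*ₚ y-part u)
          (coefficientsBelow-* g (x-part u) cg (tabulate-below (λ i → row u (suc (D Fin.↑ʳ i))) (λ i → below-row u (suc (D Fin.↑ʳ i)))))
          (coefficientsBelow-* p (y-part u) cp (tabulate-below (λ i → row u (suc (i Fin.↑ˡ E))) (λ i → below-row u (suc (i Fin.↑ˡ E))))))
        (λ { zero → below-≤ {row u zero} (ℕₚ.m≤n+m σ d) (below-row u zero) ; (suc i) j le → refl })

      code-injective : ∀ {u u′} → code u ≡ code u′ → value u R[X][Y].≈ value u′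
      code-injective {u} {u′} e .YP.at i .at k with i ℕₚ.<? rows | k ℕₚ.<? d ℕ.+ σ
      ... | no  i≥ | _      = trans (value-below u i (ℕₚ.≮⇒≥ i≥) .at k) (sym (value-below u′ i (ℕₚ.≮⇒≥ i≥) .at k))
      ... | yes _  | no k≥  = trans (value-coefficients u i k (ℕₚ.≮⇒≥ k≥)) (sym (value-coefficients u′ i k (ℕₚ.≮⇒≥ k≥)))
      ... | yes i< | yes k< = ≡.subst₂ (λ i k → coeff (YP.coeff (value u) i) k ≈ coeff (YP.coeff (value u′) i) k)
          (Finₚ.toℕ-fromℕ< i<) (Finₚ.toℕ-fromℕ< k<)
          (≡.subst (λ (i , k) → coeff (YP.coeff (value u) (toℕ i)) (toℕ k) ≈ coeff (YP.coeff (value u′) (toℕ i)) (toℕ k))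
            (Finₚ.remQuot-combine i′ k′)
            (to-injective (≡.trans (≡.sym (Finₚ.finToFun-funToFin _ z))
              (≡.trans (≡.cong (λ c → Fin.finToFun {q} {rows ℕ.* (d ℕ.+ σ)} c z) e) (Finₚ.finToFun-funToFin _ z)))))
        where
        i′ = Fin.fromℕ< i<
        k′ = Fin.fromℕ< k<
        z  = Fin.combine i′ k′

      fromCollision : (∃ λ u → ∃ λ u′ → u Fin.< u′ × code u ≡ code u′) → Syzygy g p
      fromCollision (u , u′ , u<u′ , e) = record
        { x          = x-part u YP.+ₚ YP.-ₚ x-part u′
        ; y          = y-part u YP.+ₚ YP.-ₚ y-part u′
        ; z          = row u zero +ₚ (-ₚ row u′ zero)
        ; relation   = difference g p (code-injective e)
        ; below-y    = YL.below-+ (y-part u) (YP.-ₚ y-part u′) (YL.below-tabulate _)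
                         (YL.below-neg (y-part u′) (YL.below-tabulate _))
        ; below-z    = below-+ (row u zero) (-ₚ row u′ zero) (below-row u zero) (below-neg (row u′ zero) (below-row u′ zero))
        ; nontrivial = λ ex ey ez → Finₚ.<⇒≢ u<u′ (part-injective u u′
            (YL.P.x∙y⁻¹≈ε⇒x≈y _ _ ex) (YL.P.x∙y⁻¹≈ε⇒x≈y _ _ ey) (P.x∙y⁻¹≈ε⇒x≈y _ _ ez))
        }
        where
        difference : ∀ g p {x x′ y y′ z z′} →
          g YP.*ₚ x YP.+ₚ p YP.*ₚ y YP.+ₚ YP.const z R[X][Y].≈ g YP.*ₚ x′ YP.+ₚ p YP.*ₚ y′ YP.+ₚ YP.const z′ →
          g YP.*ₚ (x YP.+ₚ YP.-ₚ x′) YP.+ₚ p YP.*ₚ (y YP.+ₚ YP.-ₚ y′) YP.+ₚ YP.const (z +ₚ (-ₚ z′)) R[X][Y].≈ []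
        difference g p {x} {x′} {y} {y′} {z} {z′} e = begin
          g YP.*ₚ (x YP.+ₚ YP.-ₚ x′) YP.+ₚ p YP.*ₚ (y YP.+ₚ YP.-ₚ y′) YP.+ₚ (YP.const z YP.+ₚ YP.const (-ₚ z′))
            -- The solver works in semirings, so the negatives are passed to it as independent
            -- variables.
            ≈⟨ YS.solve 8 (λ g p x x′ y y′ z z′ →
                 g :* (x :+ x′) :+ p :* (y :+ y′) :+ (z :+ z′) := (g :* x :+ p :* y :+ z) :+ (g :* x′ :+ p :* y′ :+ z′))
                 R[X][Y].refl g p x (YP.-ₚ x′) y (YP.-ₚ y′) (YP.const z) (YP.const (-ₚ z′)) ⟩
          (g YP.*ₚ x YP.+ₚ p YP.*ₚ y YP.+ₚ YP.const z) YP.+ₚ (g YP.*ₚ (YP.-ₚ x′) YP.+ₚ p YP.*ₚ (YP.-ₚ y′) YP.+ₚ YP.const (-ₚ z′))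
            ≈⟨ R[X][Y].+-congʳ e ⟩
          (g YP.*ₚ x′ YP.+ₚ p YP.*ₚ y′ YP.+ₚ YP.const z′) YP.+ₚ (g YP.*ₚ (YP.-ₚ x′) YP.+ₚ p YP.*ₚ (YP.-ₚ y′) YP.+ₚ YP.const (-ₚ z′))
            ≈⟨ YS.solve 8 (λ g p x x′ y y′ z z′ →
                 g :* (x :+ x′) :+ p :* (y :+ y′) :+ (z :+ z′) := (g :* x :+ p :* y :+ z) :+ (g :* x′ :+ p :* y′ :+ z′))
                 R[X][Y].refl g p x′ (YP.-ₚ x′) y′ (YP.-ₚ y′) (YP.const z′) (YP.const (-ₚ z′)) ⟨
          g YP.*ₚ (x′ YP.+ₚ YP.-ₚ x′) YP.+ₚ p YP.*ₚ (y′ YP.+ₚ YP.-ₚ y′) YP.+ₚ (YP.const z′ YP.+ₚ YP.const (-ₚ z′))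
            ≈⟨ R[X][Y].+-cong (R[X][Y].+-cong
                 (YP.transₚ (YP.*ₚ-congˡ g (YP.-ₚ-inverseʳ x′)) (YP.*ₚ-zeroʳ g))
                 (YP.transₚ (YP.*ₚ-congˡ p (YP.-ₚ-inverseʳ y′)) (YP.*ₚ-zeroʳ p)))
                 (YP.transₚ (YP.∷-cong (-ₚ-inverseʳ z′) YP.reflₚ) YP.0∷[]≈[]) ⟩
          [] ∎
          where
          open SetoidReasoning R[X][Y].setoid
          open YS using (_:+_; _:*_; _:=_)

-- The residue field of an irreducible polynomial, and its valuation.

module ResidueField (R : CommutativeRing a b) (isField : IsField R)
  (v : Polynomial.Poly R) (irreducible : RingNotation.Irreducible (Polynomial.polynomialRing R) v)
  {D} (has-degree : PolynomialNotation.HasDegree R v D) where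
  open RingNotation R hiding (zero)
  open IsField isField
  open Polynomial R
  open CommutativeRingLemmas R
  open PolynomialLemmas R
  open Division R
  open FieldPolynomials R isField
  open Quotient polynomialRing v using (quotientRing; _≡ᵥ_; fromEq; transᵥ; symᵥ; +-congᵥ)
  open QuotientLemmas polynomialRing v
  private
    module Q = RingNotation quotientRing
    v-below   = proj₂ has-degree
    v-regular = nonzero-regular (proj₁ has-degree)

  remainder : Poly → Poly
  remainder x = x +ₚ proj₁ (divide v v-below (inverse _ (proj₁ has-degree)) x) *ₚ v

  remainder-below : ∀ x → DegreeBelow (remainder x) D
  remainder-below x = proj₂ (divide v v-below (inverse _ (proj₁ has-degree)) x)

  remainder-≡ : ∀ x → remainder x ≡ᵥ x
  remainder-≡ x = transᵥ (+-congᵥ (fromEq (reflₚ {x})) (∣⇒≡0 (P.x∣ʳyx v s))) (fromEq (+ₚ-identityʳ x))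
    where s = proj₁ (divide v v-below (inverse _ (proj₁ has-degree)) x)

  residue-zero? : ∀ x → Dec (x ≡ᵥ [])
  residue-zero? x with zeroₚ? (remainder x)
  ... | yes e = yes (transᵥ (symᵥ (remainder-≡ x)) (fromEq e))
  ... | no ¬e = no λ x≡0 → ¬e (lead-below-∣ {v} {remainder x} v-below v-regular (remainder-below x)
                  (≡0⇒∣ (transᵥ (remainder-≡ x) x≡0)))

  residue-inverse : ∀ x → ¬ (x ≡ᵥ []) → ∃ λ y → x *ₚ y ≡ᵥ P.1#
  residue-inverse x x≢0 = invert (irreducible⇒comaximal {v} {x} irreducible (λ h → x≢0 (∣⇒≡0 h)))
    where
    invert : P.Comaximal x v → ∃ λ y → x *ₚ y ≡ᵥ P.1#
    invert (u , w , e) = u , transᵥ (fromEq (*ₚ-comm x u))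
      (transᵥ (symᵥ (transᵥ (+-congᵥ (fromEq (reflₚ {u *ₚ x})) (∣⇒≡0 (P.x∣ʳyx v w)))
        (fromEq (+ₚ-identityʳ (u *ₚ x))))) (fromEq e))

  residue-1≉0 : ¬ (P.1# ≡ᵥ [])
  residue-1≉0 e = P.Irreducible.p∤1 irreducible (≡0⇒∣ e)

  residue-isField : IsField quotientRing
  residue-isField = record { 1≉0 = residue-1≉0 ; zero? = residue-zero? ; inverse = residue-inverse }

  open FieldPolynomials quotientRing residue-isField using () renaming (nonzero-regular to residue-regular)

  residue-reduced : ∀ n x → x Q.^ n ≡ᵥ [] → x ≡ᵥ []
  residue-reduced zero    x e = contradiction e residue-1≉0
  residue-reduced (suc n) x e with residue-zero? x
  ... | yes x≡0 = x≡0
  ... | no  x≢0 = residue-reduced n x (residue-regular x≢0 _ e)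

  residue-characteristic : ∀ {p} → HasCharacteristic R p → HasCharacteristic quotientRing p
  residue-characteristic {p} e = transᵥ (symᵥ (·-∼ p (fromEq (reflₚ {P.1#}))))
    (fromEq (transₚ (const-· p) (transₚ (const-cong e) 0∷[]≈[])))
    where open RingRelation quotient-relation

  residue-code : ∀ {q} → (Carrier → Fin q) → Poly → Fin (q ℕ.^ D)
  residue-code to x = Fin.funToFin (λ i → to (coeff (remainder x) (toℕ {D} i)))

  residue-code-injective : ∀ {q} {to : Carrier → Fin q} → (∀ {x y} → to x ≡ to y → x ≈ y) →
                           ∀ {x y} → residue-code to x ≡ residue-code to y → x ≡ᵥ y
  residue-code-injective {q} {to} injective {x} {y} e =
    transᵥ (symᵥ (remainder-≡ x)) (transᵥ (fromEq agree) (remainder-≡ y))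
    where
    agree : remainder x ≈ₚ remainder y
    agree .at i with i ℕₚ.<? D
    ... | no  i≥ = trans (remainder-below x i (ℕₚ.≮⇒≥ i≥)) (sym (remainder-below y i (ℕₚ.≮⇒≥ i≥)))
    ... | yes i< = ≡.subst (λ i → coeff (remainder x) i ≈ coeff (remainder y) i) (Finₚ.toℕ-fromℕ< i<)
      (injective (≡.trans (≡.sym (Finₚ.finToFun-funToFin (λ i → to (coeff (remainder x) (toℕ {D} i))) (Fin.fromℕ< i<)))
        (≡.trans (≡.cong (λ c → Fin.finToFun {q} {D} c (Fin.fromℕ< i<)) e)
          (Finₚ.finToFun-funToFin (λ i → to (coeff (remainder y) (toℕ {D} i))) (Fin.fromℕ< i<)))))

  degree-^ : ∀ n → PolynomialNotation.HasDegree R (v P.^ n) (n ℕ.* D)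
  degree-^ zero    = 1≉0 , λ { (suc i) _ → refl }
  degree-^ (suc n) =
    (λ e → proj₁ (degree-^ n) (v-regular _ (trans (sym (coeff-*-top v (v P.^ n) D (n ℕ.* D) v-below (proj₂ (degree-^ n)))) e))) ,
    below-≤ {v P.^ suc n} (ℕₚ.≤-reflexive (ℕₚ.+-suc D (n ℕ.* D))) (below-* v (v P.^ n) v-below (proj₂ (degree-^ n)))

  degree-positive : ∃ λ E → D ≡ suc E
  degree-positive = positive D ≡.refl
    where
    unit : ¬ ((∃ λ y → coeff v 0 * y ≈ 1#) × DegreeBelow v 1)
    unit ((y , e) , below) = P.Irreducible.p∤1 irreducible (const y P., record { at = λ
      { zero    → trans (coeff-const-* y v 0) (trans (*-comm y _) e)
      ; (suc i) → trans (coeff-const-* y v (suc i)) (trans (*-congˡ (below (suc i) (s≤s z≤n))) (zeroʳ y)) } })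

    positive : ∀ E → D ≡ E → ∃ λ E → D ≡ suc E
    positive (suc E) eq = E , eq
    positive zero    eq = contradiction (≡.subst (λ D → (∃ λ y → coeff v D * y ≈ 1#) × DegreeBelow v (suc D)) eq
      (inverse _ (proj₁ has-degree) , v-below)) unit

  -- Comaximality to `v` is inherited by its powers; thus an element prime to `v` is regular modulo
  -- every `v ^ n`.
  ^-comaximal-∣ : ∀ {x} → ¬ (v P.∣ x) → ∀ n {y} → v P.^ n P.∣ x *ₚ y → v P.^ n P.∣ y
  ^-comaximal-∣ {x} v∤x n {y} h = P.comaximal-∣ {v P.^ n} {x} {y}
    (P.comaximal-sym {x} {v P.^ n} (P.comaximal-^ n (irreducible⇒comaximal {v} {x} irreducible v∤x)))
    (P.∣ʳ-respʳ-≈ (*ₚ-comm x y) h)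

  -- Division by `v` is repeated while it succeeds. Each division lowers the degree because `v` has
  -- positive degree, so the length of `x` bounds the recursion.
  valuation : ∀ x → ¬ (x ≈ₚ []) → ∃ λ n → ∃ λ y → x ≈ₚ v P.^ n *ₚ y × ¬ (v P.∣ y)
  valuation x x≉0 = go (length x) x (below-length x) x≉0
    where
    go : ∀ L x → DegreeBelow x L → ¬ (x ≈ₚ []) → ∃ λ n → ∃ λ y → x ≈ₚ v P.^ n *ₚ y × ¬ (v P.∣ y)
    go zero    x below x≉0 = contradiction (below-0⇒≈0 below) x≉0
    go (suc L) x below x≉0 with residue-zero? x
    ... | no  x≢0 = 0 , x , symₚ (*ₚ-identityˡ x) , (λ h → x≢0 (∣⇒≡0 h))
    ... | yes x≡0 = extend (≡0⇒∣ x≡0)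
      where
      extend : v P.∣ x → ∃ λ n → ∃ λ y → x ≈ₚ v P.^ n *ₚ y × ¬ (v P.∣ y)
      extend (s P., e) with go L s (below-*⁻ v s D L v-below v-regular
          (below-cong {x} (transₚ (symₚ e) (*ₚ-comm s v)) (below-≤ {x} (shift L) below)))
          (λ s≈0 → x≉0 (transₚ (symₚ e) (*ₚ-cong s≈0 (reflₚ {v}))))
        where
        shift : ∀ L → suc L ≤ D ℕ.+ L
        shift L = ≡.subst (λ D → suc L ≤ D ℕ.+ L) (≡.sym (proj₂ degree-positive)) (s≤s (ℕₚ.m≤n+m L (proj₁ degree-positive)))
      ... | n , y , f , v∤y = suc n , y , (begin
        x                         ≈⟨ e ⟨
        s *ₚ v                    ≈⟨ *ₚ-comm s v ⟩
        v *ₚ s                    ≈⟨ *ₚ-congˡ v f ⟩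
        v *ₚ (v P.^ n *ₚ y)       ≈⟨ *ₚ-assoc v (v P.^ n) y ⟨
        v P.^ suc n *ₚ y          ∎) , v∤y
        where open SetoidReasoning P.setoid

-- Truncations of the completion, and fractions compared with it.

module CompletionLemmas (R : CommutativeRing a b) (v : CommutativeRing.Carrier R) where
  open RingNotation R hiding (zero)
  open CommutativeRingLemmas R
  open Completion R v
  private
    module S = Solver commutativeSemiring
    module Q (k : ℕ) = Quotient R (v ^ k)
    module Oᵥ = RingNotation completionRing

  truncation : ∀ ℓ → RingRelation completionRing (Q.quotientRing ℓ) (a ⊔ b)
  truncation ℓ = record
    { _∼_    = λ x y → Q._≡ᵥ_ ℓ (seq x ℓ) y
    ; respˡ  = λ e h → Q.transᵥ ℓ (Q.symᵥ ℓ (mod e ℓ)) h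
    ; respʳ  = λ e h → Q.transᵥ ℓ h e
    ; unique = λ h k → Q.transᵥ ℓ (Q.symᵥ ℓ h) k
    ; 0-∼    = Q.fromEq ℓ refl
    ; 1-∼    = Q.fromEq ℓ refl
    ; +-∼    = Q.+-congᵥ ℓ
    ; *-∼    = Q.*-congᵥ ℓ
    }

  module _ (ℓ : ℕ) (1≤ℓ : 1 ≤ ℓ) where
    private module V = Quotient R v

    ^-≡⇒≡ : ∀ {x y} → Q._≡ᵥ_ ℓ x y → x V.≡ᵥ y
    ^-≡⇒≡ e = V.mk≡ᵥ (∣ʳ-trans (v∣v^ 1≤ℓ) (Q.divides {ℓ} e))
      where
      v∣v^ : ∀ {ℓ} → 1 ≤ ℓ → v ∣ v ^ ℓ
      v∣v^ {suc ℓ} _ = ∣-*ʳ (v ^ ℓ) ∣ʳ-refl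

    residue-map : RingRelation (Q.quotientRing ℓ) V.quotientRing (a ⊔ b)
    residue-map = record
      { _∼_    = V._≡ᵥ_
      ; respˡ  = λ e h → V.transᵥ (V.symᵥ (^-≡⇒≡ e)) h
      ; respʳ  = λ e h → V.transᵥ h e
      ; unique = λ h k → V.transᵥ (V.symᵥ h) k
      ; 0-∼    = V.fromEq refl
      ; 1-∼    = V.fromEq refl
      ; +-∼    = V.+-congᵥ
      ; *-∼    = V.*-congᵥ
      }

  ι-^ : ∀ x n k → seq (ι x Oᵥ.^ n) k ≡ x ^ n
  ι-^ x zero    k = ≡.refl
  ι-^ x (suc n) k = ≡.cong (x *_) (ι-^ x n k)

  residue-≡ : ∀ ℓ x y → ι v Oᵥ.^ ℓ Oᵥ.∣ ι y Oᵥ.- x → Q._≡ᵥ_ ℓ (seq x ℓ) y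
  residue-≡ ℓ x y h = divided h
    where
    divided : ι v Oᵥ.^ ℓ Oᵥ.∣ ι y Oᵥ.- x → Q._≡ᵥ_ ℓ (seq x ℓ) y
    divided (z CommutativeRingLemmas., e) = Q.symᵥ ℓ (Q.mk≡ᵥ {ℓ}
      (≡0⇒∣ (Q.transᵥ ℓ (Q.symᵥ ℓ (mod e ℓ)) (∣⇒≡0 (seq z ℓ , *-congˡ (reflexive (≡.sym (ι-^ v ℓ ℓ))))))))
      where open QuotientLemmas R (v ^ ℓ)

  coherent-+ : ∀ x n k → Q._≡ᵥ_ n (seq x (k ℕ.+ n)) (seq x n)
  coherent-+ x n zero    = Q.fromEq n refl
  coherent-+ x n (suc k) = Q.transᵥ n
    (Q.mk≡ᵥ {n} (∣ʳ-trans (v^n∣v^ n k) (Q.divides {k ℕ.+ n} (coherent x (k ℕ.+ n))))) (coherent-+ x n k)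
    where
    v^n∣v^ : ∀ n k → v ^ n ∣ v ^ (k ℕ.+ n)
    v^n∣v^ n zero    = ∣ʳ-refl
    v^n∣v^ n (suc k) = x∣ʳy⇒x∣ʳzy v (v^n∣v^ n k)

  ^-regular : Regular v → ∀ k → Regular (v ^ k)
  ^-regular reg zero    y e = trans (sym (*-identityˡ y)) e
  ^-regular reg (suc k) y e = ^-regular reg k y (reg _ (trans (sym (*-assoc _ _ _)) e))

  -- With `x = v ^ k y`, precision `k` is lost. The product is read modulo `v ^ (k + n)`, then
  -- `v ^ k` and `y` are cancelled, and coherence brings the term of `z` at `k + n` back to the one
  -- at `n`.
  ι-regular : Regular v → ∀ {x y} k → x ≈ v ^ k * y → (∀ n {z} → v ^ n ∣ y * z → v ^ n ∣ z) →
              CommutativeRingLemmas.Regular completionRing (ι x)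
  ι-regular reg {x} {y} k x≈ y-regular z e .mod n = Q.transᵥ n (Q.symᵥ n (coherent-+ z n k))
    (QuotientLemmas.∣⇒≡0 R (v ^ n) (y-regular n (cancelled (QuotientLemmas.≡0⇒∣ R (v ^ (k ℕ.+ n)) (e .mod (k ℕ.+ n))))))
    where
    open SetoidReasoning setoid
    zₖ = seq z (k ℕ.+ n)
    cancelled : v ^ (k ℕ.+ n) ∣ x * zₖ → v ^ n ∣ y * zₖ
    cancelled (q , f) = q , regular-cancel (^-regular reg k) (begin
      v ^ k * (q * v ^ n)     ≈⟨ S.solve 3 (λ a q b → a S.:* (q S.:* b) S.:= q S.:* (a S.:* b)) refl (v ^ k) q (v ^ n) ⟩
      q * (v ^ k * v ^ n)     ≈⟨ *-congˡ (SemiringExp.^-homo-* semiring v k n) ⟨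
      q * v ^ (k ℕ.+ n)       ≈⟨ f ⟩
      x * zₖ                  ≈⟨ *-congʳ x≈ ⟩
      v ^ k * y * zₖ          ≈⟨ *-assoc _ _ _ ⟩
      v ^ k * (y * zₖ)        ∎)

record IsRegularEmbedding (R : CommutativeRing a b) (S : CommutativeRing c d)
  (ι : CommutativeRing.Carrier R → CommutativeRing.Carrier S) : Set (a ⊔ b ⊔ c ⊔ d) where
  private
    module R = RingNotation R
    module S = RingNotation S
  field
    ι-cong    : ∀ {x y} → x R.≈ y → ι x S.≈ ι y
    ι-0       : ι R.0# S.≈ S.0#
    ι-1       : ι R.1# S.≈ S.1#
    ι-+       : ∀ x y → ι (x R.+ y) S.≈ ι x S.+ ι y
    ι-*       : ∀ x y → ι (x R.* y) S.≈ ι x S.* ι y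
    ι-regular : ∀ {x} → x R.≉ R.0# → CommutativeRingLemmas.Regular S (ι x)

module FractionRelation (R : CommutativeRing a b)
  (1≉0 : CommutativeRing._≉_ R (CommutativeRing.1# R) (CommutativeRing.0# R))
  (cancel : AlmostLeftCancellative (CommutativeRing._≈_ R) (CommutativeRing.0# R)
              (CommutativeRing._*_ R))
  (S : CommutativeRing c d)
  (ι : CommutativeRing.Carrier R → CommutativeRing.Carrier S)
  (isRegularEmbedding : IsRegularEmbedding R S ι) where
  private
    module R = RingNotation R
    module S = RingNotation S
  open CommutativeRingLemmas S
  open IsRegularEmbedding isRegularEmbedding
  open Fractions R 1≉0 cancel using (num; den; den≉0; fractionField; cross; κ)
  open SetoidReasoning S.setoid
  private module SS = Solver S.commutativeSemiring
  open SS using (solve; _:+_; _:*_; _:=_)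

  -- Cross-multiplication expresses `x = y` without a fraction ring of `S`. Regularity of the
  -- embedded denominators makes the relation single-valued and independent of the chosen fraction.
  fraction-relation : RingRelation fractionField S d
  fraction-relation = record
    { _∼_    = λ x y → ι (num x) S.≈ y S.* ι (den x)
    ; respˡ  = λ {x} {x′} {y} e h → regular-cancel (ι-regular (den≉0 x)) (begin
        ι (den x) S.* ι (num x′)              ≈⟨ ι-* (den x) (num x′) ⟨
        ι (den x R.* num x′)                  ≈⟨ ι-cong (R.trans (R.*-comm _ _) (R.sym (cross e))) ⟩
        ι (num x R.* den x′)                  ≈⟨ ι-* (num x) (den x′) ⟩
        ι (num x) S.* ι (den x′)              ≈⟨ S.*-congʳ h ⟩
        y S.* ι (den x) S.* ι (den x′)        ≈⟨ solve 3 (λ y d e → y :* d :* e := d :* (y :* e)) S.refl y (ι (den x)) (ι (den x′)) ⟩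
        ι (den x) S.* (y S.* ι (den x′))      ∎)
    ; respʳ  = λ e h → S.trans h (S.*-congʳ e)
    ; unique = λ {x} h k → regular-cancel (ι-regular (den≉0 x))
        (S.trans (S.*-comm _ _) (S.trans (S.sym h) (S.trans k (S.*-comm _ _))))
    ; 0-∼    = S.trans ι-0 (S.sym (S.zeroˡ _))
    ; 1-∼    = S.sym (S.*-identityˡ _)
    ; +-∼    = λ {x} {x′} {y} {y′} h k → begin
        ι (num x R.* den x′ R.+ num x′ R.* den x)
          ≈⟨ S.trans (ι-+ _ _) (S.+-cong (ι-* _ _) (ι-* _ _)) ⟩
        ι (num x) S.* ι (den x′) S.+ ι (num x′) S.* ι (den x)
          ≈⟨ S.+-cong (S.*-congʳ h) (S.*-congʳ k) ⟩
        y S.* ι (den x) S.* ι (den x′) S.+ y′ S.* ι (den x′) S.* ι (den x)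
          ≈⟨ solve 4 (λ y y′ d e → y :* d :* e :+ y′ :* e :* d := (y :+ y′) :* (d :* e)) S.refl y y′ (ι (den x)) (ι (den x′)) ⟩
        (y S.+ y′) S.* (ι (den x) S.* ι (den x′))
          ≈⟨ S.*-congˡ (ι-* _ _) ⟨
        (y S.+ y′) S.* ι (den x R.* den x′) ∎
    ; *-∼    = λ {x} {x′} {y} {y′} h k → begin
        ι (num x R.* num x′)                             ≈⟨ ι-* _ _ ⟩
        ι (num x) S.* ι (num x′)                         ≈⟨ S.*-cong h k ⟩
        (y S.* ι (den x)) S.* (y′ S.* ι (den x′))
          ≈⟨ solve 4 (λ y y′ d e → (y :* d) :* (y′ :* e) := (y :* y′) :* (d :* e)) S.refl y y′ (ι (den x)) (ι (den x′)) ⟩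
        (y S.* y′) S.* (ι (den x) S.* ι (den x′))        ≈⟨ S.*-congˡ (ι-* _ _) ⟨
        (y S.* y′) S.* ι (den x R.* den x′)              ∎
    }

  κ-∼-ι : ∀ x → RingRelation._∼_ fraction-relation (κ x) (ι x)
  κ-∼-ι x = S.sym (S.trans (S.*-congˡ ι-1) (S.*-identityʳ (ι x)))

-- The prime field and coordinates with respect to a basis.

module PrimeField {a b} {p w : ℕ} (Fq : FiniteField a b p w) where
  open Global Fq using (module 𝔽; module 𝔽ₚ; 𝔽ₚ⇒𝔽; Basis)
  open 𝔽 hiding (zero)
  open CommutativeRingLemmas (FiniteField.commutativeRing Fq)
  open RingProperties ring using (-‿+-comm)
  open SemiringMult semiring using (×-homo-+)
  open SetoidReasoning setoid
  private
    module S = Solver commutativeSemiring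
    φ = 𝔽ₚ⇒𝔽

  𝔽ₚ⇒𝔽-⊖ : ∀ m n → φ (m ℤ.⊖ n) ≈ m · 1# - n · 1#
  𝔽ₚ⇒𝔽-⊖ m       zero    = sym (trans (+-congˡ -0≈0) (+-identityʳ _))
  𝔽ₚ⇒𝔽-⊖ zero    (suc n) = sym (+-identityˡ _)
  𝔽ₚ⇒𝔽-⊖ (suc m) (suc n) = begin
    φ (suc m ℤ.⊖ suc n)                       ≡⟨ ≡.cong φ (ℤₚ.[1+m]⊖[1+n]≡m⊖n m n) ⟩
    φ (m ℤ.⊖ n)                               ≈⟨ 𝔽ₚ⇒𝔽-⊖ m n ⟩
    m · 1# - n · 1#                           ≈⟨ +-identityʳ _ ⟨
    (m · 1# - n · 1#) + 0#                    ≈⟨ +-congˡ (-‿inverseʳ 1#) ⟨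
    (m · 1# - n · 1#) + (1# - 1#)             ≈⟨ S.solve 4 (λ m n o o′ → (m S.:+ n) S.:+ (o S.:+ o′) S.:= (o S.:+ m) S.:+ (o′ S.:+ n)) refl _ _ 1# (- 1#) ⟩
    (1# + m · 1#) + (- 1# - n · 1#)           ≈⟨ +-congˡ (-‿+-comm 1# (n · 1#)) ⟩
    (1# + m · 1#) - (1# + n · 1#)             ∎

  𝔽ₚ⇒𝔽-+ : ∀ x y → φ (x ℤ.+ y) ≈ φ x + φ y
  𝔽ₚ⇒𝔽-+ (ℤ.+ m)      (ℤ.+ n)      = ×-homo-+ 1# m n
  𝔽ₚ⇒𝔽-+ (ℤ.+ m)      (ℤ.-[1+ n ]) = 𝔽ₚ⇒𝔽-⊖ m (suc n)
  𝔽ₚ⇒𝔽-+ (ℤ.-[1+ m ]) (ℤ.+ n)      = trans (𝔽ₚ⇒𝔽-⊖ n (suc m)) (+-comm _ _)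
  𝔽ₚ⇒𝔽-+ (ℤ.-[1+ m ]) (ℤ.-[1+ n ]) = sym (trans (-‿+-comm _ _) (-‿cong (begin
    suc m · 1# + suc n · 1#     ≈⟨ ×-homo-+ 1# (suc m) (suc n) ⟨
    (suc m ℕ.+ suc n) · 1#      ≡⟨ ≡.cong (_· 1#) (≡.cong suc (ℕₚ.+-suc m n)) ⟩
    suc (suc (m ℕ.+ n)) · 1#    ∎)))

  𝔽ₚ⇒𝔽-neg : ∀ x → φ (ℤ.- x) ≈ - φ x
  𝔽ₚ⇒𝔽-neg (ℤ.+ zero)    = sym -0≈0
  𝔽ₚ⇒𝔽-neg (ℤ.+ suc n)   = refl
  𝔽ₚ⇒𝔽-neg (ℤ.-[1+ n ])  = sym (⁻¹-involutive _)

  𝔽ₚ⇒𝔽-* : ∀ x y → φ (x ℤ.* y) ≈ φ x * φ y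
  𝔽ₚ⇒𝔽-* (ℤ.+ m)      y = natural m
    where
    natural : ∀ m → φ (ℤ.+ m ℤ.* y) ≈ m · 1# * φ y
    natural zero    = trans (reflexive (≡.cong φ (ℤₚ.*-zeroˡ y))) (sym (zeroˡ _))
    natural (suc m) = begin
      φ (ℤ.+ suc m ℤ.* y)              ≡⟨ ≡.cong φ (ℤₚ.suc-* (ℤ.+ m) y) ⟩
      φ (y ℤ.+ ℤ.+ m ℤ.* y)            ≈⟨ 𝔽ₚ⇒𝔽-+ y (ℤ.+ m ℤ.* y) ⟩
      φ y + φ (ℤ.+ m ℤ.* y)            ≈⟨ +-cong (sym (*-identityˡ _)) (natural m) ⟩
      1# * φ y + m · 1# * φ y          ≈⟨ distribʳ _ _ _ ⟨
      (1# + m · 1#) * φ y              ∎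
  𝔽ₚ⇒𝔽-* (ℤ.-[1+ m ]) y = begin
    φ (ℤ.-[1+ m ] ℤ.* y)               ≡⟨ ≡.cong φ (ℤₚ.neg-distribˡ-* (ℤ.+ suc m) y) ⟨
    φ (ℤ.- (ℤ.+ suc m ℤ.* y))          ≈⟨ 𝔽ₚ⇒𝔽-neg (ℤ.+ suc m ℤ.* y) ⟩
    - φ (ℤ.+ suc m ℤ.* y)              ≈⟨ -‿cong (𝔽ₚ⇒𝔽-* (ℤ.+ suc m) y) ⟩
    - (suc m · 1# * φ y)               ≈⟨ -‿distribˡ-* _ _ ⟩
    - (suc m · 1#) * φ y               ∎

  𝔽ₚ⇒𝔽-cong : ∀ {x y} → x 𝔽ₚ.≈ y → φ x ≈ φ y
  𝔽ₚ⇒𝔽-cong {x} {y} e = x∙y⁻¹≈ε⇒x≈y _ _ (multiple (Quotient.divides e))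
    where
    multiple : RingNotation._∣_ ℤₚ.+-*-commutativeRing (ℤ.+ p) (x ℤ.+ ℤ.- y) → φ x - φ y ≈ 0#
    multiple (q CommutativeRingLemmas., f) = begin
      φ x - φ y                ≈⟨ +-congˡ (𝔽ₚ⇒𝔽-neg y) ⟨
      φ x + φ (ℤ.- y)          ≈⟨ 𝔽ₚ⇒𝔽-+ x (ℤ.- y) ⟨
      φ (x ℤ.+ ℤ.- y)          ≡⟨ ≡.cong φ f ⟨
      φ (q ℤ.* ℤ.+ p)          ≈⟨ 𝔽ₚ⇒𝔽-* q (ℤ.+ p) ⟩
      φ q * (p · 1#)           ≈⟨ *-congˡ (FiniteField.characteristic Fq) ⟩
      φ q * 0#                 ≈⟨ zeroʳ _ ⟩
      0#                       ∎

  𝔽ₚ⇒𝔽-sum : ∀ {n} (t : Vector ℤ.ℤ n) → φ (𝔽ₚ.sum t) ≈ sum (φ ∘ t)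
  𝔽ₚ⇒𝔽-sum {zero}  t = refl
  𝔽ₚ⇒𝔽-sum {suc n} t = trans (𝔽ₚ⇒𝔽-+ (t zero) _) (+-congˡ (𝔽ₚ⇒𝔽-sum (t ∘ suc)))

  module _ (B : Basis) where
    open Basis B

    -- Applied to the constant family `x`, `independent` makes every coordinate vanish. There is at
    -- least one coordinate, since an empty basis would give `1# ≈ 0#`.
    𝔽ₚ⇒𝔽-injective : ∀ x → φ x ≈ 0# → x 𝔽ₚ.≈ 𝔽ₚ.0#
    𝔽ₚ⇒𝔽-injective x e = first w {ψ 1#} γ (spanning 1#) (independent (λ _ → x) (sum-zero (λ l → φ x * γ l) (λ l → trans (*-congʳ e) (zeroˡ (γ l)))))
      where
      first : ∀ w {c : Vector ℤ.ℤ w} (γ : Fin w → Carrier) → 1# ≈ sum (λ l → φ (c l) * γ l) → (Fin w → x 𝔽ₚ.≈ 𝔽ₚ.0#) → x 𝔽ₚ.≈ 𝔽ₚ.0#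
      first zero    γ f h = contradiction f (FiniteField.1≉0 Fq)
      first (suc w) γ f h = h zero

    -- Each `x j` is expanded in the basis and the sums are exchanged, so the coordinate sums of an
    -- expanded matrix row appear as coefficients of `γ`. This identity, with `independent`,
    -- supplies what linearity of `ψ` would give.
    combination : ∀ {r} (x : Vector Carrier r) (e : Vector ℤ.ℤ r) →
      sum (λ j → φ (e j) * x j) ≈ sum (λ l → φ (𝔽ₚ.sum (λ j → ψ (x j) l ℤ.* e j)) * γ l)
    combination x e = begin
      sum (λ j → φ (e j) * x j)
        ≈⟨ sum-cong-≋ (λ j → *-congˡ (spanning (x j))) ⟩
      sum (λ j → φ (e j) * sum (λ l → φ (ψ (x j) l) * γ l))
        ≈⟨ sum-cong-≋ (λ j → *-distribˡ-sum (φ (e j)) (λ l → φ (ψ (x j) l) * γ l)) ⟩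
      sum (λ j → sum (λ l → φ (e j) * (φ (ψ (x j) l) * γ l)))
        ≈⟨ ∑-comm (λ j l → φ (e j) * (φ (ψ (x j) l) * γ l)) ⟩
      sum (λ l → sum (λ j → φ (e j) * (φ (ψ (x j) l) * γ l)))
        ≈⟨ sum-cong-≋ (λ l → begin
             sum (λ j → φ (e j) * (φ (ψ (x j) l) * γ l))
               ≈⟨ sum-cong-≋ (λ j → trans (S.solve 3 (λ e y g → e S.:* (y S.:* g) S.:= (y S.:* e) S.:* g) refl (φ (e j)) (φ (ψ (x j) l)) (γ l))
                    (*-congʳ (sym (𝔽ₚ⇒𝔽-* (ψ (x j) l) (e j))))) ⟩
             sum (λ j → φ (ψ (x j) l ℤ.* e j) * γ l)
               ≈⟨ *-distribʳ-sum (γ l) (λ j → φ (ψ (x j) l ℤ.* e j)) ⟨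
             sum (λ j → φ (ψ (x j) l ℤ.* e j)) * γ l
               ≈⟨ *-congʳ (𝔽ₚ⇒𝔽-sum (λ j → ψ (x j) l ℤ.* e j)) ⟨
             φ (𝔽ₚ.sum (λ j → ψ (x j) l ℤ.* e j)) * γ l ∎) ⟩
      sum (λ l → φ (𝔽ₚ.sum (λ j → ψ (x j) l ℤ.* e j)) * γ l) ∎

    coordinates≈0⇒combination≈0 : ∀ {r} (x : Vector Carrier r) (e : Vector ℤ.ℤ r) →
      (∀ l → 𝔽ₚ.sum (λ j → ψ (x j) l ℤ.* e j) 𝔽ₚ.≈ 𝔽ₚ.0#) → sum (λ j → φ (e j) * x j) ≈ 0#
    coordinates≈0⇒combination≈0 x e h = trans (combination x e)
      (sum-zero (λ l → φ (𝔽ₚ.sum (λ j → ψ (x j) l ℤ.* e j)) * γ l)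
        (λ l → trans (*-congʳ (𝔽ₚ⇒𝔽-cong (h l))) (zeroˡ (γ l))))

    combination≈0⇒coordinates≈0 : ∀ {r} (x : Vector Carrier r) (e : Vector ℤ.ℤ r) →
      sum (λ j → φ (e j) * x j) ≈ 0# → ∀ l → 𝔽ₚ.sum (λ j → ψ (x j) l ℤ.* e j) 𝔽ₚ.≈ 𝔽ₚ.0#
    combination≈0⇒coordinates≈0 x e h = independent (λ l → 𝔽ₚ.sum (λ j → ψ (x j) l ℤ.* e j)) (trans (sym (combination x e)) h)

    kernel-expand : ∀ {h r} (M : 𝔽.Matrix h r) (e : Vector ℤ.ℤ r) →
      𝔽ₚ.Kernel (Global.expand Fq B M) e → ∀ k → sum (λ j → φ (e j) * M k j) ≈ 0#
    kernel-expand M e ker k = coordinates≈0⇒combination≈0 (M k) e (λ l →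
      ≡.subst (λ (k , l) → 𝔽ₚ.sum (λ j → ψ (M k j) l ℤ.* e j) 𝔽ₚ.≈ 𝔽ₚ.0#) (Finₚ.remQuot-combine k l)
        (ker (Fin.combine k l)))

    expand-kernel : ∀ {h r} (M : 𝔽.Matrix h r) (e : Vector ℤ.ℤ r) →
      (∀ k → sum (λ j → φ (e j) * M k j) ≈ 0#) → 𝔽ₚ.Kernel (Global.expand Fq B M) e
    expand-kernel {h} M e zeros row = combination≈0⇒coordinates≈0 (M k) e (zeros k) (proj₂ (Fin.remQuot {h} w row))
      where k = proj₁ (Fin.remQuot {h} w row)

-- Primitive global factors of `f`, and common factors from the linear relation.

module GlobalFactors (F : CommutativeRing a b) (F-field : IsField F) {q} (F-finite : IsFinite F q)
  (K : CommutativeRing c d) (K-fractions : IsFractionField (Polynomial.polynomialRing F) K) where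
  open IsFractionField K-fractions
  private
    module 𝒪    = PolynomialNotation F
    module 𝒪[X] = PolynomialNotation 𝒪.polynomialRing
    module K    = RingNotation K
    module K[X] = PolynomialNotation K
    module OP = Polynomial 𝒪.polynomialRing
    module OL = PolynomialLemmas 𝒪.polynomialRing
    module FL = PolynomialLemmas F
    module KP = Polynomial K
    module KL = PolynomialLemmas K
    module KF = FieldPolynomials K isField
  open FieldPolynomials F F-field

  𝒪-isBezoutDomain : IsBezoutDomain 𝒪.polynomialRing
  𝒪-isBezoutDomain = record
    { zero? = zeroₚ? ; nonzero-regular = λ {x} → nonzero-regularₚ {x} ; bezout = bezout }

  open GaussLemma 𝒪.polynomialRing K 𝒪-isBezoutDomain K-fractions
  private module T = RingRelation polynomialRelation
  open CoefficientBounds F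
  open CoefficientDegree F F-field
  open Counting F F-finite

  toK[X] : 𝒪[X].Carrier → K[X].Carrier
  toK[X] = map κ

  toK-∼ : ∀ q → q ∼ₚ toK[X] q
  toK-∼ = map-∼ (λ x → K.refl)

  toK-≈0 : ∀ {q} → toK[X] q K[X].≈ [] → q 𝒪[X].≈ []
  toK-≈0 {q} e = ∼-injective (toK-∼ q) (T.respʳ (K[X].sym e) []-∼)

  -- `bounded′` concerns `H G′`, the future value of `Λ` at the vector of the block. `lead∣` makes
  -- the leading coefficient of `G` prime to `v`, so that `G` may be cancelled modulo `v ^ ℓ`.
  record BlockFactor (f : 𝒪[X].Carrier) (n deg : ℕ) (g : K[X].Carrier) : Set (a ⊔ b ⊔ c ⊔ d) where
    field
      D           : ℕ
      monic       : KP.coeff g D K.≈ K.1#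
      below-g     : K[X].DegreeBelow g (suc D)
      0<D         : 0 ℕ.< D
      D≤n         : D ≤ n
      associated  : PrimitiveAssociate g D
    open PrimitiveAssociate associated public renaming (poly to G)
    field
      H           : 𝒪[X].Carrier
      factors     : H 𝒪[X].* G 𝒪[X].≈ f
      lead∣       : OP.coeff G D 𝒪.∣ OP.coeff f n
      bounded     : CoefficientsBelow G (suc deg)
      bounded′    : CoefficientsBelow (H 𝒪[X].* OP.derivative G) (suc deg)

    toK-G≈ : toK[X] G K[X].≈ KP.const (κ (OP.coeff G D)) K[X].* g
    toK-G≈ = T.unique (toK-∼ G) associate

  blockFactor : ∀ {f n d g} → 𝒪[X].HasDegree f n → CoefficientsBelow f (suc d) →
                K[X].Monic g → K[X].Irreducible g → g K[X].∣ toK[X] f → BlockFactor f n d g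
  blockFactor {f} {n} {d} {g} (f-lead , f-below) f-bounded (D , monic , below-g) irreducible g∣f =
    fromQuotient (primitiveAssociate g D monic below-g)
    where
    D-positive : ∀ D → KP.coeff g D K.≈ K.1# → K[X].DegreeBelow g (suc D) → 0 ℕ.< D
    D-positive (suc D) m h = s≤s z≤n
    D-positive zero    m h = contradiction (K[X].1# KL.P., KP.transₚ (KP.*ₚ-identityˡ g) g≈1)
      (K[X].Irreducible.p∤1 irreducible)
      where
      g≈1 : g K[X].≈ K[X].1#
      g≈1 .KP.at zero    = m
      g≈1 .KP.at (suc i) = h (suc i) (s≤s z≤n)

    fromQuotient : PrimitiveAssociate g D → BlockFactor f n d g
    fromQuotient A = build (associate-∣ A (toK-∼ f) g∣f)
      where
      open PrimitiveAssociate A renaming (poly to G)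
      f≉0 : ¬ (f 𝒪[X].≈ [])
      f≉0 e = f-lead (e .OP.at n)
      build : G 𝒪[X].∣ f → BlockFactor f n d g
      -- Both `t`-degree bounds come from splitting the degree of `f` between `H` and `G`;
      -- differentiation in `X` does not raise the degree in `t`.
      build (H OL.P., HG≈f) = degrees (coefficientDegree-factors H G H≉0 G≉0
          (coefficientsBelow-cong f (H 𝒪[X].* G) (𝒪[X].sym HG≈f) f-bounded))
        (degree-of-H H H≉0)
        where
        H≉0 : ¬ (H 𝒪[X].≈ [])
        H≉0 e = f≉0 (𝒪[X].trans (𝒪[X].sym HG≈f) (𝒪[X].*-congʳ {G} e))
        G≉0 : ¬ (G 𝒪[X].≈ [])
        G≉0 e = lead≉0 (e .OP.at D)
        degree-of-H : ∀ p → ¬ (p 𝒪[X].≈ []) → ∃ (𝒪[X].HasDegree p)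
        degree-of-H p p≉0 = descend (List.length p) (OL.below-length p)
          where
          descend : ∀ L → 𝒪[X].DegreeBelow p L → ∃ (𝒪[X].HasDegree p)
          descend zero    h = contradiction (OL.below-0⇒≈0 h) p≉0
          descend (suc L) h with zeroₚ? (OP.coeff p L)
          ... | yes e = descend L (OL.below-suc {p} h e)
          ... | no ¬e = L , ¬e , h
        degrees : (∃ λ E → ∃ λ E′ → CoefficientsBelow H (suc E) × CoefficientsBelow G (suc E′) × E ℕ.+ E′ ≤ d) →
                  ∃ (𝒪[X].HasDegree H) → BlockFactor f n d g
        degrees (E , E′ , H-bounded , G-bounded , E+E′≤d) (M , H-lead , H-below) = record
          { D          = D
          ; monic      = monic
          ; below-g    = below-g
          ; 0<D        = D-positive D monic below-g
          ; D≤n        = ≡.subst (D ≤_) (≡.sym n≡) (ℕₚ.m≤n+m D M)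
          ; associated = A
          ; H          = H
          ; factors    = HG≈f
          ; lead∣      = OP.coeff H M FL.P., 𝒪.trans (𝒪.sym top) (𝒪.reflexive (≡.cong (OP.coeff f) (≡.sym n≡)))
          ; bounded    = coefficientsBelow-≤ G (s≤s (ℕₚ.≤-trans (ℕₚ.m≤n+m E′ E) E+E′≤d)) G-bounded
          ; bounded′   = coefficientsBelow-≤ (H 𝒪[X].* OP.derivative G) (≡.subst (_≤ suc d) (≡.sym (ℕₚ.+-suc E E′)) (s≤s E+E′≤d))
              (coefficientsBelow-* H (OP.derivative G) H-bounded (coefficientsBelow-derivative G G-bounded))
          }
          where
          top : OP.coeff f (M ℕ.+ D) 𝒪.≈ OP.coeff H M 𝒪.* OP.coeff G D
          top = 𝒪.trans (𝒪.sym (HG≈f .OP.at (M ℕ.+ D))) (OL.coeff-*-top H G M D H-below below)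
          top≉0 : OP.coeff f (M ℕ.+ D) 𝒪.≉ 𝒪.0#
          top≉0 e = nonzero-* H-lead lead≉0 (𝒪.trans (𝒪.sym top) e)
          n≡ : n ≡ M ℕ.+ D
          n≡ = ℕₚ.≤-antisym
            (ℕₚ.≮⇒≥ λ M+D<n → f-lead (OL.below-cong {H 𝒪[X].* G} HG≈f
              (OL.below-* H G {M} {suc D} H-below below) n (≡.subst (_≤ n) (≡.sym (ℕₚ.+-suc M D)) M+D<n)))
            (ℕₚ.≮⇒≥ λ n<M+D → top≉0 (f-below (M ℕ.+ D) n<M+D))

  -- Counting yields G x + q y + z = 0; once z = 0, the irreducible g divides q y and,
  -- since deg y < deg g, it divides q.
  commonFactor : ∀ {f n d g} → K[X].Irreducible g → (F : BlockFactor f n d g) →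
    let open BlockFactor F in
    ∀ q E σ → 𝒪[X].DegreeBelow q (suc E) → CoefficientsBelow q (suc d) → (D ℕ.+ E) ℕ.* d ℕ.< σ →
    (∀ x y z → 𝒪.DegreeBelow z σ → G 𝒪[X].* x 𝒪[X].+ q 𝒪[X].* y 𝒪[X].+ OP.const z 𝒪[X].≈ [] → z 𝒪.≈ []) →
    G 𝒪[X].∣ q
  commonFactor {d = d} {g} irreducible F q E σ q-below q-bounded bound constants =
    fromSyzygy (syzygy D E d σ 0<D bound G q below q-below bounded q-bounded)
    where
    open BlockFactor F
    fromSyzygy : Syzygy D E d σ 0<D bound G q → G 𝒪[X].∣ q
    fromSyzygy s = associate-∣ associated (toK-∼ q) (KL.P.comaximal-∣ {g} {toK[X] y} {toK[X] q}
        (KL.P.comaximal-sym {toK[X] y} {g} (KF.irreducible⇒comaximal {g} {toK[X] y} irreducible g∤y)) g∣qy)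
      where
      open Syzygy s
      z≈0 : z 𝒪.≈ []
      z≈0 = constants x y z below-z relation
      Gx+qy≈0 : G 𝒪[X].* x 𝒪[X].+ q 𝒪[X].* y 𝒪[X].≈ []
      Gx+qy≈0 = begin
        G 𝒪[X].* x 𝒪[X].+ q 𝒪[X].* y                       ≈⟨ 𝒪[X].+-identityʳ (G 𝒪[X].* x 𝒪[X].+ q 𝒪[X].* y) ⟨
        G 𝒪[X].* x 𝒪[X].+ q 𝒪[X].* y 𝒪[X].+ []            ≈⟨ 𝒪[X].+-congˡ {G 𝒪[X].* x 𝒪[X].+ q 𝒪[X].* y} (𝒪[X].trans (OL.const-cong z≈0) OP.0∷[]≈[]) ⟨
        G 𝒪[X].* x 𝒪[X].+ q 𝒪[X].* y 𝒪[X].+ OP.const z    ≈⟨ relation ⟩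
        []                                                    ∎
        where open SetoidReasoning 𝒪[X].setoid
      y≉0 : ¬ (y 𝒪[X].≈ [])
      y≉0 y≈0 = nontrivial (OL.lead-regular {G} below (nonzero-regularₚ lead≉0) x (begin
          G 𝒪[X].* x                        ≈⟨ 𝒪[X].+-identityʳ (G 𝒪[X].* x) ⟨
          G 𝒪[X].* x 𝒪[X].+ []             ≈⟨ 𝒪[X].+-congˡ {G 𝒪[X].* x} (𝒪[X].trans (𝒪[X].*-congˡ {q} y≈0) (OP.*ₚ-zeroʳ q)) ⟨
          G 𝒪[X].* x 𝒪[X].+ q 𝒪[X].* y    ≈⟨ Gx+qy≈0 ⟩
          []                                 ∎)) y≈0 z≈0
        where open SetoidReasoning 𝒪[X].setoid
      g∤y : ¬ (g K[X].∣ toK[X] y)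
      g∤y h = y≉0 (toK-≈0 (KL.lead-below-∣ {g} {toK[X] y} below-g (CommutativeRingLemmas.regular-1 K monic) (below-∼ (toK-∼ y) below-y) h))
      g∣qy : g K[X].∣ toK[X] q K[X].* toK[X] y
      g∣qy = KL.P.∣ʳ-respʳ-≈ eq (KL.P.∣-neg (KL.P.∣-*ʳ (toK[X] x) (KL.P.x∣ʳyx g (KP.const (κ (OP.coeff G D))))))
        where
        eq : K[X].- (KP.const (κ (OP.coeff G D)) K[X].* g K[X].* toK[X] x) K[X].≈ toK[X] q K[X].* toK[X] y
        eq = K[X].sym (KL.P.inverseʳ-unique _ _ (T.transfer
          (T.+-∼ (T.*-∼ associate (toK-∼ x)) (T.*-∼ (toK-∼ q) (toK-∼ y))) []-∼ Gx+qy≈0))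

-- Vanishing of high coefficients, and the block structure to be proved.

module HighCoefficients (R : CommutativeRing a b)
  {n r} (α : Fin n → Fin r → Polynomial.Poly R) (D σ : ℕ) where
  open RingNotation R hiding (zero)
  open Polynomial R using (coeff)
  open CommutativeRingLemmas R

  -- Membership in `L′` before coordinates are taken, with `D` equal to `deg_t f + 1`. The vector
  -- may have entries in all of `𝔽_q`; the prime field returns only in the final comparison of
  -- spans.
  Vanishing : Vector Carrier r → Set b
  Vanishing e = ∀ i τ → D ≤ τ → τ ℕ.< σ → sum (λ j → e j * coeff (α i j) τ) ≈ 0#

  vanishing-combination : ∀ {s} (x : Vector Carrier s) (u : Fin s → Vector Carrier r) →
    (∀ j → Vanishing (u j)) → ∀ {e} → (∀ i → e i ≈ sum (λ j → x j * u j i)) → Vanishing e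
  vanishing-combination x u vanishing {e} e≈ i τ D≤τ τ<σ = begin
    sum (λ j → e j * y j)                              ≈⟨ sum-cong-≋ (λ j → *-congʳ (e≈ j)) ⟩
    sum (λ j → sum (λ l → x l * u l j) * y j)          ≈⟨ sum-cong-≋ (λ j → *-distribʳ-sum (y j) (λ l → x l * u l j)) ⟩
    sum (λ j → sum (λ l → x l * u l j * y j))          ≈⟨ ∑-comm (λ j l → x l * u l j * y j) ⟩
    sum (λ l → sum (λ j → x l * u l j * y j))          ≈⟨ sum-zero _ (λ l → begin
      sum (λ j → x l * u l j * y j)      ≈⟨ sum-cong-≋ (λ j → *-assoc (x l) (u l j) (y j)) ⟩
      sum (λ j → x l * (u l j * y j))    ≈⟨ *-distribˡ-sum (x l) (λ j → u l j * y j) ⟨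
      x l * sum (λ j → u l j * y j)      ≈⟨ *-congˡ (vanishing l i τ D≤τ τ<σ) ⟩
      x l * 0#                            ≈⟨ zeroʳ (x l) ⟩
      0#                                  ∎) ⟩
    0#                                                 ∎
    where
    open SetoidReasoning setoid
    y : Fin r → Carrier
    y j = coeff (α i j) τ

-- Everything that the concluding linear algebra needs: the blocks partition the indices, their
-- indicator vectors are vanishing, and vanishing vectors are constant on each block.
record BlockStructure (R : CommutativeRing a b)
  {n r s} (α : Fin n → Fin r → Polynomial.Poly R) (ω : Fin s → Fin r → Fin 2) (D σ : ℕ) : Set (a ⊔ b) where
  open RingNotation R hiding (zero)
  open HighCoefficients R α D σ
  field
    in-some-block   : ∀ i → ∃ λ j → ω j i ≡ suc zero
    in-unique-block : ∀ {i j k} → ω j i ≡ suc zero → ω k i ≡ suc zero → j ≡ k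
    block-vanishing : ∀ j e → (∀ i → e i ≈ toℕ (ω j i) · 1#) → Vanishing e
    block-constant  : ∀ {i i′ j e} → ω j i ≡ suc zero → ω j i′ ≡ suc zero → Vanishing e → e i ≈ e i′

-- The argument modulo `v ^ ℓ` and modulo `v`.

module LocalGlobal (F : CommutativeRing a b) (F-field : IsField F) {q} (F-finite : IsFinite F q)
  {p} (prime : Prime p) (char : HasCharacteristic F p)
  (K : CommutativeRing c d) (K-fractions : IsFractionField (Polynomial.polynomialRing F) K)
  (v : Polynomial.Poly F) (v-irreducible : RingNotation.Irreducible (Polynomial.polynomialRing F) v)
  {N} (v-degree : PolynomialNotation.HasDegree F v N)
  (ℓ : ℕ) (1≤ℓ : 1 ≤ ℓ) where
  private
    module 𝔽    = RingNotation F
    module 𝒪    = PolynomialNotation F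
    module 𝒪[X] = PolynomialNotation 𝒪.polynomialRing
    module K[X] = PolynomialNotation K
    module GF   = GlobalFactors F F-field F-finite K K-fractions
  open GF using (BlockFactor; module BlockFactor; commonFactor)
  open CoefficientBounds F using (CoefficientsBelow)
  open FieldPolynomials F F-field using (nonzero-regular)
  open IsFinite F-finite
  open IsField F-field

  -- The local factors enter only through their classes modulo `v ^ ℓ`, so this ring stands in for
  -- the completion; facts that require a field are proved one level lower, in `k`.
  Q : CommutativeRing _ _
  Q = Quotient.quotientRing 𝒪.polynomialRing (v 𝒪.^ ℓ)
  k : CommutativeRing _ _
  k = Quotient.quotientRing 𝒪.polynomialRing v

  private
    module OP = Polynomial 𝒪.polynomialRing
    module OL = PolynomialLemmas 𝒪.polynomialRing
    module FP = Polynomial F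
    module FL = PolynomialLemmas F
    module RF = ResidueField F F-field v v-irreducible v-degree
    module CL = CompletionLemmas 𝒪.polynomialRing v
    module Q    = RingNotation Q
    module Q[X] = PolynomialNotation Q
    module k[X] = PolynomialNotation k
    module QP = Polynomial Q
    module QL = PolynomialLemmas Q
    module QD = LogarithmicDerivative Q
    module kL = PolynomialLemmas k
    module QO = QuotientLemmas 𝒪.polynomialRing (v 𝒪.^ ℓ)

  σ = ℓ ℕ.* N

  private
    module 𝒪⇒Q where
      open PolynomialRelation QO.quotient-relation public
      open RingRelation polynomialRelation public

      same : ∀ p → p ∼ₚ p
      same = QO.reduction

  private
    module Q⇒k where
      open PolynomialRelation (CL.residue-map ℓ 1≤ℓ) public
      open RingRelation polynomialRelation public

      same : ∀ p → p ∼ₚ p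
      same []      = []-∼
      same (x ∷ p) = ∷-∼ (Quotient.fromEq 𝒪.polynomialRing v 𝒪.refl) (same p)

  ∣-mod-v : ∀ {x y} → x Q[X].∣ y → x k[X].∣ y
  ∣-mod-v {x} {y} (s QL.P., e) = s kL.P., Q⇒k.transfer (Q⇒k.*-∼ (Q⇒k.same s) (Q⇒k.same x)) (Q⇒k.same y) e

  ∣-mod-v^ : ∀ {x y} → x 𝒪[X].∣ y → x Q[X].∣ y
  ∣-mod-v^ {x} {y} (s OL.P., e) = s QL.P., 𝒪⇒Q.transfer (𝒪⇒Q.*-∼ (𝒪⇒Q.same s) (𝒪⇒Q.same x)) (𝒪⇒Q.same y) e

  -- `v ^ ℓ` has degree exactly `σ`, so it divides no nonzero difference of degree below `σ`. This
  -- lifts congruences to identities in `𝔽_q[t]`.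
  residue-unique : ∀ {x y} → 𝒪.DegreeBelow x σ → 𝒪.DegreeBelow y σ → x Q.≈ y → x 𝒪.≈ y
  residue-unique {x} {y} hx hy e = FL.P.x∙y⁻¹≈ε⇒x≈y x y (FL.lead-below-∣ {v 𝒪.^ ℓ} {x FP.+ₚ (FP.-ₚ y)}
    (proj₂ (RF.degree-^ ℓ)) (nonzero-regular (proj₁ (RF.degree-^ ℓ)))
    (FL.below-+ x (FP.-ₚ y) hx (FL.below-neg y hy)) (Quotient.divides e))

  k-perfect : HasRoots k p
  k-perfect = Frobenius.finite⇒perfect k prime (RF.residue-characteristic {p} char) RF.residue-reduced
    (RF.residue-code to) (RF.residue-code-injective to-injective)

  private
    module SF = SquarefreeFactors k RF.residue-isField prime
      (RF.residue-characteristic {p} char) k-perfect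

  module Factored
    {f n d} (f-degree : 𝒪[X].HasDegree f n) (v∤lead : v 𝒪.∤ 𝒪[X].coeff f n)
    (squarefree : k[X].Squarefree f)
    {r} (gs : Vector Q[X].Carrier r) (δ : Fin r → ℕ)
    (monic : ∀ i → Q[X].coeff (gs i) (suc (δ i)) Q.≈ Q.1#)
    (below : ∀ i → Q[X].DegreeBelow (gs i) (suc (suc (δ i))))
    (f≈∏gs : f Q[X].≈ Q[X].const (𝒪[X].coeff f n) Q[X].* Q[X].product gs)
    (hs : Vector Q[X].Carrier r)
    (log-derivative : ∀ i → hs i Q[X].* gs i Q[X].≈ f Q[X].* Q[X].derivative (gs i))
    (α : Fin n → Fin r → 𝒪.Carrier)
    (α-below : ∀ i j → 𝒪.DegreeBelow (α i j) σ)
    (α-residue : ∀ i j → Q[X].coeff (hs j) (toℕ i) Q.≈ α i j)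
    (d<σ : d ℕ.< σ) where

    gs-regular : ∀ i → CommutativeRingLemmas.Regular (Polynomial.polynomialRing Q) (gs i)
    gs-regular i = QL.lead-regular {gs i} (below i) (CommutativeRingLemmas.regular-1 Q (monic i))

    -- Scalars of the field do not raise degrees in `t`, so a combination of the reduced
    -- coefficients `α` is again reduced: no further reduction modulo `v ^ ℓ` is taken.
    Λ : Vector 𝔽.Carrier r → 𝒪[X].Carrier
    Λ e = List.tabulate (λ i → 𝒪.sum (λ j → 𝒪.const (e j) 𝒪.* α i j))

    Λ-below : ∀ e → 𝒪[X].DegreeBelow (Λ e) n
    Λ-below e = OL.below-tabulate (λ i → 𝒪.sum (λ j → 𝒪.const (e j) 𝒪.* α i j))

    Λ-coefficient-below : ∀ e → CoefficientsBelow (Λ e) σ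
    Λ-coefficient-below e i with i ℕₚ.<? n
    ... | no  i≥ = FL.below-cong {[]} (FP.symₚ (Λ-below e i (ℕₚ.≮⇒≥ i≥))) (λ _ _ → 𝔽.refl)
    ... | yes i< = ≡.subst (λ i → 𝒪.DegreeBelow (OP.coeff (Λ e) i) σ) (Finₚ.toℕ-fromℕ< i<)
      (FL.below-cong {𝒪.sum (λ j → 𝒪.const (e j) 𝒪.* α i′ j)}
        (FP.symₚ (OL.coeff-tabulate (λ i → 𝒪.sum (λ j → 𝒪.const (e j) 𝒪.* α i j)) i′))
        (FL.below-sum (λ j → 𝒪.const (e j) 𝒪.* α i′ j) (λ j → FL.below-* (𝒪.const (e j)) (α i′ j) {0} (λ { (suc i) _ → 𝔽.refl }) (α-below i′ j))))
      where i′ = Fin.fromℕ< i<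

    Λ-coefficient : ∀ e i τ → 𝒪.coeff (OP.coeff (Λ e) (toℕ i)) τ 𝔽.≈ 𝔽.sum (λ j → e j 𝔽.* 𝒪.coeff (α i j) τ)
    Λ-coefficient e i τ = 𝔽.trans (OL.coeff-tabulate (λ i → 𝒪.sum (λ j → 𝒪.const (e j) 𝒪.* α i j)) i .FP.at τ)
      (𝔽.trans (FL.coeff-sum (λ j → 𝒪.const (e j) 𝒪.* α i j) τ)
        (CommutativeRingLemmas.sum-cong-≋ F (λ j → FL.coeff-const-* (e j) (α i j) τ)))

    open HighCoefficients F α (suc d) σ

    bounded⇒vanishing : ∀ {e} → CoefficientsBelow (Λ e) (suc d) → Vanishing e
    bounded⇒vanishing {e} h i τ le _ = 𝔽.trans (𝔽.sym (Λ-coefficient e i τ)) (h (toℕ i) τ le)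

    vanishing⇒bounded : ∀ {e} → Vanishing e → CoefficientsBelow (Λ e) (suc d)
    vanishing⇒bounded {e} h i τ le with i ℕₚ.<? n | τ ℕₚ.<? σ
    ... | no  i≥ | _      = Λ-below e i (ℕₚ.≮⇒≥ i≥) .FP.at τ
    ... | yes _  | no  τ≥ = Λ-coefficient-below e i τ (ℕₚ.≮⇒≥ τ≥)
    ... | yes i< | yes τ< = ≡.subst (λ i → 𝒪.coeff (OP.coeff (Λ e) i) τ 𝔽.≈ 𝔽.0#) (Finₚ.toℕ-fromℕ< i<)
      (𝔽.trans (Λ-coefficient e (Fin.fromℕ< i<) τ) (h (Fin.fromℕ< i<) τ le τ<))

    f-below : Q[X].DegreeBelow f (suc n)
    f-below = 𝒪⇒Q.below-∼ (𝒪⇒Q.same f) (proj₂ f-degree)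

    -- In `hs i * gs i = f * gs i′` the right side has degree below `n + deg (gs i)`, and `gs i` is
    -- monic. The `n` coefficients recorded by `α` are thus all of them.
    hs-below : ∀ i → Q[X].DegreeBelow (hs i) n
    hs-below i = QL.below-*⁻ (gs i) (hs i) (suc (δ i)) n (below i) (CommutativeRingLemmas.regular-1 Q (monic i))
      (QL.below-cong {f Q[X].* Q[X].derivative (gs i)} {gs i Q[X].* hs i}
        (Q[X].trans (Q[X].sym (log-derivative i)) (Q[X].*-comm (hs i) (gs i)))
        (QL.below-≤ {f Q[X].* Q[X].derivative (gs i)} (ℕₚ.≤-reflexive (ℕₚ.+-comm n (suc (δ i))))
          (QL.below-* f (Q[X].derivative (gs i)) {n} {suc (δ i)} f-below (QL.below-derivative (gs i) (below i)))))

    combination : Vector 𝔽.Carrier r → Q[X].Carrier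
    combination e = Q[X].sum (λ j → Q[X].const (𝒪.const (e j)) Q[X].* hs j)

    Λ≈combination : ∀ e → Λ e Q[X].≈ combination e
    Λ≈combination e .QP.at i with i ℕₚ.<? n
    ... | no  i≥ = Q.trans (𝒪⇒Q.below-∼ {Λ e} {Λ e} {n} (𝒪⇒Q.same (Λ e)) (Λ-below e) i (ℕₚ.≮⇒≥ i≥))
      (Q.sym (QL.below-sum (λ j → Q[X].const (𝒪.const (e j)) Q[X].* hs j) {n} (λ j →
        QL.below-* (Q[X].const (𝒪.const (e j))) (hs j) {0} {n} (λ { (suc i) _ → Q.refl }) (hs-below j)) i (ℕₚ.≮⇒≥ i≥)))
    ... | yes i< = ≡.subst (λ i → QP.coeff (Λ e) i Q.≈ QP.coeff (combination e) i) (Finₚ.toℕ-fromℕ< i<)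
      (Q.trans (Q.sym (𝒪⇒Q.at∼ (𝒪⇒Q.same (Λ e)) (toℕ i′)))
      (Q.trans (Quotient.fromEq 𝒪.polynomialRing (v 𝒪.^ ℓ) (OL.coeff-tabulate (λ i → 𝒪.sum (λ j → 𝒪.const (e j) 𝒪.* α i j)) i′))
      (Q.trans (RingRelation.sum-∼ QO.quotient-relation {u = λ j → 𝒪.const (e j) Q.* QP.coeff (hs j) (toℕ i′)}
                 (λ j → Q.*-congˡ {𝒪.const (e j)} {α i′ j} {QP.coeff (hs j) (toℕ i′)} (Q.sym (α-residue i′ j))))
      (Q.sym (Q.trans (QL.coeff-sum (λ j → Q[X].const (𝒪.const (e j)) Q[X].* hs j) (toℕ i′))
        (CommutativeRingLemmas.sum-cong-≋ Q (λ j → QL.coeff-const-* (𝒪.const (e j)) (hs j) (toℕ i′))))))))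
      where i′ = Fin.fromℕ< i<

    residue-nonzero : ∀ {x} → v 𝒪.∤ x → ¬ (Quotient._≡ᵥ_ 𝒪.polynomialRing v x [])
    residue-nonzero v∤x e = v∤x (QuotientLemmas.≡0⇒∣ 𝒪.polynomialRing v e)

    f≈∏gs-mod-v : f k[X].≈ k[X].const (𝒪[X].coeff f n) k[X].* k[X].product gs
    f≈∏gs-mod-v = Q⇒k.transfer (Q⇒k.same f)
      (Q⇒k.*-∼ (Q⇒k.const-∼ {𝒪[X].coeff f n} {𝒪[X].coeff f n} (Quotient.fromEq 𝒪.polynomialRing v 𝒪.refl)) (Q⇒k.product-∼ (λ i → Q⇒k.same (gs i)))) f≈∏gs

    gs-degree-mod-v : ∀ i → k[X].HasDegree (gs i) (suc (δ i))
    gs-degree-mod-v i =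
      (λ e → RF.residue-1≉0 (Quotient.transᵥ 𝒪.polynomialRing v
        (Quotient.symᵥ 𝒪.polynomialRing v (Quotient.transᵥ 𝒪.polynomialRing v
          (Quotient.symᵥ 𝒪.polynomialRing v (Q⇒k.at∼ (Q⇒k.same (gs i)) (suc (δ i)))) (CL.^-≡⇒≡ ℓ 1≤ℓ (monic i)))) e)) ,
      Q⇒k.below-∼ (Q⇒k.same (gs i)) (below i)

    factor∤hs : ∀ i → ¬ (gs i Q[X].∣ hs i)
    factor∤hs i h = SF.factor∤log-derivative squarefree (residue-nonzero {𝒪[X].coeff f n} v∤lead) gs f≈∏gs-mod-v δ gs-degree-mod-v {hs i} {i}
      (Q⇒k.transfer (Q⇒k.*-∼ (Q⇒k.same (hs i)) (Q⇒k.same (gs i)))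
        (Q⇒k.*-∼ (Q⇒k.same f) (Q⇒k.derivative-∼ (Q⇒k.same (gs i)))) (log-derivative i))
      (∣-mod-v h)

    factor∣hs : ∀ {i j} → i ≢ j → gs i Q[X].∣ hs j
    factor∣hs {i} {j} i≢j = QD.log-derivative-∣ {f = f} {c = Q[X].const (𝒪[X].coeff f n)} gs hs log-derivative f≈∏gs i≢j (gs-regular j)

    module Blocks
      (n>0 : 0 ℕ.< n)
      {s} (g : Fin s → K[X].Carrier) (irreducible : ∀ j → K[X].Irreducible (g j))
      (B : ∀ j → BlockFactor f n d (g j))
      (ω : Fin s → Fin r → Fin 2)
      (G≈ : ∀ j → BlockFactor.G (B j) Q[X].≈
        Q[X].const (OP.coeff (BlockFactor.G (B j)) (BlockFactor.D (B j))) Q[X].* Q[X].product (λ i → gs i Q[X].^ toℕ (ω j i)))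
      (f≈∏∏ : f Q[X].≈ Q[X].const (𝒪[X].coeff f n) Q[X].*
        Q[X].product (λ j → Q[X].product (λ i → gs i Q[X].^ toℕ (ω j i))))
      (bound : (2 ℕ.* n ℕ.∸ 1) ℕ.* d ℕ.< σ) where

      f≈∏∏-mod-v : f k[X].≈ k[X].const (𝒪[X].coeff f n) k[X].*
        k[X].product (λ j → k[X].product (λ i → gs i k[X].^ toℕ (ω j i)))
      f≈∏∏-mod-v = Q⇒k.transfer (Q⇒k.same f)
        (Q⇒k.*-∼ (Q⇒k.const-∼ {𝒪[X].coeff f n} {𝒪[X].coeff f n} (Quotient.fromEq 𝒪.polynomialRing v 𝒪.refl))
          (Q⇒k.product-∼ (λ j → Q⇒k.product-∼ (λ i → Q⇒k.^-∼ (toℕ (ω j i)) (Q⇒k.same (gs i)))))) f≈∏∏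

      in-some-block : ∀ i → ∃ λ j → ω j i ≡ suc zero
      in-some-block = SF.in-some-block squarefree (residue-nonzero {𝒪[X].coeff f n} v∤lead) gs f≈∏gs-mod-v δ gs-degree-mod-v ω f≈∏∏-mod-v

      in-unique-block : ∀ {i j k} → ω j i ≡ suc zero → ω k i ≡ suc zero → j ≡ k
      in-unique-block = SF.in-unique-block squarefree (residue-nonzero {𝒪[X].coeff f n} v∤lead) gs f≈∏gs-mod-v δ gs-degree-mod-v ω f≈∏∏-mod-v

      -- The leading coefficient of `G` divides that of `f`, hence is prime to `v` and regular
      -- modulo `v ^ ℓ`.
      G-regular : ∀ j → CommutativeRingLemmas.Regular (Polynomial.polynomialRing Q) (BlockFactor.G (B j))
      G-regular j = QL.lead-regular {G} {D} (𝒪⇒Q.below-∼ (𝒪⇒Q.same G) G-below)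
        (≡.subst (CommutativeRingLemmas.Regular Q) (QO.coeff-≡ G D)
          (λ y e → QO.∣⇒≡0 (RF.^-comaximal-∣ {OP.coeff G D} (λ h → v∤lead (FL.P.∣ʳ-trans h lead∣)) ℓ (QO.≡0⇒∣ e))))
        where open BlockFactor (B j) using (G; D; lead∣) renaming (below to G-below)

      -- The logarithmic derivative yields only a congruence between `Λ e` and `H G′` modulo
      -- `v ^ ℓ`. Both sides have degree below `σ` in `t`, so they are equal, and the bound on
      -- `H G′` carries over.
      block-bounded : ∀ j e → (∀ i → e i 𝔽.≈ toℕ (ω j i) 𝔽.· 𝔽.1#) → CoefficientsBelow (Λ e) (suc d)
      block-bounded j e e≈ i = FL.below-cong {OP.coeff HG′ i} {OP.coeff (Λ e) i} (FP.symₚ Λ≈HG′) (bounded′ i)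
        where
        open BlockFactor (B j) using (G; D; H; factors; bounded′)
        HG′ = H 𝒪[X].* OP.derivative G
        lead = OP.coeff G D
        Γ = Q[X].product (λ i → gs i Q[X].^ toℕ (ω j i))
        x≈ : ∀ i → 𝒪.const (e i) Q.≈ toℕ (ω j i) Q.· Q.1#
        x≈ i = Q.trans (Quotient.fromEq 𝒪.polynomialRing (v 𝒪.^ ℓ)
            (FP.transₚ (FL.const-cong (e≈ i)) (FP.symₚ (FL.const-· (toℕ (ω j i))))))
          (RingRelation.·-∼ QO.quotient-relation (toℕ (ω j i)) Q.refl)
        combination≈ : combination e Q[X].≈ H Q[X].* Q[X].derivative G
        combination≈ = QD.log-derivative-factor {f} {G} {H} {Γ} {lead} {combination e}
          (𝒪⇒Q.transfer (𝒪⇒Q.*-∼ (𝒪⇒Q.same H) (𝒪⇒Q.same G)) (𝒪⇒Q.same f) factors)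
          (G≈ j) (G-regular j)
          (QD.log-derivative-product f gs hs log-derivative (λ i → toℕ (ω j i)) (λ i → 𝒪.const (e i)) x≈)
        Λ≈HG′ : OP.coeff (Λ e) i 𝒪.≈ OP.coeff HG′ i
        Λ≈HG′ = residue-unique (Λ-coefficient-below e i) (FL.below-≤ {OP.coeff HG′ i} d<σ (bounded′ i))
          (Q.trans (𝒪⇒Q.at∼ (𝒪⇒Q.same (Λ e)) i)
          (Q.trans (Q[X].trans (Λ≈combination e) combination≈ .QP.at i)
          (Q.sym (𝒪⇒Q.at∼ (𝒪⇒Q.*-∼ (𝒪⇒Q.same H) (𝒪⇒Q.derivative-∼ (𝒪⇒Q.same G))) i))))

      gs∣G : ∀ {i j} → ω j i ≡ suc zero → gs i Q[X].∣ BlockFactor.G (B j)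
      gs∣G {i} {j} e = QL.P.∣ʳ-respʳ-≈ (Q[X].sym (G≈ j))
        (QL.P.x∣ʳy⇒x∣ʳzy (Q[X].const (OP.coeff (BlockFactor.G (B j)) (BlockFactor.D (B j)))) (QL.P.∣-product-^ gs (ω j) i e))

      gs∣Λ : ∀ {i e} → e i 𝔽.≈ 𝔽.0# → gs i Q[X].∣ Λ e
      gs∣Λ {i} {e} e≈0 = QL.P.∣ʳ-respʳ-≈ (Q[X].sym (Λ≈combination e))
        (QD.combination-∣ (λ j → 𝒪.const (e j)) hs i (λ j j≢i → factor∣hs (j≢i ∘ ≡.sym))
          (Quotient.fromEq 𝒪.polynomialRing (v 𝒪.^ ℓ) (FP.transₚ (FL.const-cong e≈0) FP.0∷[]≈[])))

      -- Modulo `gs i` only the `i`-th summand of `Λ e` is left. A nonzero scalar `e i` is a unit,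
      -- so `gs i` would divide `hs i`, which fails already modulo `v`.
      gs∣Λ⁻ : ∀ {i e} → gs i Q[X].∣ Λ e → e i 𝔽.≈ 𝔽.0#
      gs∣Λ⁻ {i} {e} h with zero? (e i)
      ... | yes e≈0 = e≈0
      ... | no  e≉0 = contradiction (QL.unit-const-∣ {𝒪.const (e i)} {𝒪.const (proj₁ (inverse (e i) e≉0))} {gs i} {hs i}
          (Quotient.fromEq 𝒪.polynomialRing (v 𝒪.^ ℓ) (FP.transₚ (FP.symₚ (FL.const-∼ (e i) (proj₁ (inverse (e i) e≉0)))) (FL.const-cong (proj₂ (inverse (e i) e≉0)))))
          (QD.combination-∣⁻ {u = gs i} (λ j → 𝒪.const (e j)) hs i (λ j j≢i → factor∣hs (j≢i ∘ ≡.sym))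
            (QL.P.∣ʳ-respʳ-≈ (Λ≈combination e) h)))
        (factor∤hs i)

      G∣Λ : ∀ {i j e} → ω j i ≡ suc zero → CoefficientsBelow (Λ e) (suc d) → e i 𝔽.≈ 𝔽.0# →
            BlockFactor.G (B j) 𝒪[X].∣ Λ e
      -- `Λ e` has degree below `n` in `X`, hence at most `pred n`.
      G∣Λ {i} {j} {e} i∈j bounded e≈0 = commonFactor (irreducible j) (B j) (Λ e) (ℕ.pred n) σ
        (≡.subst (𝒪[X].DegreeBelow (Λ e)) (≡.sym (ℕₚ.suc-pred n {{ℕ.>-nonZero n>0}})) (Λ-below e)) bounded
        (ℕₚ.≤-<-trans (ℕₚ.*-monoˡ-≤ d (degrees n n>0 (BlockFactor.D≤n (B j)))) bound)
        constants
        where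
        open BlockFactor (B j) using (G)
        -- The factor `2 n - 1` in the hypothesis on `σ` is the largest degree `n` of `G` plus the
        -- largest degree `n - 1` of `Λ e`.
        degrees : ∀ n → 0 ℕ.< n → ∀ {D} → D ≤ n → D ℕ.+ ℕ.pred n ≤ 2 ℕ.* n ℕ.∸ 1
        degrees (suc m) _ {D} le = ℕₚ.≤-trans (ℕₚ.+-monoˡ-≤ m le)
          (ℕₚ.≤-reflexive (≡.trans (ℕₚ.+-comm (suc m) m) (≡.cong (m ℕ.+_) (≡.sym (ℕₚ.+-identityʳ (suc m))))))
        constants : ∀ x y z → 𝒪.DegreeBelow z σ → G 𝒪[X].* x 𝒪[X].+ Λ e 𝒪[X].* y 𝒪[X].+ OP.const z 𝒪[X].≈ [] → z 𝒪.≈ []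
        constants x y z z-below relation = residue-unique {z} {[]} z-below (λ _ _ → 𝔽.refl)
          (QL.lead-below-∣ {gs i} {Q[X].const z} (below i) (CommutativeRingLemmas.regular-1 Q (monic i))
            (λ { (suc i) _ → Q.refl }) gs∣z .QP.at 0)
          where
          relation′ : (G Q[X].* x Q[X].+ Λ e Q[X].* y) Q[X].+ Q[X].const z Q[X].≈ []
          relation′ = 𝒪⇒Q.transfer (𝒪⇒Q.+-∼ (𝒪⇒Q.+-∼ (𝒪⇒Q.*-∼ (𝒪⇒Q.same G) (𝒪⇒Q.same x))
            (𝒪⇒Q.*-∼ (𝒪⇒Q.same (Λ e)) (𝒪⇒Q.same y))) (𝒪⇒Q.const-∼ Q.refl)) 𝒪⇒Q.[]-∼ relation
          gs∣z : gs i Q[X].∣ Q[X].const z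
          gs∣z = QL.P.∣ʳ-respʳ-≈ (Q[X].sym (QL.P.inverseʳ-unique (G Q[X].* x Q[X].+ Λ e Q[X].* y) (Q[X].const z) relation′))
            (QL.P.∣-neg (QL.P.∣-+ (QL.P.∣-*ʳ x (gs∣G i∈j)) (QL.P.∣-*ʳ y (gs∣Λ {i} {e} e≈0))))

      block-zero : ∀ {i i′ j e} → ω j i ≡ suc zero → ω j i′ ≡ suc zero →
                       CoefficientsBelow (Λ e) (suc d) → e i 𝔽.≈ 𝔽.0# → e i′ 𝔽.≈ 𝔽.0#
      block-zero {i} {i′} {j} {e} i∈j i′∈j bounded e≈0 = gs∣Λ⁻ {i′} {e}
        (QL.P.∣ʳ-trans (gs∣G i′∈j) (∣-mod-v^ (G∣Λ {i} {j} {e} i∈j bounded e≈0)))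

      block-vanishing : ∀ j e → (∀ i → e i 𝔽.≈ toℕ (ω j i) 𝔽.· 𝔽.1#) → Vanishing e
      block-vanishing j e e≈ = bounded⇒vanishing {e} (block-bounded j e e≈)

      block-constant : ∀ {i i′ j e} → ω j i ≡ suc zero → ω j i′ ≡ suc zero → Vanishing e → e i 𝔽.≈ e i′
      block-constant {i} {i′} {j} {e} i∈j i′∈j vanishing = FR.x∙y⁻¹≈ε⇒x≈y (e i) (e i′)
        (𝔽.trans (𝔽.sym (shifted-at i∈j)) (block-zero {i′} {i} {j} {shifted} i′∈j i∈j
          (vanishing⇒bounded {shifted} shifted-vanishing)
          (𝔽.trans (shifted-at i′∈j) (𝔽.-‿inverseʳ (e i′)))))
        where
        module FR = CommutativeRingLemmas F
        indicator shifted : Vector 𝔽.Carrier r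
        indicator k = toℕ (ω j k) 𝔽.· 𝔽.1#
        shifted k = e k 𝔽.+ (𝔽.- e i′) 𝔽.* indicator k
        shifted-at : ∀ {k} → ω j k ≡ suc zero → shifted k 𝔽.≈ e k 𝔽.- e i′
        shifted-at {k} k∈j = 𝔽.+-congˡ (𝔽.trans
          (𝔽.*-congˡ (𝔽.trans (𝔽.reflexive (≡.cong (λ w → toℕ w 𝔽.· 𝔽.1#) k∈j)) (𝔽.+-identityʳ 𝔽.1#))) (𝔽.*-identityʳ _))
        shifted-vanishing : Vanishing shifted
        shifted-vanishing = vanishing-combination {2}
          (λ { zero → 𝔽.1# ; (suc zero) → 𝔽.- e i′ }) (λ { zero → e ; (suc zero) → indicator })
          (λ { zero → vanishing ; (suc zero) → block-vanishing j indicator (λ k → 𝔽.refl) })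
          (λ k → 𝔽.+-cong (𝔽.sym (𝔽.*-identityˡ (e k))) (𝔽.sym (𝔽.+-identityʳ _)))

      blockStructure : BlockStructure F α ω (suc d) σ
      blockStructure = record
        { in-some-block   = in-some-block
        ; in-unique-block = in-unique-block
        ; block-vanishing = block-vanishing
        ; block-constant  = λ {i} {i′} {j} {e} → block-constant {i} {i′} {j} {e}
        }

-- From factorizations over `K` and over the completion to one modulo `v ^ ℓ`.

module Completed (F : CommutativeRing a b) (F-field : IsField F) {q} (F-finite : IsFinite F q)
  {p} (prime : Prime p) (char : HasCharacteristic F p)
  (K : CommutativeRing c d) (K-fractions : IsFractionField (Polynomial.polynomialRing F) K)
  (v : Polynomial.Poly F) (v-irreducible : RingNotation.Irreducible (Polynomial.polynomialRing F) v)
  {N} (v-degree : PolynomialNotation.HasDegree F v N)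
  (ℓ : ℕ) (1≤ℓ : 1 ≤ ℓ)
  {lₛ lₛ′ lₖ lₜ} (S : CommutativeRing lₛ lₛ′)
  (K-S : RingRelation K S lₖ)
  (S-Q : RingRelation S (Quotient.quotientRing (Polynomial.polynomialRing F)
           (RingNotation._^_ (Polynomial.polynomialRing F) v ℓ)) lₜ)
  (ι : Polynomial.Poly F → CommutativeRing.Carrier S)
  (κ-∼-ι : ∀ x → RingRelation._∼_ K-S (IsFractionField.κ K-fractions x) (ι x))
  (ι-∼ : ∀ x → RingRelation._∼_ S-Q (ι x) x)
  (truncate : CommutativeRing.Carrier S → Polynomial.Poly F)
  (∼-truncate : ∀ x → RingRelation._∼_ S-Q x (truncate x)) where
  private
    module 𝒪    = PolynomialNotation F
    module 𝒪[X] = PolynomialNotation 𝒪.polynomialRing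
    module K[X] = PolynomialNotation K
    module S    = RingNotation S
    module S[X] = PolynomialNotation S
    module Q    = RingNotation (Quotient.quotientRing 𝒪.polynomialRing (v 𝒪.^ ℓ))
    module Q[X] = PolynomialNotation (Quotient.quotientRing 𝒪.polynomialRing (v 𝒪.^ ℓ))
    module k[X] = PolynomialNotation (Quotient.quotientRing 𝒪.polynomialRing v)
    module GF   = GlobalFactors F F-field F-finite K K-fractions
    module OP   = Polynomial 𝒪.polynomialRing
    module SP   = Polynomial S
    module SL   = PolynomialLemmas S
    module KL   = PolynomialLemmas K
  open IsFractionField K-fractions using (κ)
  open GF using (BlockFactor; module BlockFactor; blockFactor; toK[X])
  open CoefficientBounds F using (CoefficientsBelow)

  σ = ℓ ℕ.* N

  private
    module K⇒S where
      open PolynomialRelation K-S public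
      open RingRelation polynomialRelation public

      embed : ∀ p → toK[X] p ∼ₚ map ι p
      embed []      = []-∼
      embed (x ∷ p) = ∷-∼ (κ-∼-ι x) (embed p)

  private
    module S⇒Q where
      open PolynomialRelation S-Q public
      open RingRelation polynomialRelation public

      embed : ∀ p → map ι p ∼ₚ p
      embed []      = []-∼
      embed (x ∷ p) = ∷-∼ (ι-∼ x) (embed p)

      truncated : ∀ p → p ∼ₚ map truncate p
      truncated = map-∼ ∼-truncate

  monic-degree : ∀ {g} → S[X].Monic g → S[X].Irreducible g →
                 ∃ λ δ → S[X].coeff g (suc δ) S.≈ S.1# × S[X].DegreeBelow g (suc (suc δ))
  monic-degree     (suc δ , monic , below) irreducible = δ , monic , below
  monic-degree {g} (zero  , monic , below) irreducible = contradiction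
    (S[X].1# SL.P., SP.transₚ (SP.*ₚ-identityˡ g) g≈1) (S[X].Irreducible.p∤1 irreducible)
    where
    g≈1 : g S[X].≈ S[X].1#
    g≈1 .SP.at zero    = monic
    g≈1 .SP.at (suc i) = below (suc i) (s≤s z≤n)

  module Factorization
    {f n deg} (n>0 : 0 ℕ.< n) (f-degree : 𝒪[X].HasDegree f n) (f-bounded : CoefficientsBelow f (suc deg))
    (v∤lead : v 𝒪.∤ 𝒪[X].coeff f n)
    (squarefree : k[X].Squarefree f)
    {r} (fs : Vector S[X].Carrier r)
    (fs-monic : ∀ i → S[X].Monic (fs i)) (fs-irreducible : ∀ i → S[X].Irreducible (fs i))
    (f≈∏fs : map ι f S[X].≈ S[X].const (ι (𝒪[X].coeff f n)) S[X].* S[X].product fs)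
    {s} (g : Fin s → K[X].Carrier)
    (g-monic : ∀ j → K[X].Monic (g j)) (g-irreducible : ∀ j → K[X].Irreducible (g j))
    (f≈∏g : toK[X] f K[X].≈ K[X].const (κ (𝒪[X].coeff f n)) K[X].* K[X].product g)
    (ω : Fin s → Fin r → Fin 2)
    (g∼ : ∀ j → g j K⇒S.∼ₚ S[X].product (λ i → fs i S[X].^ toℕ (ω j i)))
    (Φ : Vector S[X].Carrier r)
    (Φ≈ : ∀ j → Φ j S[X].* fs j S[X].≈ map ι f S[X].* S[X].derivative (fs j))
    (α : Fin n → Fin r → 𝒪.Carrier)
    (α-below : ∀ i j → 𝒪.DegreeBelow (α i j) σ)
    (α-residue : ∀ i j → truncate (S[X].coeff (Φ j) (toℕ i)) Q.≈ α i j)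
    (bound : (2 ℕ.* n ℕ.∸ 1) ℕ.* deg ℕ.< σ) where

    gs hs : Vector Q[X].Carrier r
    gs i = map truncate (fs i)
    hs i = map truncate (Φ i)

    δ : Fin r → ℕ
    δ i = proj₁ (monic-degree (fs-monic i) (fs-irreducible i))

    B : ∀ j → BlockFactor f n deg (g j)
    B j = blockFactor f-degree f-bounded (g-monic j) (g-irreducible j)
      (KL.P.∣ʳ-respʳ-≈ (K[X].sym f≈∏g) (KL.P.x∣ʳy⇒x∣ʳzy (K[X].const (κ (𝒪[X].coeff f n))) (KL.P.∣-product g j)))

    deg<σ : deg ℕ.< σ
    deg<σ = ℕₚ.≤-<-trans (at-least n n>0) bound
      where
      at-least : ∀ n → 0 ℕ.< n → deg ≤ (2 ℕ.* n ℕ.∸ 1) ℕ.* deg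
      at-least (suc m) _ = ℕₚ.≤-trans (ℕₚ.m≤m+n deg _)
        (ℕₚ.*-monoˡ-≤ deg {1} (ℕₚ.≤-trans (s≤s z≤n) (ℕₚ.m≤n+m (suc (m ℕ.+ 0)) m)))

    private
      ∏fs : Fin s → S[X].Carrier
      ∏fs j = S[X].product (λ i → fs i S[X].^ toℕ (ω j i))

      l = 𝒪[X].coeff f n

      gs-monic : ∀ i → Q[X].coeff (gs i) (suc (δ i)) Q.≈ Q.1#
      gs-monic i = RingRelation.transfer S-Q (S⇒Q.at∼ (S⇒Q.truncated (fs i)) (suc (δ i))) (RingRelation.1-∼ S-Q)
        (proj₁ (proj₂ (monic-degree (fs-monic i) (fs-irreducible i))))

      gs-below : ∀ i → Q[X].DegreeBelow (gs i) (suc (suc (δ i)))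
      gs-below i = S⇒Q.below-∼ (S⇒Q.truncated (fs i)) (proj₂ (proj₂ (monic-degree (fs-monic i) (fs-irreducible i))))

      f≈∏gs : f Q[X].≈ Q[X].const l Q[X].* Q[X].product gs
      f≈∏gs = S⇒Q.transfer (S⇒Q.embed f)
        (S⇒Q.*-∼ (S⇒Q.const-∼ (ι-∼ l)) (S⇒Q.product-∼ (λ i → S⇒Q.truncated (fs i)))) f≈∏fs

      log-derivative : ∀ i → hs i Q[X].* gs i Q[X].≈ f Q[X].* Q[X].derivative (gs i)
      log-derivative i = S⇒Q.transfer (S⇒Q.*-∼ (S⇒Q.truncated (Φ i)) (S⇒Q.truncated (fs i)))
        (S⇒Q.*-∼ (S⇒Q.embed f) (S⇒Q.derivative-∼ (S⇒Q.truncated (fs i)))) (Φ≈ i)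

      hs-residue : ∀ i j → Q[X].coeff (hs j) (toℕ i) Q.≈ α i j
      hs-residue i j = Q.trans (RingRelation.unique S-Q (S⇒Q.at∼ (S⇒Q.truncated (Φ j)) (toℕ i))
        (∼-truncate (S[X].coeff (Φ j) (toℕ i)))) (α-residue i j)

    private
      block-∼ : ∀ j → ∏fs j S⇒Q.∼ Q[X].product (λ i → gs i Q[X].^ toℕ (ω j i))
      block-∼ j = S⇒Q.product-∼ (λ i → S⇒Q.^-∼ (toℕ (ω j i)) (S⇒Q.truncated (fs i)))

      f≈∏∏ : f Q[X].≈ Q[X].const l Q[X].* Q[X].product (λ j → Q[X].product (λ i → gs i Q[X].^ toℕ (ω j i)))
      f≈∏∏ = S⇒Q.transfer (S⇒Q.embed f) (S⇒Q.*-∼ (S⇒Q.const-∼ (ι-∼ l)) (S⇒Q.product-∼ block-∼))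
        (K⇒S.transfer (K⇒S.embed f) (K⇒S.*-∼ (K⇒S.const-∼ (κ-∼-ι l)) (K⇒S.product-∼ g∼)) f≈∏g)

      -- `G` is its leading coefficient times `g j` over `K`. The partial relation replaces `g j` by
      -- its product of local factors in the completion, and truncation carries the result to `Q`.
      G≈ : ∀ j → BlockFactor.G (B j) Q[X].≈
        Q[X].const (OP.coeff (BlockFactor.G (B j)) (BlockFactor.D (B j))) Q[X].* Q[X].product (λ i → gs i Q[X].^ toℕ (ω j i))
      G≈ j = S⇒Q.transfer (S⇒Q.embed G) (S⇒Q.*-∼ (S⇒Q.const-∼ (ι-∼ lead)) (block-∼ j))
        (K⇒S.transfer (K⇒S.embed G) (K⇒S.*-∼ (K⇒S.const-∼ (κ-∼-ι lead)) (g∼ j))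
          toK-G≈)
        where
        open BlockFactor (B j) using (G; D; toK-G≈)
        lead = OP.coeff G D

    blockStructure : BlockStructure F α ω (suc deg) σ
    blockStructure = LocalGlobal.Factored.Blocks.blockStructure F F-field F-finite prime char K K-fractions
      v v-irreducible v-degree ℓ 1≤ℓ {f} {n} {deg} f-degree v∤lead squarefree gs δ gs-monic gs-below f≈∏gs
      hs log-derivative α α-below hs-residue deg<σ n>0 g g-irreducible B ω G≈ f≈∏∏ bound

-- The concrete field, fraction field and completion satisfy the abstract hypotheses.

module FiniteFieldInstances {a b} {p w : ℕ} (Fq : FiniteField a b p w) where
  open Global Fq
  open FiniteField Fq using (enumeration)
  open Inverse enumeration using (to; from; to-cong; strictlyInverseˡ)

  to-injective : ∀ {x y} → to x ≡ to y → x 𝔽.≈ y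
  to-injective = Injection.injective (Inverse⇒Injection enumeration)

  isField : IsField (FiniteField.commutativeRing Fq)
  isField = record
    { 1≉0     = FiniteField.1≉0 Fq
    ; zero?   = λ x → FiniteField._≟_ Fq x 𝔽.0#
    ; inverse = FiniteField.inverse Fq
    }

  isFinite : IsFinite (FiniteField.commutativeRing Fq) (p ℕ.^ w)
  isFinite = record
    { 1<q            = distinct (to 𝔽.1#) (to 𝔽.0#) (λ e → FiniteField.1≉0 Fq (to-injective e))
    ; to             = to
    ; from           = from
    ; to-injective   = to-injective
    ; from-injective = λ {x} {y} e → ≡.trans (≡.sym (strictlyInverseˡ x)) (≡.trans (to-cong e) (strictlyInverseˡ y))
    }
    where
    distinct : ∀ {q} (i j : Fin q) → i ≢ j → 1 ℕ.< q
    distinct {suc zero}    zero zero i≢j = contradiction ≡.refl i≢j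
    distinct {suc (suc q)} _    _    _   = s≤s (s≤s z≤n)

  open FractionLemmas 𝒪.polynomialRing 1≉0 cancel

  isFractionField : IsFractionField 𝒪.polynomialRing Frac.fractionField
  isFractionField = record
    { isField     = record
      { 1≉0     = fraction-1≉0
      ; zero?   = fraction-zero? (FieldPolynomials.zeroₚ? (FiniteField.commutativeRing Fq) isField)
      ; inverse = fraction-inverse
      }
    ; κ           = Frac.κ
    ; κ-cong      = κ-cong
    ; κ-0         = Frac.mk≈ᶠ 𝒪.refl
    ; κ-1         = Frac.mk≈ᶠ 𝒪.refl
    ; κ-+         = κ-+
    ; κ-*         = κ-*
    ; κ-injective = κ-injective
    ; fraction    = λ x → Frac.num x , Frac.den x , Frac.den≉0 x , κ-den-* x
    }

module CompletionInstances {a b} {p w : ℕ} (Fq : FiniteField a b p w)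
  (v : Global.𝒪.Carrier Fq) (irreducible : Global.𝒪.Irreducible Fq v)
  {N} (v-degree : Global.𝒪.HasDegree Fq v N) where
  open Global Fq
  open Local v
  open FiniteFieldInstances Fq
  private
    module CL = CompletionLemmas 𝒪.polynomialRing v
    module RF = ResidueField (FiniteField.commutativeRing Fq) isField v irreducible v-degree
    module FP = FieldPolynomials (FiniteField.commutativeRing Fq) isField

  ι-regular : ∀ {x} → x 𝒪.≉ 𝒪.0# → CommutativeRingLemmas.Regular Compl.completionRing (ι x)
  ι-regular {x} x≉0 = regular (RF.valuation x x≉0)
    where
    regular : (∃ λ n → ∃ λ y → x 𝒪.≈ v 𝒪.^ n 𝒪.* y × ¬ (v 𝒪.∣ y)) → CommutativeRingLemmas.Regular Compl.completionRing (ι x)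
    regular (n , y , x≈ , v∤y) = CL.ι-regular
      (PolynomialLemmas.lead-regular (FiniteField.commutativeRing Fq) {v} (proj₂ v-degree) (FP.nonzero-regular (proj₁ v-degree)))
      {x} {y} n x≈ (λ k {z} → RF.^-comaximal-∣ {y} v∤y k {z})

  isRegularEmbedding : IsRegularEmbedding 𝒪.polynomialRing Compl.completionRing ι
  isRegularEmbedding = record
    { ι-cong    = λ e → Compl.mk≈ᵥ λ k → Quotient.fromEq 𝒪.polynomialRing (v 𝒪.^ k) e
    ; ι-0       = Compl.mk≈ᵥ λ k → Quotient.fromEq 𝒪.polynomialRing (v 𝒪.^ k) 𝒪.refl
    ; ι-1       = Compl.mk≈ᵥ λ k → Quotient.fromEq 𝒪.polynomialRing (v 𝒪.^ k) 𝒪.refl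
    ; ι-+       = λ x y → Compl.mk≈ᵥ λ k → Quotient.fromEq 𝒪.polynomialRing (v 𝒪.^ k) 𝒪.refl
    ; ι-*       = λ x y → Compl.mk≈ᵥ λ k → Quotient.fromEq 𝒪.polynomialRing (v 𝒪.^ k) 𝒪.refl
    ; ι-regular = λ {x} → ι-regular {x}
    }

-- Vanishing vectors over the prime field and the span of the blocks.

module BlockSpan {a b} {p w : ℕ} (Fq : FiniteField a b p w) (B : Global.Basis Fq)
  {n r s} {α : Fin n → Fin r → Global.𝒪.Carrier Fq} {ω : Fin s → Fin r → Fin 2} {D σ : ℕ}
  (structure : BlockStructure (FiniteField.commutativeRing Fq) α ω D σ) where
  open Global Fq using (module 𝔽; module 𝔽ₚ; 𝔽ₚ⇒𝔽)
  open BlockStructure structure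
  open HighCoefficients (FiniteField.commutativeRing Fq) α D σ
  open PrimeField Fq
  private
    module R  = CommutativeRingLemmas (FiniteField.commutativeRing Fq)
    module Rₚ = CommutativeRingLemmas (Quotient.quotientRing ℤₚ.+-*-commutativeRing (ℤ.+ p))

  vanishing⇒span : ∀ e → Vanishing (𝔽ₚ⇒𝔽 ∘ e) → 𝔽ₚ.Span (λ j i → ℤ.+ toℕ (ω j i)) e
  vanishing⇒span e vanishing = x , spans
    where
    value : ∀ {j} → Dec (∃ λ i → ω j i ≡ suc zero) → ℤ.ℤ
    value (yes (i , _)) = e i
    -- The vector of a block without members is zero, so any coefficient would do.
    value (no _)        = ℤ.+ 0
    member? : ∀ j → Dec (∃ λ i → ω j i ≡ suc zero)
    member? j = Finₚ.any? (λ i → ω j i Finₚ.≟ suc zero)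
    x : Vector ℤ.ℤ s
    x j = value (member? j)
    value≈ : ∀ {i j} → ω j i ≡ suc zero → (m : Dec (∃ λ i → ω j i ≡ suc zero)) → e i 𝔽ₚ.≈ value m
    value≈ {i} i∈j (no ¬m)         = contradiction (i , i∈j) ¬m
    -- Constancy on blocks is an equality in `𝔽_q`; injectivity of `𝔽ₚ⇒𝔽` brings it back to the
    -- prime field, so the choice of member does not matter.
    value≈ {i} {j} i∈j (yes (i′ , i′∈j)) = Rₚ.x∙y⁻¹≈ε⇒x≈y (e i) (e i′) (𝔽ₚ⇒𝔽-injective B (e i ℤ.- e i′) (begin
      𝔽ₚ⇒𝔽 (e i ℤ.- e i′)             ≈⟨ 𝔽ₚ⇒𝔽-+ (e i) (ℤ.- e i′) ⟩
      𝔽ₚ⇒𝔽 (e i) 𝔽.+ 𝔽ₚ⇒𝔽 (ℤ.- e i′)  ≈⟨ 𝔽.+-congˡ (𝔽ₚ⇒𝔽-neg (e i′)) ⟩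
      𝔽ₚ⇒𝔽 (e i) 𝔽.- 𝔽ₚ⇒𝔽 (e i′)      ≈⟨ R.x≈y⇒x∙y⁻¹≈ε (block-constant {e = 𝔽ₚ⇒𝔽 ∘ e} i∈j i′∈j vanishing) ⟩
      𝔽.0#                             ∎))
      where open SetoidReasoning 𝔽.setoid
    spans : ∀ i → e i 𝔽ₚ.≈ 𝔽ₚ.sum (λ j → x j 𝔽ₚ.* (ℤ.+ toℕ (ω j i)))
    spans i = begin
      e i                                          ≈⟨ value≈ i∈j (member? j) ⟩
      x j                                          ≡⟨ ℤₚ.*-identityʳ (x j) ⟨
      x j ℤ.* ℤ.+ 1                                ≡⟨ ≡.cong (λ k → x j ℤ.* ℤ.+ toℕ k) i∈j ⟨
      x j ℤ.* ℤ.+ toℕ (ω j i)                      ≈⟨ Rₚ.sum-single (λ j → x j 𝔽ₚ.* (ℤ.+ toℕ (ω j i))) j others ⟨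
      𝔽ₚ.sum (λ j → x j 𝔽ₚ.* (ℤ.+ toℕ (ω j i)))    ∎
      where
      open SetoidReasoning 𝔽ₚ.setoid
      j   = proj₁ (in-some-block i)
      i∈j = proj₂ (in-some-block i)
      others : ∀ k → k ≢ j → x k 𝔽ₚ.* (ℤ.+ toℕ (ω k i)) 𝔽ₚ.≈ 𝔽ₚ.0#
      others k k≢j with ω k i in eq
      ... | zero     = 𝔽ₚ.zeroʳ (x k)
      ... | suc zero = contradiction (in-unique-block eq i∈j) k≢j

  span⇒vanishing : ∀ e → 𝔽ₚ.Span (λ j i → ℤ.+ toℕ (ω j i)) e → Vanishing (𝔽ₚ⇒𝔽 ∘ e)
  span⇒vanishing e (x , spans) = vanishing-combination (𝔽ₚ⇒𝔽 ∘ x) (λ j i → toℕ (ω j i) 𝔽.· 𝔽.1#)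
    (λ j → block-vanishing j (λ i → toℕ (ω j i) 𝔽.· 𝔽.1#) (λ i → 𝔽.refl)) {𝔽ₚ⇒𝔽 ∘ e} λ i → begin
      𝔽ₚ⇒𝔽 (e i)                                          ≈⟨ 𝔽ₚ⇒𝔽-cong (spans i) ⟩
      𝔽ₚ⇒𝔽 (𝔽ₚ.sum (λ j → x j ℤ.* (ℤ.+ toℕ (ω j i))))     ≈⟨ 𝔽ₚ⇒𝔽-sum (λ j → x j ℤ.* (ℤ.+ toℕ (ω j i))) ⟩
      𝔽.sum (λ j → 𝔽ₚ⇒𝔽 (x j ℤ.* (ℤ.+ toℕ (ω j i))))      ≈⟨ R.sum-cong-≋ (λ j → 𝔽ₚ⇒𝔽-* (x j) (ℤ.+ toℕ (ω j i))) ⟩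
      𝔽.sum (λ j → 𝔽ₚ⇒𝔽 (x j) 𝔽.* (toℕ (ω j i) 𝔽.· 𝔽.1#)) ∎
    where open SetoidReasoning 𝔽.setoid

-- Equality of `L′` and `W`.

open import Data.Integer.Base using (+_)
open import Data.Nat.Base using (_+_; _*_; _∸_; _<_)

theorem5p2 :
    ∀ {a b} {p w : ℕ} (Fq : FiniteField a b p w) →
    let open Global Fq in
    (B : Basis)
    (f : 𝒪[X].Carrier) (n : ℕ) → 2 ≤ n → 𝒪[X].HasDegree f n →
    Separable f →
    let ℓf = 𝒪[X].coeff f n in
    (v : 𝒪.Carrier) → 𝒪.Irreducible v → v 𝒪.∤ ℓf →
    let open Local v in
    k[X].Squarefree (reduce f) →
    -- f = ℓf f₁ ⋯ fᵣ over 𝒪ᵥ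
    ∀ {r} (fs : Vector 𝒪ᵥ[X].Carrier r) →
    (∀ i → 𝒪ᵥ[X].Monic (fs i)) → (∀ i → 𝒪ᵥ[X].Irreducible (fs i)) →
    to𝒪ᵥ[X] f 𝒪ᵥ[X].≈ 𝒪ᵥ[X].const (ι ℓf) 𝒪ᵥ[X].* 𝒪ᵥ[X].product fs →
    -- f = ℓf g₁ ⋯ gₛ over K
    ∀ {s} (gs : Vector K[X].Carrier s) →
    (∀ j → K[X].Monic (gs j)) → (∀ j → K[X].Irreducible (gs j)) →
    toK[X] f K[X].≈ K[X].const (Frac.κ ℓf) K[X].* K[X].product gs →
    -- the exponents w_{j,i} ∈ {0,1}
    (ω : Fin s → Fin r → Fin 2) →
    (∀ j → gs j ≈ᴷᵛ[X] 𝒪ᵥ[X].product (λ i → fs i 𝒪ᵥ[X].^ toℕ (ω j i))) →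
    (ℓ deg-v d : ℕ) → 1 ≤ ℓ → 𝒪.HasDegree v deg-v → HasDegreeₜ f d →
    let σ = ℓ * deg-v
        m = d + 1
    in
    -- Φ(fⱼ) = f fⱼ′ / fⱼ
    (Φ : Vector 𝒪ᵥ[X].Carrier r) →
    (∀ j → Φ j 𝒪ᵥ[X].* fs j 𝒪ᵥ[X].≈ to𝒪ᵥ[X] f 𝒪ᵥ[X].* 𝒪ᵥ[X].derivative (fs j)) →
    -- the coefficients a_{i,j} of Φ(fⱼ) mod v^ℓ
    (α : Fin n → Fin r → 𝒪.Carrier) →
    (∀ i j → IsResidue ℓ σ (𝒪ᵥ[X].coeff (Φ j) (toℕ i)) (α i j)) →
    let A : Fin n → 𝔽.Matrix (σ ∸ m) r
        A = λ i k j → φ m σ (α i j) k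
        W = 𝔽ₚ.Span (λ j i → + toℕ (ω j i))
        L′ = λ (e : Vector 𝔽ₚ.Carrier r) → ∀ i → 𝔽ₚ.Kernel (expand B (A i)) e
    in
    (2 * n ∸ 1) * d < σ →
    ∀ e → L′ e ⇔ W e
theorem5p2 Fq B f n 2≤n f-degree _ v v-irreducible v∤ℓf squarefree
  fs fs-monic fs-irreducible f≈∏fs gs gs-monic gs-irreducible f≈∏gs ω gs≈
  ℓ deg-v d 1≤ℓ v-degree (f-bounded , _) Φ Φ≈ α α-residue bound e =
  mk⇔ (λ L′e → vanishing⇒span e (kernel⇒vanishing L′e)) (λ We → vanishing⇒kernel (span⇒vanishing e We))
  where
  open Global Fq
  open FiniteFieldInstances Fq

  embedding = CompletionInstances.isRegularEmbedding Fq v v-irreducible v-degree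

  σ = ℓ * deg-v
  m = d + 1

  structure : BlockStructure (FiniteField.commutativeRing Fq) α ω (suc d) σ
  structure = Completed.Factorization.blockStructure (FiniteField.commutativeRing Fq) isField isFinite
    (FiniteField.p-prime Fq) (FiniteField.characteristic Fq) Frac.fractionField isFractionField
    v v-irreducible v-degree ℓ 1≤ℓ (Local.Compl.completionRing v)
    (FractionRelation.fraction-relation 𝒪.polynomialRing 1≉0 cancel (Local.Compl.completionRing v) (Local.ι v) embedding)
    (CompletionLemmas.truncation 𝒪.polynomialRing v ℓ) (Local.ι v)
    (FractionRelation.κ-∼-ι 𝒪.polynomialRing 1≉0 cancel (Local.Compl.completionRing v) (Local.ι v) embedding)
    (λ x → Quotient.fromEq 𝒪.polynomialRing (v 𝒪.^ ℓ) 𝒪.refl)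
    (λ x → Local.Compl.seq {v} x ℓ)
    (λ x → Quotient.fromEq 𝒪.polynomialRing (v 𝒪.^ ℓ) 𝒪.refl)
    (ℕₚ.<-≤-trans (s≤s z≤n) 2≤n) f-degree f-bounded v∤ℓf squarefree
    fs fs-monic fs-irreducible f≈∏fs gs gs-monic gs-irreducible f≈∏gs
    ω (λ j → PolynomialRelation.mk∼ₚ (gs≈ j)) Φ Φ≈ α (λ i j → proj₁ (α-residue i j))
    (λ i j → CompletionLemmas.residue-≡ 𝒪.polynomialRing v ℓ (Local.𝒪ᵥ[X].coeff v (Φ j) (toℕ i)) (α i j) (proj₂ (α-residue i j)))
    bound

  open BlockSpan Fq B structure
  open HighCoefficients (FiniteField.commutativeRing Fq) α (suc d) σ
  open PrimeField Fq using (kernel-expand; expand-kernel)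

  A : Fin n → 𝔽.Matrix (σ ∸ m) _
  A i k j = φ m σ (α i j) k

  kernel⇒vanishing : (∀ i → 𝔽ₚ.Kernel (expand B (A i)) e) → Vanishing (𝔽ₚ⇒𝔽 ∘ e)
  -- Row `k` of `A i` holds the coefficients at `t ^ (m + k)`, so the power `τ` is found in row
  -- `τ ∸ m`.
  kernel⇒vanishing h i τ d<τ τ<σ = ≡.subst (λ τ → 𝔽.sum (λ j → 𝔽ₚ⇒𝔽 (e j) 𝔽.* 𝒪.coeff (α i j) τ) 𝔽.≈ 𝔽.0#)
    (≡.trans (≡.cong (_+_ m) (Finₚ.toℕ-fromℕ< k<)) (ℕₚ.m+[n∸m]≡n m≤τ))
    (kernel-expand B (A i) e (h i) (Fin.fromℕ< k<))
    where
    m≤τ : m ≤ τ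
    m≤τ = ≡.subst (_≤ τ) (ℕₚ.+-comm 1 d) d<τ
    k< : τ ∸ m < σ ∸ m
    k< = ℕₚ.∸-monoˡ-< τ<σ m≤τ

  vanishing⇒kernel : Vanishing (𝔽ₚ⇒𝔽 ∘ e) → ∀ i → 𝔽ₚ.Kernel (expand B (A i)) e
  vanishing⇒kernel h i = expand-kernel B (A i) e (λ k → h i (m + toℕ k)
    (≡.subst (_≤ m + toℕ k) (ℕₚ.+-comm d 1) (ℕₚ.m≤m+n m (toℕ k)))
    (below-σ k))
    where
    below-σ : (k : Fin (σ ∸ m)) → m + toℕ k < σ
    below-σ k = ℕₚ.<-≤-trans (ℕₚ.+-monoʳ-< m (Finₚ.toℕ<n k)) (ℕₚ.≤-reflexive (ℕₚ.m+[n∸m]≡n (m≤σ k)))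
      where
      -- Truncated subtraction would leave no row at all if `σ` were smaller than `m`, so the
      -- existence of `k` gives the inequality.
      m≤σ : Fin (σ ∸ m) → m ≤ σ
      m≤σ k = ℕₚ.≮⇒≥ λ σ<m → ℕₚ.n≮0 (≡.subst (toℕ k <_) (ℕₚ.m≤n⇒m∸n≡0 (ℕₚ.<⇒≤ σ<m)) (Finₚ.toℕ<n k))
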